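{- For every fixed $\epsilon>0$ there exists $d_0=d_0(\epsilon)$ such that for every fixed integer $d\ge d_0$, asymptotically almost surely $G\in\mathcal{G}_{n,d}$ contains no $q$-bipartite hole with $q\ge(1+\epsilon)\frac{2n\log d}{d}$. As a consequence, a.a.s. \[ Z(G)\ge n\left(1-(1+\epsilon)\frac{4\log d}{d}\right). \]
   Context: $\mathcal{G}_{n,d}$ denotes the uniform probability space of (simple) $d$-regular graphs on $n$ labelled vertices, with $d$ fixed, $n\to\infty$, and $n$ even if $d$ is odd; a.a.s. means with probability tending to $1$ as $n\to\infty$. $\log$ is the natural logarithm. A $q$-bipartite hole in a graph is a pair of disjoint vertex sets $A_1,A_2$ with $|A_1|=|A_2|=q$ such that there is no edge with one end in $A_1$ and the other in $A_2$. Zero forcing: starting from a set of black vertices (others white), repeatedly a black vertex with exactly one white neighbour forces that neighbour to become black; a zero forcing set is one from which all vertices eventually become black, and $Z(G)$ is the minimum size of a zero forcing set. -}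

module Defs where

open import Data.Nat.Base as ℕ using (ℕ; zero; suc; z≤n; s≤s)
import Data.Nat.Properties as ℕ
open import Data.Nat.Divisibility using (_∣_)
open import Data.Integer.Base as ℤ using (+_; +[1+_])
import Data.Integer.Properties as ℤ
open import Data.Rational.Base as ℚ using (ℚ; mkℚ; 0ℚ; 1ℚ; ½; ∣_∣)
import Data.Rational.Properties as ℚ
open import Data.Rational.Unnormalised.Base as ℚᵘ using (mkℚᵘ)
import Data.Rational.Unnormalised.Properties as ℚᵘ
open import Data.Rational.Solver using (module +-*-Solver)
open import Algebra.Definitions.RawSemiring ℚ.+-*-rawSemiring using (_^_)
open import Data.Bool.Base using (true; false)
open import Data.Fin.Base using (Fin)
open import Data.Fin.Properties using (all?)
open import Data.Fin.Subset using (Subset; _∈_; _∉_; _∪_; _∩_; ⁅_⁆; ⊤; Empty)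
  renaming (∣_∣ to #_)
open import Data.Fin.Subset.Properties using (_∈?_)
open import Data.List.Base using (List; []; _∷_; length; filter; cartesianProductWith)
open import Data.List.Relation.Unary.All using (All)
open import Data.List.Relation.Binary.Sublist.Propositional using (_⊆_)
open import Data.Product.Base using (_×_; _,_; proj₁; proj₂; ∃-syntax)
open import Data.Sum.Base using (inj₁; inj₂)
open import Data.Vec.Base using (Vec; []; _∷_; lookup)
open import Relation.Nullary using (¬_; Dec)
open import Relation.Nullary.Decidable using (_×-dec_; _→-dec_; ¬?)
open import Relation.Binary.Construct.Closure.ReflexiveTransitive using (Star)
open import Relation.Binary.PropositionalEquality
  using (_≡_; refl; sym; trans; cong; subst; subst₂)


IsCauchy : (ℕ → ℚ) → Set
IsCauchy s = ∀ (η : ℚ) → 0ℚ ℚ.< η →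
  ∃[ N ] ∀ m n → N ℕ.≤ m → N ℕ.≤ n → ∣ s m ℚ.- s n ∣ ℚ.≤ η

record ℝ : Set where
  constructor mkℝ
  field
    seq    : ℕ → ℚ
    cauchy : IsCauchy seq

open ℝ public

infix 4 _≤_ _<_

_≤_ : ℝ → ℝ → Set
x ≤ y = ∀ (η : ℚ) → 0ℚ ℚ.< η → ∃[ N ] ∀ n → N ℕ.≤ n → seq x n ℚ.≤ seq y n ℚ.+ η

_<_ : ℝ → ℝ → Set
x < y = ∃[ η ] 0ℚ ℚ.< η × ∃[ N ] ∀ n → N ℕ.≤ n → seq x n ℚ.+ η ℚ.≤ seq y n

private
  open +-*-Solver using (solve; _:+_; _:*_; _:-_; :-_; _:=_; con)

  half-pos : ∀ {η} → 0ℚ ℚ.< η → 0ℚ ℚ.< ½ ℚ.* η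
  half-pos {η} 0<η = ℚ.positive⁻¹ _ {{ℚ.pos*pos⇒pos ½ η {{ℚ.positive 0<η}}}}

  halves : ∀ η → ½ ℚ.* η ℚ.+ ½ ℚ.* η ≡ η
  halves η = trans (sym (ℚ.*-distribʳ-+ η ½ ½)) (ℚ.*-identityˡ η)

  *-mono-≤ : ∀ {a b c d} → 0ℚ ℚ.≤ c → 0ℚ ℚ.≤ b → a ℚ.≤ b → c ℚ.≤ d → a ℚ.* c ℚ.≤ b ℚ.* d
  *-mono-≤ {a} {b} {c} {d} 0≤c 0≤b a≤b c≤d = ℚ.≤-trans
    (ℚ.*-monoʳ-≤-nonNeg c {{ℚ.nonNegative 0≤c}} a≤b)
    (ℚ.*-monoˡ-≤-nonNeg b {{ℚ.nonNegative 0≤b}} c≤d)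

  const-cauchy : ∀ p → IsCauchy (λ _ → p)
  const-cauchy p η 0<η = 0 , λ _ _ _ _ →
    subst (ℚ._≤ η) (sym (cong ∣_∣ (ℚ.+-inverseʳ p))) (ℚ.<⇒≤ 0<η)

  +-cauchy : ∀ {s t} → IsCauchy s → IsCauchy t → IsCauchy (λ n → s n ℚ.+ t n)
  +-cauchy {s} {t} cs ct η 0<η =
    let M , bs = cs (½ ℚ.* η) (half-pos 0<η)
        N , bt = ct (½ ℚ.* η) (half-pos 0<η)
    in M ℕ.⊔ N , λ m n m≥ n≥ →
      subst₂ ℚ._≤_
        (cong ∣_∣ (solve 4 (λ a b c d → (a :- b) :+ (c :- d) := (a :+ c) :- (b :+ d))
                    refl (s m) (s n) (t m) (t n)))
        (halves η)
        (ℚ.≤-trans (ℚ.∣p+q∣≤∣p∣+∣q∣ (s m ℚ.- s n) (t m ℚ.- t n))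
          (ℚ.+-mono-≤
            (bs m n (ℕ.≤-trans (ℕ.m≤m⊔n M N) m≥) (ℕ.≤-trans (ℕ.m≤m⊔n M N) n≥))
            (bt m n (ℕ.≤-trans (ℕ.m≤n⊔m M N) m≥) (ℕ.≤-trans (ℕ.m≤n⊔m M N) n≥))))

  neg-cauchy : ∀ {s} → IsCauchy s → IsCauchy (λ n → ℚ.- s n)
  neg-cauchy {s} cs η 0<η =
    let N , b = cs η 0<η
    in N , λ m n m≥ n≥ → subst (ℚ._≤ η)
      (trans (sym (ℚ.∣-p∣≡∣p∣ (s m ℚ.- s n)))
        (cong ∣_∣ (solve 2 (λ a b → :- (a :- b) := :- a :- (:- b)) refl (s m) (s n))))
      (b m n m≥ n≥)

  bounded : ∀ {s} → IsCauchy s →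
    ∃[ B ] 0ℚ ℚ.< B × ∃[ N ] ∀ n → N ℕ.≤ n → ∣ s n ∣ ℚ.≤ B
  bounded {s} cs =
    let N , b = cs 1ℚ (ℚ.positive⁻¹ 1ℚ)
    in 1ℚ ℚ.+ ∣ s N ∣
     , ℚ.+-mono-<-≤ (ℚ.positive⁻¹ 1ℚ) (ℚ.0≤∣p∣ (s N))
     , N , λ n n≥ → ℚ.≤-trans
         (subst (ℚ._≤ ∣ s n ℚ.- s N ∣ ℚ.+ ∣ s N ∣)
           (cong ∣_∣ (solve 2 (λ a b → (a :- b) :+ b := a) refl (s n) (s N)))
           (ℚ.∣p+q∣≤∣p∣+∣q∣ (s n ℚ.- s N) (s N)))
         (ℚ.+-monoˡ-≤ ∣ s N ∣ (b n N n≥ ℕ.≤-refl))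

  shrink : ∀ B η → 0ℚ ℚ.< B → 0ℚ ℚ.< η → ∃[ θ ] 0ℚ ℚ.< θ × B ℚ.* θ ≡ η
  shrink B η 0<B 0<η =
    (ℚ.1/ B) ℚ.* η
    , ℚ.positive⁻¹ _ {{ℚ.pos*pos⇒pos (ℚ.1/ B) {{ℚ.1/pos⇒pos B}} η {{ℚ.positive 0<η}}}}
    , trans (sym (ℚ.*-assoc B (ℚ.1/ B) η))
        (trans (cong (ℚ._* η) (ℚ.*-inverseʳ B)) (ℚ.*-identityˡ η))
    where
    instance
      B-pos : ℚ.Positive B
      B-pos = ℚ.positive 0<B
      B-nz : ℚ.NonZero B
      B-nz = ℚ.pos⇒nonZero B

  *-cauchy : ∀ {s t} → IsCauchy s → IsCauchy t → IsCauchy (λ n → s n ℚ.* t n)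
  *-cauchy {s} {t} cs ct η 0<η =
    let A , 0<A , K , bA    = bounded {s} cs
        B , 0<B , L , bB    = bounded {t} ct
        α , 0<α , Bα≡       = shrink B (½ ℚ.* η) 0<B (half-pos 0<η)
        β , 0<β , Aβ≡       = shrink A (½ ℚ.* η) 0<A (half-pos 0<η)
        M , bs              = cs α 0<α
        N , bt              = ct β 0<β
    in (K ℕ.⊔ L) ℕ.⊔ (M ℕ.⊔ N) , λ m n m≥ n≥ →
      let kl≤m = ℕ.m⊔n≤o⇒m≤o (K ℕ.⊔ L) (M ℕ.⊔ N) m≥
          kl≤n = ℕ.m⊔n≤o⇒m≤o (K ℕ.⊔ L) (M ℕ.⊔ N) n≥
          mn≤m = ℕ.m⊔n≤o⇒n≤o (K ℕ.⊔ L) (M ℕ.⊔ N) m≥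
          mn≤n = ℕ.m⊔n≤o⇒n≤o (K ℕ.⊔ L) (M ℕ.⊔ N) n≥
          Δs = s m ℚ.- s n
          Δt = t m ℚ.- t n
          bound₁ : ∣ s m ℚ.* Δt ∣ ℚ.≤ ½ ℚ.* η
          bound₁ = subst₂ ℚ._≤_ (sym (ℚ.∣p*q∣≡∣p∣*∣q∣ (s m) Δt)) Aβ≡
            (*-mono-≤ (ℚ.0≤∣p∣ Δt) (ℚ.<⇒≤ 0<A)
              (bA m (ℕ.m⊔n≤o⇒m≤o K L kl≤m))
              (bt m n (ℕ.m⊔n≤o⇒n≤o M N mn≤m) (ℕ.m⊔n≤o⇒n≤o M N mn≤n)))
          bound₂ : ∣ t n ℚ.* Δs ∣ ℚ.≤ ½ ℚ.* η
          bound₂ = subst₂ ℚ._≤_ (sym (ℚ.∣p*q∣≡∣p∣*∣q∣ (t n) Δs)) Bα≡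
            (*-mono-≤ (ℚ.0≤∣p∣ Δs) (ℚ.<⇒≤ 0<B)
              (bB n (ℕ.m⊔n≤o⇒n≤o K L kl≤n))
              (bs m n (ℕ.m⊔n≤o⇒m≤o M N mn≤m) (ℕ.m⊔n≤o⇒m≤o M N mn≤n)))
      in subst₂ ℚ._≤_
        (cong ∣_∣ (solve 4 (λ a b c d → a :* (c :- d) :+ d :* (a :- b) := a :* c :- b :* d)
                    refl (s m) (s n) (t m) (t n)))
        (halves η)
        (ℚ.≤-trans (ℚ.∣p+q∣≤∣p∣+∣q∣ (s m ℚ.* Δt) (t n ℚ.* Δs))
          (ℚ.+-mono-≤ bound₁ bound₂))

infixl 6 _+_ _-_
infixl 7 _*_ _/_
infix  8 -_

fromℚ : ℚ → ℝ
fromℚ p = mkℝ (λ _ → p) (const-cauchy p)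

fromℕ : ℕ → ℝ
fromℕ n = fromℚ (+ n ℚ./ 1)

_+_ : ℝ → ℝ → ℝ
x + y = mkℝ (λ n → seq x n ℚ.+ seq y n) (+-cauchy {seq x} {seq y} (cauchy x) (cauchy y))

-_ : ℝ → ℝ
- x = mkℝ (λ n → ℚ.- seq x n) (neg-cauchy {seq x} (cauchy x))

_-_ : ℝ → ℝ → ℝ
x - y = x + (- y)

_*_ : ℝ → ℝ → ℝ
x * y = mkℝ (λ n → seq x n ℚ.* seq y n) (*-cauchy {seq x} {seq y} (cauchy x) (cauchy y))

_/_ : ℝ → (d : ℕ) .{{_ : ℕ.NonZero d}} → ℝ
x / d = x * fromℚ (+ 1 ℚ./ d)

-- Partial sums of the Mercator series for the natural logarithm:
--   log d = - log (1 - (d-1)/d) = Σ_{k≥1} ((d-1)/d)ᵏ / k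
logTerm : (d : ℕ) .{{_ : ℕ.NonZero d}} → ℕ → ℚ
logTerm d k = (+ (d ℕ.∸ 1) ℚ./ d) ^ suc k ℚ.* (+ 1 ℚ./ suc k)

logSum : (d : ℕ) .{{_ : ℕ.NonZero d}} → ℕ → ℚ
logSum d zero    = 0ℚ
logSum d (suc m) = logSum d m ℚ.+ logTerm d m

private
  squeeze : (s u : ℕ → ℚ) →
    (∀ n → s n ℚ.≤ s (suc n)) → (∀ n → u (suc n) ℚ.≤ u n) → (∀ n → s n ℚ.≤ u n) →
    (∀ η → 0ℚ ℚ.< η → ∃[ N ] u N ℚ.- s N ℚ.≤ η) → IsCauchy s
  squeeze s u s↑ u↓ s≤u gap η 0<η =
    let N , g = gap η 0<η
    in N , λ m n m≥ n≥ → ℚ.≤-trans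
      (within (up m≥) (top m≥) (up n≥) (top n≥)) g
    where
    mono : ∀ {m n} → m ℕ.≤′ n → s m ℚ.≤ s n
    mono (ℕ.≤′-reflexive refl) = ℚ.≤-refl
    mono (ℕ.≤′-step p)         = ℚ.≤-trans (mono p) (s↑ _)

    anti : ∀ {m n} → m ℕ.≤′ n → u n ℚ.≤ u m
    anti (ℕ.≤′-reflexive refl) = ℚ.≤-refl
    anti (ℕ.≤′-step p)         = ℚ.≤-trans (u↓ _) (anti p)

    up : ∀ {m n} → m ℕ.≤ n → s m ℚ.≤ s n
    up p = mono (ℕ.≤⇒≤′ p)

    top : ∀ {m n} → m ℕ.≤ n → s n ℚ.≤ u m
    top p = ℚ.≤-trans (s≤u _) (anti (ℕ.≤⇒≤′ p))

    within : ∀ {a b x y} → a ℚ.≤ x → x ℚ.≤ b → a ℚ.≤ y → y ℚ.≤ b →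
      ∣ x ℚ.- y ∣ ℚ.≤ b ℚ.- a
    within {a} {b} {x} {y} a≤x x≤b a≤y y≤b with ℚ.∣p∣≡p∨∣p∣≡-p (x ℚ.- y)
    ... | inj₁ e = subst (ℚ._≤ b ℚ.- a) (sym e)
          (ℚ.+-mono-≤ x≤b (ℚ.neg-antimono-≤ a≤y))
    ... | inj₂ e = subst (ℚ._≤ b ℚ.- a)
          (sym (trans e (solve 2 (λ x y → :- (x :- y) := y :- x) refl x y)))
          (ℚ.+-mono-≤ y≤b (ℚ.neg-antimono-≤ a≤x))

  frac-≤ : ∀ a b c d .{{_ : ℕ.NonZero b}} .{{_ : ℕ.NonZero d}} →
    a ℕ.* d ℕ.≤ c ℕ.* b → + a ℚ./ b ℚ.≤ + c ℚ./ d
  frac-≤ a b@(suc _) c d@(suc _) p = ℚ.toℚᵘ-cancel-≤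
    (ℚᵘ.≤-respˡ-≃ (ℚᵘ.≃-sym (ℚ.toℚᵘ-fromℚᵘ (mkℚᵘ (+ a) _)))
      (ℚᵘ.≤-respʳ-≃ (ℚᵘ.≃-sym (ℚ.toℚᵘ-fromℚᵘ (mkℚᵘ (+ c) _)))
        (ℚᵘ.*≤* (subst₂ ℤ._≤_ (ℤ.pos-* a d) (ℤ.pos-* c b) (ℤ.+≤+ p)))))

  0≤frac : ∀ a b .{{_ : ℕ.NonZero b}} → 0ℚ ℚ.≤ + a ℚ./ b
  0≤frac a b = ℚ.nonNegative⁻¹ _ {{ℚ.normalize-nonNeg a b}}

  module Log (d-1 : ℕ) where
    d : ℕ
    d = suc d-1

    D x : ℚ
    D = + d ℚ./ 1
    x = + d-1 ℚ./ d

    c : ℕ → ℚ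
    c k = + 1 ℚ./ suc k

    1+Dx≡D : 1ℚ ℚ.+ D ℚ.* x ≡ D
    1+Dx≡D = ℚ.toℚᵘ-injective (begin
      ℚ.toℚᵘ (1ℚ ℚ.+ D ℚ.* x)
        ≈⟨ ℚ.toℚᵘ-homo-+ 1ℚ (D ℚ.* x) ⟩
      ℚᵘ.1ℚᵘ ℚᵘ.+ ℚ.toℚᵘ (D ℚ.* x)
        ≈⟨ ℚᵘ.+-congʳ ℚᵘ.1ℚᵘ (ℚ.toℚᵘ-homo-* D x) ⟩
      ℚᵘ.1ℚᵘ ℚᵘ.+ ℚ.toℚᵘ D ℚᵘ.* ℚ.toℚᵘ x
        ≈⟨ ℚᵘ.+-congʳ ℚᵘ.1ℚᵘ (ℚᵘ.*-cong
             (ℚ.toℚᵘ-fromℚᵘ (mkℚᵘ (+ d) 0)) (ℚ.toℚᵘ-fromℚᵘ (mkℚᵘ (+ d-1) d-1))) ⟩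
      ℚᵘ.1ℚᵘ ℚᵘ.+ mkℚᵘ (+ d) 0 ℚᵘ.* mkℚᵘ (+ d-1) d-1
        ≈⟨ ℚᵘ.*≡* arith ⟩
      mkℚᵘ (+ d) 0
        ≈⟨ ℚ.toℚᵘ-fromℚᵘ (mkℚᵘ (+ d) 0) ⟨
      ℚ.toℚᵘ D ∎)
      where
      open ℚᵘ.≃-Reasoning
      open import Data.Integer.Tactic.RingSolver using (solve-∀)
      go : ∀ a → (+ 1 ℤ.* (+ 1 ℤ.* (+ 1 ℤ.+ a)) ℤ.+ (+ 1 ℤ.+ a) ℤ.* a ℤ.* + 1) ℤ.* + 1
               ≡ (+ 1 ℤ.+ a) ℤ.* (+ 1 ℤ.* (+ 1 ℤ.* (+ 1 ℤ.+ a)))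
      go = solve-∀
      arith : (+ 1 ℤ.* (+ 1 ℤ.* + d) ℤ.+ + d ℤ.* + d-1 ℤ.* + 1) ℤ.* + 1
            ≡ + d ℤ.* (+ 1 ℤ.* (+ 1 ℤ.* + d))
      arith = go (+ d-1)

    0≤x : 0ℚ ℚ.≤ x
    0≤x = 0≤frac d-1 d

    x≤1 : x ℚ.≤ 1ℚ
    x≤1 = frac-≤ d-1 d 1 1
      (subst₂ ℕ._≤_ (sym (ℕ.*-identityʳ d-1)) (sym (ℕ.*-identityˡ d)) (ℕ.n≤1+n d-1))

    0≤x^ : ∀ k → 0ℚ ℚ.≤ x ^ k
    0≤x^ zero    = ℚ.nonNegative⁻¹ 1ℚ
    0≤x^ (suc k) = subst (ℚ._≤ x ℚ.* x ^ k) (ℚ.*-zeroˡ 0ℚ)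
      (*-mono-≤ ℚ.≤-refl 0≤x 0≤x (0≤x^ k))

    x^≤1 : ∀ k → x ^ k ℚ.≤ 1ℚ
    x^≤1 zero    = ℚ.≤-refl
    x^≤1 (suc k) = *-mono-≤ (0≤x^ k) (ℚ.nonNegative⁻¹ 1ℚ) x≤1 (x^≤1 k)

    0≤c : ∀ k → 0ℚ ℚ.≤ c k
    0≤c k = 0≤frac 1 (suc k)

    0≤D : 0ℚ ℚ.≤ D
    0≤D = 0≤frac d 1

    c↓ : ∀ k → c (suc k) ℚ.≤ c k
    c↓ k = frac-≤ 1 (suc (suc k)) 1 (suc k) (ℕ.*-monoʳ-≤ 1 (ℕ.n≤1+n (suc k)))

    0≤* : ∀ {a b} → 0ℚ ℚ.≤ a → 0ℚ ℚ.≤ b → 0ℚ ℚ.≤ a ℚ.* b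
    0≤* {a} {b} p q = ℚ.nonNegative⁻¹ _
      {{ℚ.nonNeg*nonNeg⇒nonNeg a {{ℚ.nonNegative p}} b {{ℚ.nonNegative q}}}}

    grow : ∀ a {b} → 0ℚ ℚ.≤ b → a ℚ.≤ a ℚ.+ b
    grow a {b} p = subst (ℚ._≤ a ℚ.+ b) (ℚ.+-identityʳ a) (ℚ.+-monoʳ-≤ a p)

    S U : ℕ → ℚ
    S = logSum d
    U n = S n ℚ.+ D ℚ.* logTerm d n

    0≤term : ∀ n → 0ℚ ℚ.≤ logTerm d n
    0≤term n = 0≤* (0≤x^ (suc n)) (0≤c n)

    U↓ : ∀ n → U (suc n) ℚ.≤ U n
    U↓ n = ℚ.≤-trans
      (ℚ.+-monoʳ-≤ (S (suc n))
        (*-mono-≤ (0≤term (suc n)) 0≤D ℚ.≤-refl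
          (*-mono-≤ (0≤c (suc n)) (0≤x^ (suc (suc n))) ℚ.≤-refl (c↓ n))))
      (ℚ.≤-reflexive (trans
        (solve 5 (λ s D x p c → (s :+ p :* c) :+ D :* (x :* p :* c)
                              := s :+ (con 1ℚ :+ D :* x) :* (p :* c))
               refl (S n) D x (x ^ suc n) (c n))
        (cong (λ z → S n ℚ.+ z ℚ.* logTerm d n) 1+Dx≡D)))

    gap : ∀ η → 0ℚ ℚ.< η → ∃[ N ] U N ℚ.- S N ℚ.≤ η
    gap η 0<η = N , (begin
      U N ℚ.- S N
        ≡⟨ solve 2 (λ s t → (s :+ t) :- s := t) refl (S N) (D ℚ.* logTerm d N) ⟩
      D ℚ.* (x ^ suc N ℚ.* c N)
        ≤⟨ *-mono-≤ (0≤term N) 0≤D ℚ.≤-refl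
             (*-mono-≤ (0≤c N) (ℚ.nonNegative⁻¹ 1ℚ) (x^≤1 (suc N)) ℚ.≤-refl) ⟩
      D ℚ.* (1ℚ ℚ.* c N)
        ≡⟨ cong (D ℚ.*_) (ℚ.*-identityˡ (c N)) ⟩
      D ℚ.* c N
        ≤⟨ *-mono-≤ (0≤c N) 0≤D ℚ.≤-refl c≤ ⟩
      D ℚ.* θ
        ≡⟨ Dθ≡η ⟩
      η ∎)
      where
      open ℚ.≤-Reasoning
      D-pos : 0ℚ ℚ.< D
      D-pos = ℚ.positive⁻¹ _ {{ℚ.normalize-pos d 1}}
      θ-data = shrink D η D-pos 0<η
      θ = proj₁ θ-data
      Dθ≡η = proj₂ (proj₂ θ-data)
      below : ∀ θ → 0ℚ ℚ.< θ → ∃[ N ] c N ℚ.≤ θ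
      below θ@(mkℚ +[1+ a ] b-1 _) _ = b-1 , subst (c b-1 ℚ.≤_) (ℚ.↥p/↧p≡p θ)
        (frac-≤ 1 (suc b-1) (suc a) (suc b-1) (ℕ.*-monoˡ-≤ (suc b-1) {1} {suc a} (s≤s z≤n)))
      below (mkℚ (+ 0) _ _) (ℚ.*<* (ℤ.+<+ ()))
      below (mkℚ (ℤ.-[1+ _ ]) _ _) (ℚ.*<* ())
      N = proj₁ (below θ (proj₁ (proj₂ θ-data)))
      c≤ = proj₂ (below θ (proj₁ (proj₂ θ-data)))

    log-cauchy : IsCauchy S
    log-cauchy = squeeze S U
      (λ n → grow (S n) (0≤term n)) U↓ (λ n → grow (S n) (0≤* 0≤D (0≤term n))) gap

private
  log-cauchy : (d : ℕ) .{{_ : ℕ.NonZero d}} → IsCauchy (logSum d)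
  log-cauchy (suc d-1) = Log.log-cauchy d-1

log : (d : ℕ) .{{_ : ℕ.NonZero d}} → ℝ
log d = mkℝ (logSum d) (log-cauchy d)

-- Row v of the adjacency matrix is the neighbourhood of v.
Adjacency : ℕ → Set
Adjacency n = Vec (Subset n) n

module _ {n : ℕ} where

  nbrs : Adjacency n → Fin n → Subset n
  nbrs G v = lookup G v

  IsSimple : Adjacency n → Set
  IsSimple G = (∀ u v → v ∈ nbrs G u → u ∈ nbrs G v) × (∀ v → v ∉ nbrs G v)

  IsRegular : ℕ → Adjacency n → Set
  IsRegular d G = ∀ v → # nbrs G v ≡ d

  IsBipartiteHole : Adjacency n → ℕ → Subset n → Subset n → Set
  IsBipartiteHole G q A₁ A₂ =
    # A₁ ≡ q × # A₂ ≡ q × Empty (A₁ ∩ A₂) ×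
    (∀ u v → u ∈ A₁ → v ∈ A₂ → v ∉ nbrs G u)

  HasBipartiteHole : Adjacency n → ℕ → Set
  HasBipartiteHole G q = ∃[ A₁ ] ∃[ A₂ ] IsBipartiteHole G q A₁ A₂

  -- One application of the forcing rule; a state is its set of black vertices.
  data Forces (G : Adjacency n) (S : Subset n) : Subset n → Set where
    force : ∀ u v → u ∈ S → v ∈ nbrs G u → v ∉ S →
            (∀ w → w ∈ nbrs G u → w ∉ S → w ≡ v) →
            Forces G S (S ∪ ⁅ v ⁆)

  IsZeroForcingSet : Adjacency n → Subset n → Set
  IsZeroForcingSet G S = Star (Forces G) S ⊤

  -- Z(G) = z, as a relation.
  IsZeroForcingNumber : Adjacency n → ℕ → Set
  IsZeroForcingNumber G z =
    (∃[ S ] IsZeroForcingSet G S × # S ≡ z) ×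
    (∀ S → IsZeroForcingSet G S → z ℕ.≤ # S)

isSimpleRegular? : ∀ {n} d (G : Adjacency n) → Dec (IsSimple G × IsRegular d G)
isSimpleRegular? d G =
  ((all? λ u → all? λ v → (v ∈? nbrs G u) →-dec (u ∈? nbrs G v))
    ×-dec (all? λ v → ¬? (v ∈? nbrs G v)))
  ×-dec (all? λ v → # nbrs G v ℕ.≟ d)

allVecs : {A : Set} → List A → ∀ n → List (Vec A n)
allVecs xs zero    = [] ∷ []
allVecs xs (suc n) = cartesianProductWith _∷_ xs (allVecs xs n)

-- Every labelled d-regular simple graph on Fin n, each exactly once.
regularGraphs : ∀ d n → List (Adjacency n)
regularGraphs d n =
  filter (isSimpleRegular? d) (allVecs (allVecs (true ∷ false ∷ []) n) n)

Event : Set₁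
Event = ∀ n → Adjacency n → Set

-- Pr(P) ≥ p for a uniform d-regular graph on n vertices.  Events about real
-- thresholds need not be decidable, so the count of favourable outcomes is
-- bounded below by a duplicate-free list of them (a sublist of the
-- enumeration) instead of being computed by a filter.
Pr[_,_]_≥_ : (d n : ℕ) → Event → ℚ → Set
Pr[ d , n ] P ≥ p = ∃[ Gs ] Gs ⊆ regularGraphs d n × All (P n) Gs ×
  p ℚ.* (+ length (regularGraphs d n) ℚ./ 1) ℚ.≤ + length Gs ℚ./ 1

-- n → ∞ through even values when d is odd.
AAS : ℕ → Event → Set
AAS d P = ∀ (δ : ℚ) → 0ℚ ℚ.< δ →
  ∃[ N ] ∀ n → N ℕ.≤ n → (¬ 2 ∣ d → 2 ∣ n) → Pr[ d , n ] P ≥ (1ℚ ℚ.- δ)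

{-# OPTIONS --safe #-}

-- Fix disjoint A, B with |A| = |B| = q and let g k be the number of d-regular graphs with exactly k
-- edges between A and B. Replacing edges ax and by (a ∈ A, x ∉ B, b ∈ B, y ∉ A) by ab and xy raises
-- the number of A–B edges by one, or by two if x ∈ A and y ∈ B. Counting these switchings from both
-- sides compares g k with g (k+1) and g (k+2), and iterating up to K ≈ d q² / n bounds g 0 / N by
-- K! / K^K ≈ e^(-K), where N is the number of all d-regular graphs.
--
-- With q ≈ 2 (k+1) n / d and K = 2 k q for an integer k slightly above log d, the union bound over the
-- at most (n^q / q!)² pairs (A , B) leaves a proportion O(4^(-q)) of graphs with a q-hole. Since
-- log d ≥ j / (m+1) whenever ((m+1)/m)^j ≤ d, such a k exists below (1 + ε) log d once d is large.
--
-- If a set of z vertices forces the whole graph, then after q forcing steps the q forcers have no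
-- white neighbours; so z + 2 q ≤ n would give a q-hole.

module Submission where

-- Switchings with x in `A` and y in `B` cannot be discarded: nothing bounds the number of edges
-- inside `A` or inside `B`, so these may form a large share of all switchings. Keeping them makes
-- the recursion reach two levels up. Undoing one means choosing two edges between `A` and `B`, so
-- the extra term is only quadratic in the level.
--
-- The gap between k + 1 in q and k in K pays for every error. After division by q it frees 2 n d:
-- one n d covers the edges already present between `A` and `B` and the two-edge switchings, the
-- other covers the pairs that cannot be switched.
--
-- The number e enters only through ρ = (1 + 1/m)^m < e for a fixed m, with denominators cleared, so
-- the counting stays in ℕ. Using ρ for e, and a partial sum for the logarithm, loses a factor
-- (m/(m+1))² in the lower bound for log d; m is a multiple of 1/ε, so that 1 + ε outweighs this
-- loss.

module Combinatorics where

  open import Defs using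
    ( Adjacency; nbrs; IsSimple; IsRegular; allVecs; regularGraphs; isSimpleRegular?
    ; IsBipartiteHole; HasBipartiteHole; force; IsZeroForcingSet; IsZeroForcingNumber)
  open import Data.Bool.Base using (true; false; _xor_)
  open import Data.Fin.Base using (Fin; zero; suc)
  import Data.Fin.Properties as Fin
  open import Data.Fin.Subset
    using (Subset; _∈_; _∉_; _⊆_; _∩_; _∪_; ∁; ⁅_⁆; ⊤; ⊥; Empty; inside; outside)
    renaming (∣_∣ to #_)
  open import Data.Fin.Subset.Properties using
    ( _∈?_; drop-there; x∈p∩q⁺; x∈p∩q⁻; anySubset?; nonempty?; ∪-identityʳ; ∉⊥; ∣⊥∣≡0; ∣⊤∣≡n; ∣p∣≤n
    ; ∣p∣≡n⇒p≡⊤; ∣∁p∣≡n∸∣p∣; x∈∁p⇒x∉p; x∈p∪q⁻; p⊆p∪q; q⊆p∪q; x∈⁅y⁆⇒x≡y; x∈⁅x⁆; out⊆; s⊆s)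
  open import Data.List.Base
    using (List; []; _∷_; _++_; map; filter; length; allFin; cartesianProduct)
  open import Data.List.Membership.Propositional using () renaming (_∈_ to _∈ˡ_)
  open import Data.List.Membership.Propositional.Properties using
    ( ∈-∃++; ∈-++⁺ˡ; ∈-++⁺ʳ; ∈-++⁻; ∈-map⁺; ∈-map⁻; ∈-filter⁺; ∈-filter⁻; ∈-cartesianProductWith⁺)
  open import Data.List.Properties using (length-++; length-map; length-tabulate; map-tabulate)
  open import Data.List.Relation.Unary.All as All using ([]; _∷_)
  open import Data.List.Relation.Unary.AllPairs using ([]; _∷_)
  open import Data.List.Relation.Unary.Any using (here; there)
  open import Data.List.Relation.Unary.Unique.Propositional using (Unique)
  import Data.List.Relation.Unary.Unique.Propositional.Properties as Unique
  open import Data.Nat.Base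
  open import Data.Nat.DivMod using (_/_; _%_; m≡m%n+[m/n]*n; m%n<n)
  open import Data.Nat.Properties
  open import Data.Nat.Tactic.RingSolver using (solve-∀)
  open import Data.Product.Base using (_×_; _,_; proj₁; proj₂; ∃-syntax; uncurry)
  open import Data.Sum.Base using (_⊎_; inj₁; inj₂)
  open import Data.Vec.Base as Vec using (Vec; []; _∷_; here; there; lookup)
  open import Data.Vec.Properties using
    ([]=⇒lookup; lookup⇒[]=; ∷-injective; lookup∘tabulate; tabulate∘lookup; tabulate-cong)
  open import Function.Base using (_∘_; id)
  open import Relation.Binary.Construct.Closure.ReflexiveTransitive using (ε; _◅_)
  open import Relation.Binary.PropositionalEquality hiding (J)
  open import Relation.Nullary using (¬_; Dec; yes; no; does; contradiction)
  open import Relation.Nullary.Decidable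
    using (_×-dec_; _⊎-dec_; _→-dec_; ¬?; map′; dec-true; dec-false)
  open import Relation.Unary using (Decidable)

  -- Indicators and finite sums

  𝟙 : {P : Set} → Dec P → ℕ
  𝟙 (yes _) = 1
  𝟙 (no  _) = 0

  𝟙-mono : {P Q : Set} (p : Dec P) (q : Dec Q) → (P → Q) → 𝟙 p ≤ 𝟙 q
  𝟙-mono (no _)  _       _   = z≤n
  𝟙-mono (yes _) (yes _) _   = ≤-refl
  𝟙-mono (yes p) (no ¬q) p⇒q = contradiction (p⇒q p) ¬q

  𝟙-cong : {P Q : Set} (p : Dec P) (q : Dec Q) → (P → Q) → (Q → P) → 𝟙 p ≡ 𝟙 q
  𝟙-cong p q p⇒q q⇒p = ≤-antisym (𝟙-mono p q p⇒q) (𝟙-mono q p q⇒p)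

  𝟙≤1 : {P : Set} (p : Dec P) → 𝟙 p ≤ 1
  𝟙≤1 (yes _) = ≤-refl
  𝟙≤1 (no _)  = z≤n

  𝟙-yes : {P : Set} (p : Dec P) → P → 𝟙 p ≡ 1
  𝟙-yes (yes _) _ = refl
  𝟙-yes (no ¬p) p = contradiction p ¬p

  𝟙-no : {P : Set} (p : Dec P) → ¬ P → 𝟙 p ≡ 0
  𝟙-no (yes p) ¬p = contradiction p ¬p
  𝟙-no (no _)  _  = refl

  ∑ : {A : Set} → List A → (A → ℕ) → ℕ
  ∑ []       f = 0
  ∑ (x ∷ xs) f = f x + ∑ xs f

  infix 5 ∑
  syntax ∑ xs (λ x → e) = ∑[ x ∈ xs ] e

  private variable
    A B : Set


  ∑-mono-∈ : ∀ xs {f g : A → ℕ} → (∀ {x} → x ∈ˡ xs → f x ≤ g x) → ∑ xs f ≤ ∑ xs g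
  ∑-mono-∈ []       f≤g = z≤n
  ∑-mono-∈ (x ∷ xs) f≤g = +-mono-≤ (f≤g (here refl)) (∑-mono-∈ xs (f≤g ∘ there))

  ∑-mono : ∀ xs {f g : A → ℕ} → (∀ x → f x ≤ g x) → ∑ xs f ≤ ∑ xs g
  ∑-mono xs f≤g = ∑-mono-∈ xs (λ {x} _ → f≤g x)

  ∑-cong : ∀ xs {f g : A → ℕ} → (∀ x → f x ≡ g x) → ∑ xs f ≡ ∑ xs g
  ∑-cong []       f≡g = refl
  ∑-cong (x ∷ xs) f≡g = cong₂ _+_ (f≡g x) (∑-cong xs f≡g)

  ∑-zero : ∀ (xs : List A) → ∑ xs (λ _ → 0) ≡ 0
  ∑-zero []       = refl
  ∑-zero (_ ∷ xs) = ∑-zero xs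

  ∑-const : ∀ (xs : List A) c → ∑ xs (λ _ → c) ≡ length xs * c
  ∑-const []       c = refl
  ∑-const (_ ∷ xs) c = cong (c +_) (∑-const xs c)

  ∑-+ : ∀ xs (f g : A → ℕ) → (∑[ x ∈ xs ] f x + g x) ≡ ∑ xs f + ∑ xs g
  ∑-+ []       f g = refl
  ∑-+ (x ∷ xs) f g = trans (cong (f x + g x +_) (∑-+ xs f g)) (shuffle (f x) (g x) _ _)
    where
    shuffle : ∀ a b c d → a + b + (c + d) ≡ a + c + (b + d)
    shuffle = solve-∀

  ∑-*ˡ : ∀ xs c (f : A → ℕ) → (∑[ x ∈ xs ] c * f x) ≡ c * ∑ xs f
  ∑-*ˡ []       c f = sym (*-zeroʳ c)
  ∑-*ˡ (x ∷ xs) c f = trans (cong (c * f x +_) (∑-*ˡ xs c f)) (sym (*-distribˡ-+ c (f x) _))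

  ∑-*ʳ : ∀ xs c (f : A → ℕ) → (∑[ x ∈ xs ] f x * c) ≡ ∑ xs f * c
  ∑-*ʳ xs c f = trans (∑-cong xs λ x → *-comm (f x) c) (trans (∑-*ˡ xs c f) (*-comm c _))

  ∑-++ : ∀ xs ys (f : A → ℕ) → ∑ (xs ++ ys) f ≡ ∑ xs f + ∑ ys f
  ∑-++ []       ys f = refl
  ∑-++ (x ∷ xs) ys f = trans (cong (f x +_) (∑-++ xs ys f)) (sym (+-assoc (f x) _ _))

  ∑-map : (xs : List B) (h : B → A) (f : A → ℕ) → ∑ (map h xs) f ≡ ∑ xs (f ∘ h)
  ∑-map []       h f = refl
  ∑-map (x ∷ xs) h f = cong (f (h x) +_) (∑-map xs h f)

  ∑-comm : (xs : List A) (ys : List B) (f : A → B → ℕ) →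
    (∑[ x ∈ xs ] ∑[ y ∈ ys ] f x y) ≡ (∑[ y ∈ ys ] ∑[ x ∈ xs ] f x y)
  ∑-comm []       ys f = sym (∑-zero ys)
  ∑-comm (x ∷ xs) ys f = trans (cong (∑ ys (f x) +_) (∑-comm xs ys f))
    (sym (∑-+ ys (f x) (λ y → ∑[ x ∈ xs ] f x y)))

  ∑-∈ : ∀ {x xs} (f : A → ℕ) → x ∈ˡ xs → f x ≤ ∑ xs f
  ∑-∈ f (here refl)  = m≤m+n _ _
  ∑-∈ f (there x∈xs) = ≤-trans (∑-∈ f x∈xs) (m≤n+m _ _)

  length-filter : {P : A → Set} (P? : Decidable P) → ∀ xs →
    length (filter P? xs) ≡ (∑[ x ∈ xs ] 𝟙 (P? x))
  length-filter P? []       = refl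
  length-filter P? (x ∷ xs) with P? x
  ... | yes _ = cong suc (length-filter P? xs)
  ... | no _  = length-filter P? xs

  ∑-cartesianProduct : (xs : List A) (ys : List B) (f : A × B → ℕ) →
    ∑ (cartesianProduct xs ys) f ≡ (∑[ x ∈ xs ] ∑[ y ∈ ys ] f (x , y))
  ∑-cartesianProduct []       ys f = refl
  ∑-cartesianProduct (x ∷ xs) ys f =
    trans (∑-++ (map (x ,_) ys) (cartesianProduct xs ys) f)
      (cong₂ _+_ (∑-map ys (x ,_) f) (∑-cartesianProduct xs ys f))

  ∑-allFin-suc : ∀ {n} (f : Fin (suc n) → ℕ) → ∑ (allFin (suc n)) f ≡ f zero + ∑ (allFin n) (f ∘ suc)
  ∑-allFin-suc {n} f = cong (f zero +_)
    (trans (cong (λ xs → ∑ xs f) (sym (map-tabulate {n = n} id suc))) (∑-map (allFin n) suc f))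

  ∑-𝟙≡ : ∀ {n} (i : Fin n) (f : Fin n → ℕ) → (∑[ j ∈ allFin n ] 𝟙 (i Fin.≟ j) * f j) ≡ f i
  ∑-𝟙≡ {suc n} zero f = trans (∑-allFin-suc (λ j → 𝟙 (zero Fin.≟ j) * f j))
    (trans (cong₂ _+_ (+-identityʳ (f zero)) (∑-zero (allFin n))) (+-identityʳ (f zero)))
  ∑-𝟙≡ {suc n} (suc i) f = trans (∑-allFin-suc (λ j → 𝟙 (suc i Fin.≟ j) * f j))
    (trans (∑-cong (allFin n) λ j → cong (_* f (suc j))
              (𝟙-cong (suc i Fin.≟ suc j) (i Fin.≟ j) Fin.suc-injective (cong suc)))
           (∑-𝟙≡ i (f ∘ suc)))

  #≡∑ : ∀ {n} (S : Subset n) → # S ≡ (∑[ v ∈ allFin n ] 𝟙 (v ∈? S))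
  #≡∑ []            = refl
  #≡∑ {suc n} (s ∷ S) = trans (head s) (sym (∑-allFin-suc (λ v → 𝟙 (v ∈? (s ∷ S)))))
    where
    tail : # S ≡ (∑[ v ∈ allFin n ] 𝟙 (suc v ∈? (s ∷ S)))
    tail = trans (#≡∑ S) (∑-cong (allFin n) λ v →
      𝟙-cong (v ∈? S) (suc v ∈? (s ∷ S)) there drop-there)
    head : ∀ s′ → # (s′ ∷ S) ≡ 𝟙 (zero ∈? (s′ ∷ S)) + (∑[ v ∈ allFin n ] 𝟙 (suc v ∈? (s ∷ S)))
    head true  = cong suc tail
    head false = tail

  -- Pigeonhole: the head of `xs` is cut out of `ys` where it occurs, and uniqueness keeps the later
  -- entries of `xs` away from the gap.
  length-mono-⊆ : (xs ys : List A) → Unique xs → (∀ {z} → z ∈ˡ xs → z ∈ˡ ys) →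
    length xs ≤ length ys
  length-mono-⊆ []       ys _             _     = z≤n
  length-mono-⊆ (x ∷ xs) ys (x≢xs ∷ xs!) xs⊆ys with ∈-∃++ (xs⊆ys (here refl))
  ... | as , bs , refl = begin
    suc (length xs)             ≤⟨ s≤s (length-mono-⊆ xs (as ++ bs) xs! avoid) ⟩
    suc (length (as ++ bs))     ≡⟨ cong suc (length-++ as) ⟩
    suc (length as + length bs) ≡⟨ +-suc (length as) (length bs) ⟨
    length as + suc (length bs) ≡⟨ length-++ as ⟨
    length (as ++ x ∷ bs)       ∎
    where
    open ≤-Reasoning
    avoid : ∀ {z} → z ∈ˡ xs → z ∈ˡ as ++ bs
    avoid {z} z∈xs with ∈-++⁻ as (xs⊆ys (there z∈xs))
    ... | inj₁ z∈as         = ∈-++⁺ˡ z∈as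
    ... | inj₂ (there z∈bs) = ∈-++⁺ʳ as z∈bs
    ... | inj₂ (here refl)  = contradiction refl (All.lookup x≢xs z∈xs)

  -- Exchanging the sums fixes the label `t`, and `φ t` then embeds the graphs with `V` into those
  -- with `R`. In the application `V` says that a switching can be performed on a graph, `R` that it
  -- may have produced it.
  double-counting : {X T : Set} (L : List X) (ts : List T) → Unique L →
    (φ : T → X → X) → (∀ t {G H} → φ t G ≡ φ t H → G ≡ H) →
    {V R : X → T → Set} (V? : ∀ G t → Dec (V G t)) (R? : ∀ G t → Dec (R G t)) →
    (∀ t {G} → G ∈ˡ L → V G t → φ t G ∈ˡ L × R (φ t G) t) →
    (∑[ G ∈ L ] ∑[ t ∈ ts ] 𝟙 (V? G t)) ≤ (∑[ G ∈ L ] ∑[ t ∈ ts ] 𝟙 (R? G t))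
  double-counting L ts L! φ φ-inj {V} {R} V? R? φ-maps = begin
    (∑[ G ∈ L ] ∑[ t ∈ ts ] 𝟙 (V? G t)) ≡⟨ ∑-comm L ts _ ⟩
    (∑[ t ∈ ts ] ∑[ G ∈ L ] 𝟙 (V? G t)) ≤⟨ ∑-mono ts step ⟩
    (∑[ t ∈ ts ] ∑[ G ∈ L ] 𝟙 (R? G t)) ≡⟨ ∑-comm L ts _ ⟨
    (∑[ G ∈ L ] ∑[ t ∈ ts ] 𝟙 (R? G t)) ∎
    where
    open ≤-Reasoning
    step : ∀ t → (∑[ G ∈ L ] 𝟙 (V? G t)) ≤ (∑[ G ∈ L ] 𝟙 (R? G t))
    step t = begin
      (∑[ G ∈ L ] 𝟙 (V? G t))  ≡⟨ length-filter Vₜ? L ⟨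
      length sources           ≡⟨ length-map (φ t) sources ⟨
      length images            ≤⟨ length-mono-⊆ images targets
                                   (Unique.map⁺ (φ-inj t) (Unique.filter⁺ Vₜ? L!)) image⇒target ⟩
      length targets           ≡⟨ length-filter Rₜ? L ⟩
      (∑[ G ∈ L ] 𝟙 (R? G t))  ∎
      where
      Vₜ? : Decidable (λ G → V G t)
      Vₜ? G = V? G t
      Rₜ? : Decidable (λ G → R G t)
      Rₜ? G = R? G t
      sources = filter Vₜ? L
      images  = map (φ t) sources
      targets = filter Rₜ? L
      image⇒target : ∀ {H} → H ∈ˡ images → H ∈ˡ targets
      image⇒target H∈ with ∈-map⁻ (φ t) H∈
      ... | G , G∈sources , refl with ∈-filter⁻ Vₜ? {xs = L} G∈sources
      ... | G∈L , v with φ-maps t G∈L v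
      ... | φG∈L , r = ∈-filter⁺ Rₜ? φG∈L r

  -- The list of regular graphs

  allVecs-complete : {A : Set} {xs : List A} → (∀ x → x ∈ˡ xs) → ∀ {n} (v : Vec A n) → v ∈ˡ allVecs xs n
  allVecs-complete all-∈ []      = here refl
  allVecs-complete all-∈ (x ∷ v) = ∈-cartesianProductWith⁺ _∷_ (all-∈ x) (allVecs-complete all-∈ v)

  allVecs-unique : {A : Set} {xs : List A} → Unique xs → ∀ n → Unique (allVecs xs n)
  allVecs-unique xs! zero    = [] ∷ []
  allVecs-unique xs! (suc n) =
    Unique.cartesianProductWith⁺ _∷_ ∷-injective xs! (allVecs-unique xs! n)

  bools-complete : ∀ b → b ∈ˡ (true ∷ false ∷ [])
  bools-complete true  = here refl
  bools-complete false = there (here refl)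

  bools-unique : Unique (true ∷ false ∷ [])
  bools-unique = ((λ ()) ∷ []) ∷ [] ∷ []

  regularGraphs-unique : ∀ d n → Unique (regularGraphs d n)
  regularGraphs-unique d n = Unique.filter⁺ (isSimpleRegular? d)
    (allVecs-unique (allVecs-unique bools-unique n) n)

  ∈-regularGraphs⁺ : ∀ {d n} (G : Adjacency n) → IsSimple G → IsRegular d G → G ∈ˡ regularGraphs d n
  ∈-regularGraphs⁺ {d} G simple regular = ∈-filter⁺ (isSimpleRegular? d)
    (allVecs-complete (allVecs-complete bools-complete) G) (simple , regular)

  ∈-regularGraphs⁻ : ∀ {d n} (G : Adjacency n) → G ∈ˡ regularGraphs d n → IsSimple G × IsRegular d G
  ∈-regularGraphs⁻ {d} {n} G G∈ = proj₂ (∈-filter⁻ (isSimpleRegular? d)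
    {xs = allVecs (allVecs (true ∷ false ∷ []) n) n} G∈)

  -- Switchings

  module _ {n : ℕ} where

    edge : Adjacency n → Fin n → Fin n → ℕ
    edge G u v = 𝟙 (v ∈? nbrs G u)

    Joins : Fin n → Fin n → Fin n → Fin n → Set
    Joins i j u v = (i ≡ u × j ≡ v) ⊎ (j ≡ u × i ≡ v)

    joins? : ∀ i j u v → Dec (Joins i j u v)
    joins? i j u v = ((i Fin.≟ u) ×-dec (j Fin.≟ v)) ⊎-dec ((j Fin.≟ u) ×-dec (i Fin.≟ v))

    abstract
      -- Flipping by `xor`, whether or not the edge is present, makes every toggle an involution. A
      -- switching with a fixed label is therefore injective on all graphs, whether or not the label
      -- is valid for them.
      toggle : Fin n → Fin n → Adjacency n → Adjacency n
      toggle i j G = Vec.tabulate λ u → Vec.tabulate λ v → lookup (nbrs G u) v xor does (joins? i j u v)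

      lookup-toggle : ∀ i j G u v →
        lookup (nbrs (toggle i j G) u) v ≡ lookup (nbrs G u) v xor does (joins? i j u v)
      lookup-toggle i j G u v = trans
        (cong (λ r → lookup r v) (lookup∘tabulate (λ u → Vec.tabulate λ v → lookup (nbrs G u) v xor does (joins? i j u v)) u))
        (lookup∘tabulate (λ v → lookup (nbrs G u) v xor does (joins? i j u v)) v)

    toggle-involutive : ∀ i j G → toggle i j (toggle i j G) ≡ G
    toggle-involutive i j G = lookup-ext λ u → lookup-ext λ v →
      trans (lookup-toggle i j (toggle i j G) u v)
        (trans (cong (_xor does (joins? i j u v)) (lookup-toggle i j G u v))
               (xor-cancel (lookup (nbrs G u) v) (does (joins? i j u v))))
      where
      lookup-ext : {A : Set} {xs ys : Vec A n} → (∀ i → lookup xs i ≡ lookup ys i) → xs ≡ ys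
      lookup-ext {xs = xs} {ys} eq =
        trans (sym (tabulate∘lookup xs)) (trans (tabulate-cong eq) (tabulate∘lookup ys))
      xor-cancel : ∀ a b → (a xor b) xor b ≡ a
      xor-cancel true  true  = refl
      xor-cancel true  false = refl
      xor-cancel false true  = refl
      xor-cancel false false = refl

    toggle-injective : ∀ i j {G H} → toggle i j G ≡ toggle i j H → G ≡ H
    toggle-injective i j {G} {H} eq =
      trans (sym (toggle-involutive i j G)) (trans (cong (toggle i j) eq) (toggle-involutive i j H))

    ∈⇒lookup≡true : ∀ {S : Subset n} {v} → v ∈ S → lookup S v ≡ true
    ∈⇒lookup≡true = []=⇒lookup

    lookup≡true⇒∈ : ∀ {S : Subset n} {v} → lookup S v ≡ true → v ∈ S
    lookup≡true⇒∈ {S} {v} = lookup⇒[]= v S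

    ∉⇒lookup≡false : ∀ {S : Subset n} {v} → v ∉ S → lookup S v ≡ false
    ∉⇒lookup≡false {S} {v} v∉S with lookup S v in eq
    ... | true  = contradiction (lookup≡true⇒∈ eq) v∉S
    ... | false = refl

    module _ (G : Adjacency n) {i j u v : Fin n} where

      toggle-removes : Joins i j u v → v ∈ nbrs G u → v ∉ nbrs (toggle i j G) u
      toggle-removes joins v∈ v∈′ with () ← trans (sym (∈⇒lookup≡true v∈′)) (trans (lookup-toggle i j G u v)
        (cong₂ _xor_ (∈⇒lookup≡true v∈) (dec-true (joins? i j u v) joins)))

      toggle-adds : Joins i j u v → v ∉ nbrs G u → v ∈ nbrs (toggle i j G) u
      toggle-adds joins v∉ = lookup≡true⇒∈ (trans (lookup-toggle i j G u v)
        (cong₂ _xor_ (∉⇒lookup≡false v∉) (dec-true (joins? i j u v) joins)))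

      toggle-keeps-∈ : ¬ Joins i j u v → v ∈ nbrs G u → v ∈ nbrs (toggle i j G) u
      toggle-keeps-∈ ¬joins v∈ = lookup≡true⇒∈ (trans (lookup-toggle i j G u v)
        (cong₂ _xor_ (∈⇒lookup≡true v∈) (dec-false (joins? i j u v) ¬joins)))

      toggle-keeps-∉ : ¬ Joins i j u v → v ∉ nbrs G u → v ∉ nbrs (toggle i j G) u
      toggle-keeps-∉ ¬joins v∉ v∈′ with () ← trans (sym (∈⇒lookup≡true v∈′)) (trans (lookup-toggle i j G u v)
        (cong₂ _xor_ (∉⇒lookup≡false v∉) (dec-false (joins? i j u v) ¬joins)))

    Joins-sym : ∀ {i j u v} → Joins i j u v → Joins i j v u
    Joins-sym (inj₁ (p , q)) = inj₂ (q , p)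
    Joins-sym (inj₂ (p , q)) = inj₁ (q , p)

    Joins-irrefl : ∀ {i j v} → i ≢ j → ¬ Joins i j v v
    Joins-irrefl i≢j (inj₁ (p , q)) = i≢j (trans p (sym q))
    Joins-irrefl i≢j (inj₂ (p , q)) = i≢j (trans q (sym p))

    toggle-simple : ∀ G {i j} → i ≢ j → IsSimple G → IsSimple (toggle i j G)
    toggle-simple G {i} {j} i≢j (symmetric , loopless) =
      (λ u v v∈′ → symmetric′ u v v∈′ (joins? i j u v) (v ∈? nbrs G u)) ,
      (λ v → toggle-keeps-∉ G (Joins-irrefl i≢j) (loopless v))
      where
      symmetric′ : ∀ u v → v ∈ nbrs (toggle i j G) u → Dec (Joins i j u v) → Dec (v ∈ nbrs G u) →
        u ∈ nbrs (toggle i j G) v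
      symmetric′ u v v∈′ (yes J) (yes v∈) = contradiction v∈′ (toggle-removes G J v∈)
      symmetric′ u v v∈′ (yes J) (no v∉)  = toggle-adds G (Joins-sym J) (v∉ ∘ symmetric v u)
      symmetric′ u v v∈′ (no ¬J) (yes v∈) = toggle-keeps-∈ G (¬J ∘ Joins-sym) (symmetric u v v∈)
      symmetric′ u v v∈′ (no ¬J) (no v∉)  = contradiction v∈′ (toggle-keeps-∉ G ¬J v∉)

    ∑∑ : (Fin n → Fin n → ℕ) → ℕ
    ∑∑ f = ∑[ u ∈ allFin n ] ∑[ v ∈ allFin n ] f u v

    ∑∑-cong : ∀ {f g : Fin n → Fin n → ℕ} → (∀ u v → f u v ≡ g u v) → ∑∑ f ≡ ∑∑ g
    ∑∑-cong f≡g = ∑-cong (allFin n) λ u → ∑-cong (allFin n) (f≡g u)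

    ∑∑-+ : ∀ f g → ∑∑ (λ u v → f u v + g u v) ≡ ∑∑ f + ∑∑ g
    ∑∑-+ f g = trans (∑-cong (allFin n) λ u → ∑-+ (allFin n) (f u) (g u)) (∑-+ (allFin n) _ _)

    ∑∑-𝟙≡ : ∀ i j (w : Fin n → Fin n → ℕ) → ∑∑ (λ u v → 𝟙 (i Fin.≟ u) * (𝟙 (j Fin.≟ v) * w u v)) ≡ w i j
    ∑∑-𝟙≡ i j w = trans
      (∑-cong (allFin n) λ u → trans (∑-*ˡ (allFin n) (𝟙 (i Fin.≟ u)) _)
        (cong (𝟙 (i Fin.≟ u) *_) (∑-𝟙≡ j (w u))))
      (∑-𝟙≡ i (λ u → w u j))

    -- For distinct endpoints the two orientations exclude each other, so the indicator of their
    -- disjunction is a plain sum.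
    𝟙-joins : ∀ {i j} → i ≢ j → ∀ u v → 𝟙 (joins? i j u v) ≡
      𝟙 (i Fin.≟ u) * 𝟙 (j Fin.≟ v) + 𝟙 (j Fin.≟ u) * 𝟙 (i Fin.≟ v)
    𝟙-joins {i} {j} i≢j u v with i Fin.≟ u | j Fin.≟ v | j Fin.≟ u | i Fin.≟ v
    ... | yes p | _     | yes q | _     = contradiction (trans p (sym q)) i≢j
    ... | yes p | yes q | no _  | _     = refl
    ... | yes p | no _  | no _  | _     = refl
    ... | no _  | _     | yes q | yes p = refl
    ... | no _  | _     | yes q | no _  = refl
    ... | no _  | _     | no _  | _     = refl

    -- The sum runs over ordered pairs, so an edge ij contributes `w i j + w j i`. Vertex degrees
    -- and the number of edges between two disjoint sets both have this form, so that one
    -- computation of the effect of a switching serves for both.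
    weight : (Fin n → Fin n → ℕ) → Adjacency n → ℕ
    weight w G = ∑∑ λ u v → w u v * edge G u v

    ∑∑-joins : ∀ {i j} → i ≢ j → ∀ w → ∑∑ (λ u v → w u v * 𝟙 (joins? i j u v)) ≡ w i j + w j i
    ∑∑-joins {i} {j} i≢j w = trans
      (∑∑-cong λ u v → trans (cong (w u v *_) (𝟙-joins i≢j u v)) (expand (w u v) (𝟙 (i Fin.≟ u)) (𝟙 (j Fin.≟ v)) (𝟙 (j Fin.≟ u)) (𝟙 (i Fin.≟ v))))
      (trans (∑∑-+ _ _) (cong₂ _+_ (∑∑-𝟙≡ i j w) (∑∑-𝟙≡ j i w)))
      where
      expand : ∀ w a b c d → w * (a * b + c * d) ≡ a * (b * w) + c * (d * w)
      expand = solve-∀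

    module _ (G : Adjacency n) {i j : Fin n} (w : Fin n → Fin n → ℕ) (i≢j : i ≢ j)
             (symmetric : ∀ u v → v ∈ nbrs G u → u ∈ nbrs G v) where

      joined-∈ : j ∈ nbrs G i → ∀ {u v} → Joins i j u v → v ∈ nbrs G u
      joined-∈ j∈ (inj₁ (refl , refl)) = j∈
      joined-∈ j∈ (inj₂ (refl , refl)) = symmetric i j j∈

      joined-∉ : j ∉ nbrs G i → ∀ {u v} → Joins i j u v → v ∉ nbrs G u
      joined-∉ j∉ (inj₁ (refl , refl)) = j∉
      joined-∉ j∉ (inj₂ (refl , refl)) = j∉ ∘ symmetric j i

      edge-remove : j ∈ nbrs G i → ∀ u v → edge (toggle i j G) u v + 𝟙 (joins? i j u v) ≡ edge G u v
      edge-remove j∈ u v = go (joins? i j u v)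
        where
        go : (J? : Dec (Joins i j u v)) → edge (toggle i j G) u v + 𝟙 J? ≡ edge G u v
        go (yes J) = trans (cong (_+ 1) (𝟙-no (v ∈? nbrs (toggle i j G) u) (toggle-removes G J (joined-∈ j∈ J))))
          (sym (𝟙-yes (v ∈? nbrs G u) (joined-∈ j∈ J)))
        go (no ¬J) with v ∈? nbrs G u
        ... | yes v∈ = trans (+-identityʳ _) (𝟙-yes (v ∈? nbrs (toggle i j G) u) (toggle-keeps-∈ G ¬J v∈))
        ... | no v∉  = trans (+-identityʳ _) (𝟙-no (v ∈? nbrs (toggle i j G) u) (toggle-keeps-∉ G ¬J v∉))

      edge-add : j ∉ nbrs G i → ∀ u v → edge (toggle i j G) u v ≡ edge G u v + 𝟙 (joins? i j u v)
      edge-add j∉ u v = go (joins? i j u v)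
        where
        go : (J? : Dec (Joins i j u v)) → edge (toggle i j G) u v ≡ edge G u v + 𝟙 J?
        go (yes J) = trans (𝟙-yes (v ∈? nbrs (toggle i j G) u) (toggle-adds G J (joined-∉ j∉ J)))
          (cong (_+ 1) (sym (𝟙-no (v ∈? nbrs G u) (joined-∉ j∉ J))))
        go (no ¬J) with v ∈? nbrs G u
        ... | yes v∈ = 𝟙-yes (v ∈? nbrs (toggle i j G) u) (toggle-keeps-∈ G ¬J v∈)
        ... | no v∉  = 𝟙-no (v ∈? nbrs (toggle i j G) u) (toggle-keeps-∉ G ¬J v∉)

      weight-remove : j ∈ nbrs G i → weight w (toggle i j G) + (w i j + w j i) ≡ weight w G
      weight-remove j∈ = trans (cong (weight w (toggle i j G) +_) (sym (∑∑-joins i≢j w)))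
        (trans (sym (∑∑-+ _ _)) (∑∑-cong λ u v →
          trans (sym (*-distribˡ-+ (w u v) _ _)) (cong (w u v *_) (edge-remove j∈ u v))))

      weight-add : j ∉ nbrs G i → weight w (toggle i j G) ≡ weight w G + (w i j + w j i)
      weight-add j∉ = trans
        (∑∑-cong λ u v → trans (cong (w u v *_) (edge-add j∉ u v)) (*-distribˡ-+ (w u v) _ _))
        (trans (∑∑-+ _ _) (cong (weight w G +_) (∑∑-joins i≢j w)))

    -- A label (a , x) , (b , y) prescribes replacing the edges ax and by by ab and xy.
    Label : Set
    Label = (Fin n × Fin n) × (Fin n × Fin n)

    switch : Label → Adjacency n → Adjacency n
    switch ((a , x) , (b , y)) = toggle x y ∘ toggle a b ∘ toggle b y ∘ toggle a x

    switch-injective : ∀ t {G H} → switch t G ≡ switch t H → G ≡ H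
    switch-injective ((a , x) , (b , y)) =
      toggle-injective a x ∘ toggle-injective b y ∘ toggle-injective a b ∘ toggle-injective x y

    -- Together with looplessness the assumptions make a, x, b, y distinct. The pairs ax, by, ab, xy
    -- are then four different pairs, and each toggle still finds its pair in the state it had in
    -- `G`.
    module Switch (G : Adjacency n) (simple : IsSimple G) {a x b y : Fin n}
      (x∈Na : x ∈ nbrs G a) (y∈Nb : y ∈ nbrs G b) (b∉Na : b ∉ nbrs G a) (y∉Nx : y ∉ nbrs G x)
      (a≢b : a ≢ b) (a≢y : a ≢ y) (x≢b : x ≢ b) (x≢y : x ≢ y) where

      a≢x : a ≢ x
      a≢x refl = proj₂ simple a x∈Na

      b≢y : b ≢ y
      b≢y refl = proj₂ simple b y∈Nb

      G₁ G₂ G₃ G₄ : Adjacency n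
      G₁ = toggle a x G
      G₂ = toggle b y G₁
      G₃ = toggle a b G₂
      G₄ = toggle x y G₃

      simple₁ : IsSimple G₁
      simple₁ = toggle-simple G a≢x simple
      simple₂ : IsSimple G₂
      simple₂ = toggle-simple G₁ b≢y simple₁
      simple₃ : IsSimple G₃
      simple₃ = toggle-simple G₂ a≢b simple₂

      switch-simple : IsSimple G₄
      switch-simple = toggle-simple G₃ x≢y simple₃

      ¬Joins : ∀ {i j u v : Fin n} → i ≢ u ⊎ j ≢ v → j ≢ u ⊎ i ≢ v → ¬ Joins i j u v
      ¬Joins (inj₁ ¬p) _ (inj₁ (p , _)) = ¬p p
      ¬Joins (inj₂ ¬p) _ (inj₁ (_ , p)) = ¬p p
      ¬Joins _ (inj₁ ¬p) (inj₂ (p , _)) = ¬p p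
      ¬Joins _ (inj₂ ¬p) (inj₂ (_ , p)) = ¬p p

      y∈Nb₁ : y ∈ nbrs G₁ b
      y∈Nb₁ = toggle-keeps-∈ G (¬Joins (inj₁ a≢b) (inj₁ x≢b)) y∈Nb

      b∉Na₂ : b ∉ nbrs G₂ a
      b∉Na₂ = toggle-keeps-∉ G₁ (¬Joins (inj₁ (a≢b ∘ sym)) (inj₁ (a≢y ∘ sym)))
        (toggle-keeps-∉ G (¬Joins (inj₂ x≢b) (inj₁ (a≢x ∘ sym))) b∉Na)

      y∉Nx₃ : y ∉ nbrs G₃ x
      y∉Nx₃ = toggle-keeps-∉ G₂ (¬Joins (inj₁ a≢x) (inj₁ (x≢b ∘ sym)))
        (toggle-keeps-∉ G₁ (¬Joins (inj₁ (x≢b ∘ sym)) (inj₁ (x≢y ∘ sym)))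
          (toggle-keeps-∉ G (¬Joins (inj₁ a≢x) (inj₂ a≢y)) y∉Nx))

      b∈Na₄ : b ∈ nbrs G₄ a
      b∈Na₄ = toggle-keeps-∈ G₃ (¬Joins (inj₁ (a≢x ∘ sym)) (inj₁ (a≢y ∘ sym)))
        (toggle-adds G₂ (inj₁ (refl , refl)) b∉Na₂)

      y∈Nx₄ : y ∈ nbrs G₄ x
      y∈Nx₄ = toggle-adds G₃ (inj₁ (refl , refl)) y∉Nx₃

      weight-switch : ∀ w →
        weight w (switch ((a , x) , (b , y)) G) + ((w a x + w x a) + (w b y + w y b)) ≡
        weight w G + ((w a b + w b a) + (w x y + w y x))
      weight-switch w = begin
        weight w G₄ + (ax + by)
          ≡⟨ cong (_+ (ax + by)) (weight-add G₃ w x≢y (proj₁ simple₃) y∉Nx₃) ⟩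
        weight w G₃ + xy + (ax + by)
          ≡⟨ cong (λ z → z + xy + (ax + by)) (weight-add G₂ w a≢b (proj₁ simple₂) b∉Na₂) ⟩
        weight w G₂ + ab + xy + (ax + by)
          ≡⟨ regroup (weight w G₂) ab xy ax by ⟩
        weight w G₂ + by + ax + (ab + xy)
          ≡⟨ cong (λ z → z + ax + (ab + xy)) (weight-remove G₁ w b≢y (proj₁ simple₁) y∈Nb₁) ⟩
        weight w G₁ + ax + (ab + xy)
          ≡⟨ cong (_+ (ab + xy)) (weight-remove G w a≢x (proj₁ simple) x∈Na) ⟩
        weight w G + (ab + xy) ∎
        where
        open ≡-Reasoning
        ax = w a x + w x a
        by = w b y + w y b
        ab = w a b + w b a
        xy = w x y + w y x
        regroup : ∀ W ab xy ax by → W + ab + xy + (ax + by) ≡ W + by + ax + (ab + xy)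
        regroup = solve-∀

    degree : Adjacency n → Fin n → ℕ
    degree G u = ∑[ v ∈ allFin n ] edge G u v

    #nbrs≡degree : ∀ G u → # nbrs G u ≡ degree G u
    #nbrs≡degree G u = #≡∑ (nbrs G u)

    degree≡weight : ∀ G c → degree G c ≡ weight (λ u _ → 𝟙 (c Fin.≟ u)) G
    degree≡weight G c = sym (trans (∑-cong (allFin n) λ u → ∑-*ˡ (allFin n) (𝟙 (c Fin.≟ u)) (edge G u))
      (∑-𝟙≡ c (degree G)))

  𝟙-× : {P Q : Set} (p : Dec P) (q : Dec Q) → 𝟙 (p ×-dec q) ≡ 𝟙 p * 𝟙 q
  𝟙-× (yes _) (yes _) = refl
  𝟙-× (yes _) (no _)  = refl
  𝟙-× (no _)  _       = refl

  -- Counting switchings between two fixed disjoint sets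

  module Switching {n : ℕ} (d : ℕ) (A B : Subset n) (A∩B : Empty (A ∩ B)) where

    disjoint : ∀ {v} → v ∈ A → v ∉ B
    disjoint v∈A v∈B = A∩B (_ , x∈p∩q⁺ (v∈A , v∈B))

    α β : Fin n → ℕ
    α v = 𝟙 (v ∈? A)
    β v = 𝟙 (v ∈? B)

    -- The number of edges between `A` and `B`: by disjointness each is met in one orientation only.
    e : Adjacency n → ℕ
    e = weight λ u v → α u * β v

    pairs : List (Fin n × Fin n)
    pairs = cartesianProduct (allFin n) (allFin n)

    labels : List Label
    labels = cartesianProduct pairs pairs

    ∑-labels : ∀ f → ∑ labels f ≡ ∑∑ λ a x → ∑∑ λ b y → f ((a , x) , (b , y))
    ∑-labels f = trans (∑-cartesianProduct pairs pairs f)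
      (trans (∑-cartesianProduct (allFin n) (allFin n) (λ p → ∑[ q ∈ pairs ] f (p , q)))
        (∑∑-cong λ a x → ∑-cartesianProduct (allFin n) (allFin n) (λ q → f ((a , x) , q))))

    ∑∑-*ˡ : ∀ c (f : Fin n → Fin n → ℕ) → ∑∑ (λ u v → c * f u v) ≡ c * ∑∑ f
    ∑∑-*ˡ c f = trans (∑-cong (allFin n) λ u → ∑-*ˡ (allFin n) c (f u)) (∑-*ˡ (allFin n) c _)

    ∑∑-*ʳ : ∀ c (f : Fin n → Fin n → ℕ) → ∑∑ (λ u v → f u v * c) ≡ ∑∑ f * c
    ∑∑-*ʳ c f = trans (∑-cong (allFin n) λ u → ∑-*ʳ (allFin n) c (f u)) (∑-*ʳ (allFin n) c _)

    ∑∑-product : ∀ (f g : Fin n → Fin n → ℕ) → ∑∑ (λ a x → ∑∑ λ b y → f a x * g b y) ≡ ∑∑ f * ∑∑ g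
    ∑∑-product f g = trans (∑∑-cong λ a x → ∑∑-*ˡ (f a x) g) (∑∑-*ʳ (∑∑ g) f)

    ∑-swap-inner : ∀ (f : Fin n → Fin n → Fin n → Fin n → ℕ) →
      ∑∑ (λ a x → ∑∑ λ b y → f a x b y) ≡ ∑∑ (λ a b → ∑∑ λ x y → f a x b y)
    ∑-swap-inner f = ∑-cong (allFin n) λ a → ∑-comm (allFin n) (allFin n) _

    -- `x ∉ B` and `y ∉ A` ensure that neither removed edge runs between `A` and `B`, so a switching
    -- never lowers `e`. They also separate x from b and y from a.
    Valid : Adjacency n → Label → Set
    Valid G ((a , x) , (b , y)) =
      (a ∈ A × x ∉ B × x ∈ nbrs G a) × (b ∈ B × y ∉ A × y ∈ nbrs G b) ×
      b ∉ nbrs G a × y ∉ nbrs G x × x ≢ y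

    valid? : ∀ G t → Dec (Valid G t)
    valid? G ((a , x) , (b , y)) =
      ((a ∈? A) ×-dec ¬? (x ∈? B) ×-dec (x ∈? nbrs G a)) ×-dec
      ((b ∈? B) ×-dec ¬? (y ∈? A) ×-dec (y ∈? nbrs G b)) ×-dec
      ¬? (b ∈? nbrs G a) ×-dec ¬? (y ∈? nbrs G x) ×-dec ¬? (x Fin.≟ y)

    -- Switching at a crossing label creates a second edge between A and B.
    Crossing : Label → Set
    Crossing ((_ , x) , (_ , y)) = x ∈ A × y ∈ B

    crossing? : ∀ t → Dec (Crossing t)
    crossing? ((_ , x) , (_ , y)) = (x ∈? A) ×-dec (y ∈? B)

    -- Only the two created edges are recorded. This has an exact count, an edge ab between `A` and
    -- `B` times an oriented edge xy, which bounds the number of ways to undo a switching.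
    Reverse : Adjacency n → Label → Set
    Reverse G ((a , x) , (b , y)) = (a ∈ A × b ∈ B × b ∈ nbrs G a) × y ∈ nbrs G x

    reverse? : ∀ G t → Dec (Reverse G t)
    reverse? G ((a , x) , (b , y)) = ((a ∈? A) ×-dec (b ∈? B) ×-dec (b ∈? nbrs G a)) ×-dec (y ∈? nbrs G x)

    module _ (G : Adjacency n) (simple : IsSimple G) (regular : IsRegular d G) where

      edge-sym : ∀ u v → edge G u v ≡ edge G v u
      edge-sym u v = 𝟙-cong (v ∈? nbrs G u) (u ∈? nbrs G v) (proj₁ simple u v) (proj₁ simple v u)

      degree≡d : ∀ u → degree G u ≡ d
      degree≡d u = trans (sym (#nbrs≡degree G u)) (regular u)

      ∑-edge-*ʳ : ∀ u c → (∑[ v ∈ allFin n ] edge G u v * c) ≡ d * c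
      ∑-edge-*ʳ u c = trans (∑-*ʳ (allFin n) c (edge G u)) (cong (_* c) (degree≡d u))

      ∑∑-𝟙∈-edge : ∀ (S : Subset n) → ∑∑ (λ u v → 𝟙 (u ∈? S) * edge G u v) ≡ # S * d
      ∑∑-𝟙∈-edge S = trans
        (∑-cong (allFin n) λ u → trans (∑-*ˡ (allFin n) (𝟙 (u ∈? S)) (edge G u)) (cong (𝟙 (u ∈? S) *_) (degree≡d u)))
        (trans (∑-*ʳ (allFin n) d _) (cong (_* d) (sym (#≡∑ S))))

      outgoing : (S T : Subset n) → ℕ
      outgoing S T = ∑∑ λ u v → 𝟙 ((u ∈? S) ×-dec ¬? (v ∈? T) ×-dec (v ∈? nbrs G u))

      outgoing+inside : ∀ S T →
        outgoing S T + ∑∑ (λ u v → 𝟙 (u ∈? S) * 𝟙 (v ∈? T) * edge G u v) ≡ # S * d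
      outgoing+inside S T = trans (sym (∑∑-+ (λ u v → 𝟙 ((u ∈? S) ×-dec ¬? (v ∈? T) ×-dec (v ∈? nbrs G u))) _))
        (trans (∑∑-cong λ u v → pointwise (u ∈? S) (v ∈? T) (v ∈? nbrs G u)) (∑∑-𝟙∈-edge S))
        where
        pointwise : {P Q R : Set} (p : Dec P) (q : Dec Q) (r : Dec R) →
          𝟙 (p ×-dec ¬? q ×-dec r) + 𝟙 p * 𝟙 q * 𝟙 r ≡ 𝟙 p * 𝟙 r
        pointwise (no _)  _       _       = refl
        pointwise (yes _) (yes _) (yes _) = refl
        pointwise (yes _) (yes _) (no _)  = refl
        pointwise (yes _) (no _)  (yes _) = refl
        pointwise (yes _) (no _)  (no _)  = refl

      outgoing-A : outgoing A B + e G ≡ # A * d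
      outgoing-A = outgoing+inside A B

      outgoing-B : outgoing B A + e G ≡ # B * d
      outgoing-B = trans (cong (outgoing B A +_)
        (trans (∑-comm (allFin n) (allFin n) _)
          (∑∑-cong λ u v → cong₂ _*_ (*-comm (α v) (β u)) (edge-sym v u))))
        (outgoing+inside B A)

      -- Pairs of edges ax, by that cannot be switched because ab is an edge, xy is an edge, or x = y.
      blocked₁ blocked₂ blocked₃ : Label → ℕ
      blocked₁ ((a , x) , (b , y)) = edge G a x * ((α a * β b * edge G a b) * edge G b y)
      blocked₂ ((a , x) , (b , y)) = (α a * edge G a x) * (edge G x y * edge G y b)
      blocked₃ ((a , x) , (b , y)) = (α a * edge G a x) * (𝟙 (x Fin.≟ y) * edge G y b)

      -- Choose the edge ab between `A` and `B`, then a neighbour x of a and a neighbour y of b.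
      ∑-blocked₁ : ∑ labels blocked₁ ≡ d * (e G * d)
      ∑-blocked₁ = begin
        ∑ labels blocked₁
          ≡⟨ ∑-labels blocked₁ ⟩
        ∑∑ (λ a x → ∑∑ λ b y → edge G a x * ((α a * β b * edge G a b) * edge G b y))
          ≡⟨ ∑∑-cong (λ a x → ∑∑-*ˡ (edge G a x) _) ⟩
        ∑∑ (λ a x → edge G a x * ∑∑ λ b y → (α a * β b * edge G a b) * edge G b y)
          ≡⟨ ∑-cong (allFin n) (λ a → ∑-edge-*ʳ a _) ⟩
        (∑[ a ∈ allFin n ] d * ∑∑ λ b y → (α a * β b * edge G a b) * edge G b y)
          ≡⟨ ∑-*ˡ (allFin n) d _ ⟩
        d * (∑[ a ∈ allFin n ] ∑[ b ∈ allFin n ] ∑[ y ∈ allFin n ] (α a * β b * edge G a b) * edge G b y)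
          ≡⟨ cong (d *_) (∑∑-cong λ a b → trans (∑-*ˡ (allFin n) (α a * β b * edge G a b) _)
               (cong (α a * β b * edge G a b *_) (degree≡d b))) ⟩
        d * ∑∑ (λ a b → (α a * β b * edge G a b) * d)
          ≡⟨ cong (d *_) (∑∑-*ʳ d _) ⟩
        d * (e G * d) ∎
        where open ≡-Reasoning

      -- The labels are walks a, x, y, b starting in `A`, where `s` is adjacency or equality of x
      -- and y. With b left free the sum collapses from the far end, one degree at a time.
      ∑-path : ∀ (s : Fin n → Fin n → ℕ) c → (∀ x → (∑[ y ∈ allFin n ] s x y * d) ≡ c) →
        ∑ labels (λ ((a , x) , (b , y)) → (α a * edge G a x) * (s x y * edge G y b)) ≡ # A * d * c
      ∑-path s c s≡ = begin
        ∑ labels (λ ((a , x) , (b , y)) → (α a * edge G a x) * (s x y * edge G y b))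
          ≡⟨ ∑-labels _ ⟩
        ∑∑ (λ a x → ∑∑ λ b y → (α a * edge G a x) * (s x y * edge G y b))
          ≡⟨ ∑∑-cong (λ a x → trans (∑∑-*ˡ (α a * edge G a x) _) (cong (α a * edge G a x *_) (inner x))) ⟩
        ∑∑ (λ a x → (α a * edge G a x) * c)
          ≡⟨ ∑∑-*ʳ c _ ⟩
        ∑∑ (λ a x → α a * edge G a x) * c
          ≡⟨ cong (_* c) (∑∑-𝟙∈-edge A) ⟩
        # A * d * c ∎
        where
        open ≡-Reasoning
        inner : ∀ x → ∑∑ (λ b y → s x y * edge G y b) ≡ c
        inner x = trans (∑-comm (allFin n) (allFin n) _)
          (trans (∑-cong (allFin n) λ y → trans (∑-*ˡ (allFin n) (s x y) (edge G y)) (cong (s x y *_) (degree≡d y)))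
            (s≡ x))

      ∑-blocked₂ : ∑ labels blocked₂ ≡ # A * d * (d * d)
      ∑-blocked₂ = ∑-path (edge G) (d * d) (λ x → ∑-edge-*ʳ x d)

      ∑-blocked₃ : ∑ labels blocked₃ ≡ # A * d * d
      ∑-blocked₃ = ∑-path (λ x y → 𝟙 (x Fin.≟ y)) d (λ x → ∑-𝟙≡ x (λ _ → d))

      valid-or-blocked : ∀ a x b y →
        𝟙 ((a ∈? A) ×-dec ¬? (x ∈? B) ×-dec (x ∈? nbrs G a)) *
        𝟙 ((b ∈? B) ×-dec ¬? (y ∈? A) ×-dec (y ∈? nbrs G b)) ≤
        𝟙 (valid? G ((a , x) , (b , y))) +
        (blocked₁ ((a , x) , (b , y)) + (blocked₂ ((a , x) , (b , y)) + blocked₃ ((a , x) , (b , y))))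
      -- Reversing the edge yb lets validity and blocking be decided by the same nine decisions.
      valid-or-blocked a x b y rewrite edge-sym y b =
        pointwise (a ∈? A) (x ∈? B) (x ∈? nbrs G a) (b ∈? B) (y ∈? A) (y ∈? nbrs G b)
          (b ∈? nbrs G a) (y ∈? nbrs G x) (x Fin.≟ y)
        where
        pointwise : {P Q R P′ Q′ R′ S T U : Set} (p : Dec P) (q : Dec Q) (r : Dec R)
          (p′ : Dec P′) (q′ : Dec Q′) (r′ : Dec R′) (s : Dec S) (t : Dec T) (u : Dec U) →
          𝟙 (p ×-dec ¬? q ×-dec r) * 𝟙 (p′ ×-dec ¬? q′ ×-dec r′) ≤
          𝟙 ((p ×-dec ¬? q ×-dec r) ×-dec (p′ ×-dec ¬? q′ ×-dec r′) ×-dec ¬? s ×-dec ¬? t ×-dec ¬? u) +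
          (𝟙 r * ((𝟙 p * 𝟙 p′ * 𝟙 s) * 𝟙 r′) + ((𝟙 p * 𝟙 r) * (𝟙 t * 𝟙 r′) + (𝟙 p * 𝟙 r) * (𝟙 u * 𝟙 r′)))
        pointwise (no _)  _       _       _       _       _       _ _ _ = z≤n
        pointwise (yes _) (yes _) _       _       _       _       _ _ _ = z≤n
        pointwise (yes _) (no _)  (no _)  _       _       _       _ _ _ = z≤n
        pointwise (yes _) (no _)  (yes _) (no _)  _       _       _ _ _ = z≤n
        pointwise (yes _) (no _)  (yes _) (yes _) (yes _) _       _ _ _ = z≤n
        pointwise (yes _) (no _)  (yes _) (yes _) (no _)  (no _)  _ _ _ = z≤n
        pointwise (yes _) (no _)  (yes _) (yes _) (no _)  (yes _) (yes _) _       _       = s≤s z≤n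
        pointwise (yes _) (no _)  (yes _) (yes _) (no _)  (yes _) (no _)  (yes _) _       = s≤s z≤n
        pointwise (yes _) (no _)  (yes _) (yes _) (no _)  (yes _) (no _)  (no _)  (yes _) = s≤s z≤n
        pointwise (yes _) (no _)  (yes _) (yes _) (no _)  (yes _) (no _)  (no _)  (no _)  = s≤s z≤n

      valid-count : outgoing A B * outgoing B A ≤
        ∑ labels (λ t → 𝟙 (valid? G t)) + (d * (e G * d) + (# A * d * (d * d) + # A * d * d))
      valid-count = begin
        outgoing A B * outgoing B A
          ≡⟨ ∑∑-product out-A out-B ⟨
        ∑∑ (λ a x → ∑∑ λ b y → out-A a x * out-B b y)
          ≡⟨ ∑-labels (λ ((a , x) , (b , y)) → out-A a x * out-B b y) ⟨
        ∑ labels (λ ((a , x) , (b , y)) → out-A a x * out-B b y)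
          ≤⟨ ∑-mono labels (λ ((a , x) , (b , y)) → valid-or-blocked a x b y) ⟩
        ∑ labels (λ t → valid t + (blocked₁ t + (blocked₂ t + blocked₃ t)))
          ≡⟨ ∑-+ labels valid (λ t → blocked₁ t + (blocked₂ t + blocked₃ t)) ⟩
        ∑ labels valid + ∑ labels (λ t → blocked₁ t + (blocked₂ t + blocked₃ t))
          ≡⟨ cong (∑ labels valid +_) (trans (∑-+ labels blocked₁ (λ t → blocked₂ t + blocked₃ t))
               (cong₂ _+_ ∑-blocked₁ (trans (∑-+ labels blocked₂ blocked₃) (cong₂ _+_ ∑-blocked₂ ∑-blocked₃)))) ⟩
        ∑ labels valid + (d * (e G * d) + (# A * d * (d * d) + # A * d * d)) ∎
        where
        open ≤-Reasoning
        valid : Label → ℕ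
        valid t = 𝟙 (valid? G t)
        out-A out-B : Fin n → Fin n → ℕ
        out-A a x = 𝟙 ((a ∈? A) ×-dec ¬? (x ∈? B) ×-dec (x ∈? nbrs G a))
        out-B b y = 𝟙 ((b ∈? B) ×-dec ¬? (y ∈? A) ×-dec (y ∈? nbrs G b))

      reverse-count : ∑ labels (λ t → 𝟙 (reverse? G t)) ≡ e G * (n * d)
      reverse-count = begin
        ∑ labels (λ t → 𝟙 (reverse? G t))
          ≡⟨ ∑-labels (λ t → 𝟙 (reverse? G t)) ⟩
        ∑∑ (λ a x → ∑∑ λ b y → 𝟙 (reverse? G ((a , x) , (b , y))))
          ≡⟨ ∑-swap-inner (λ a x b y → 𝟙 (reverse? G ((a , x) , (b , y)))) ⟩
        ∑∑ (λ a b → ∑∑ λ x y → 𝟙 (reverse? G ((a , x) , (b , y))))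
          ≡⟨ ∑∑-cong (λ a b → ∑∑-cong λ x y → factor a x b y) ⟩
        ∑∑ (λ a b → ∑∑ λ x y → (α a * β b * edge G a b) * edge G x y)
          ≡⟨ ∑∑-product (λ a b → α a * β b * edge G a b) (edge G) ⟩
        e G * ∑∑ (edge G)
          ≡⟨ cong (e G *_) (trans (∑-cong (allFin n) degree≡d) (trans (∑-const (allFin n) d)
               (cong (_* d) (length-tabulate {n = n} id)))) ⟩
        e G * (n * d) ∎
        where
        open ≡-Reasoning
        factor : ∀ a x b y → 𝟙 (reverse? G ((a , x) , (b , y))) ≡ (α a * β b * edge G a b) * edge G x y
        factor a x b y = trans (𝟙-× ((a ∈? A) ×-dec (b ∈? B) ×-dec (b ∈? nbrs G a)) (y ∈? nbrs G x))
          (cong (_* edge G x y) (trans (𝟙-× (a ∈? A) ((b ∈? B) ×-dec (b ∈? nbrs G a)))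
            (trans (cong (α a *_) (𝟙-× (b ∈? B) (b ∈? nbrs G a))) (sym (*-assoc (α a) (β b) _)))))

      -- At a crossing label xy is itself an edge between `A` and `B`. Both edges are thus chosen
      -- among `e G`, instead of one of them among all n d oriented edges.
      crossing-reverse-count : ∑ labels (λ t → 𝟙 (crossing? t ×-dec reverse? G t)) ≡ e G * e G
      crossing-reverse-count = begin
        ∑ labels (λ t → 𝟙 (crossing? t ×-dec reverse? G t))
          ≡⟨ ∑-labels (λ t → 𝟙 (crossing? t ×-dec reverse? G t)) ⟩
        ∑∑ (λ a x → ∑∑ λ b y → 𝟙 (crossing? ((a , x) , (b , y)) ×-dec reverse? G ((a , x) , (b , y))))
          ≡⟨ ∑-swap-inner (λ a x b y → 𝟙 (crossing? ((a , x) , (b , y)) ×-dec reverse? G ((a , x) , (b , y)))) ⟩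
        ∑∑ (λ a b → ∑∑ λ x y → 𝟙 (crossing? ((a , x) , (b , y)) ×-dec reverse? G ((a , x) , (b , y))))
          ≡⟨ ∑∑-cong (λ a b → ∑∑-cong λ x y →
               pointwise (x ∈? A) (y ∈? B) (a ∈? A) (b ∈? B) (b ∈? nbrs G a) (y ∈? nbrs G x)) ⟩
        ∑∑ (λ a b → ∑∑ λ x y → (α a * β b * edge G a b) * (α x * β y * edge G x y))
          ≡⟨ ∑∑-product (λ a b → α a * β b * edge G a b) (λ x y → α x * β y * edge G x y) ⟩
        e G * e G ∎
        where
        open ≡-Reasoning
        pointwise : {P Q R S T U : Set} (p : Dec P) (q : Dec Q) (r : Dec R) (s : Dec S) (t : Dec T) (u : Dec U) →
          𝟙 ((p ×-dec q) ×-dec ((r ×-dec s ×-dec t) ×-dec u)) ≡ (𝟙 r * 𝟙 s * 𝟙 t) * (𝟙 p * 𝟙 q * 𝟙 u)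
        pointwise p q r s t u = trans (𝟙-× (p ×-dec q) _)
          (trans (cong₂ _*_ (𝟙-× p q) (trans (𝟙-× (r ×-dec s ×-dec t) u)
              (cong (_* 𝟙 u) (trans (𝟙-× r (s ×-dec t)) (cong (𝟙 r *_) (𝟙-× s t))))))
            (rearrange (𝟙 p) (𝟙 q) (𝟙 r) (𝟙 s) (𝟙 t) (𝟙 u)))
          where
          rearrange : ∀ p q r s t u → (p * q) * ((r * (s * t)) * u) ≡ (r * s * t) * (p * q * u)
          rearrange = solve-∀

    module _ (G : Adjacency n) (simple : IsSimple G) (regular : IsRegular d G)
      {a x b y : Fin n} (valid : Valid G ((a , x) , (b , y))) where

      private
        a∈A = proj₁ (proj₁ valid)
        x∉B = proj₁ (proj₂ (proj₁ valid))
        b∈B = proj₁ (proj₁ (proj₂ valid))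
        y∉A = proj₁ (proj₂ (proj₁ (proj₂ valid)))
        G′ = switch ((a , x) , (b , y)) G

        a≢b : a ≢ b
        a≢b refl = disjoint a∈A b∈B
        a≢y : a ≢ y
        a≢y refl = y∉A a∈A
        x≢b : x ≢ b
        x≢b refl = x∉B b∈B

        open Switch G simple {a} {x} {b} {y} (proj₂ (proj₂ (proj₁ valid))) (proj₂ (proj₂ (proj₁ (proj₂ valid))))
          (proj₁ (proj₂ (proj₂ valid))) (proj₁ (proj₂ (proj₂ (proj₂ valid)))) a≢b a≢y x≢b
          (proj₂ (proj₂ (proj₂ (proj₂ valid))))

      -- With the weight that sees only edges starting at `c`, the switching identity says that each
      -- of the four endpoints loses one edge and gains one.
      switch-regular : IsRegular d G′
      switch-regular c = trans (#nbrs≡degree G′ c) (trans (degree≡weight G′ c)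
        (trans (+-cancelʳ-≡ _ _ _ (trans (weight-switch w) (cong (weight w G +_) (swap-ends (δ a) (δ x) (δ b) (δ y)))))
          (trans (sym (degree≡weight G c)) (degree≡d G simple regular c))))
        where
        δ : Fin n → ℕ
        δ u = 𝟙 (c Fin.≟ u)
        w : Fin n → Fin n → ℕ
        w u _ = δ u
        swap-ends : ∀ a x b y → (a + b) + (x + y) ≡ (a + x) + (b + y)
        swap-ends = solve-∀

      switch-∈ : switch ((a , x) , (b , y)) G ∈ˡ regularGraphs d n
      switch-∈ = ∈-regularGraphs⁺ G′ switch-simple switch-regular

      switch-reverse : Reverse (switch ((a , x) , (b , y)) G) ((a , x) , (b , y))
      switch-reverse = (a∈A , b∈B , b∈Na₄) , y∈Nx₄

      e-switch : e (switch ((a , x) , (b , y)) G) ≡ suc (e G) + 𝟙 (crossing? ((a , x) , (b , y)))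
      e-switch = begin
        e G′
          ≡⟨ +-identityʳ (e G′) ⟨
        e G′ + 0
          ≡⟨ cong (e G′ +_) (sym removed) ⟩
        e G′ + ((α a * β x + α x * β a) + (α b * β y + α y * β b))
          ≡⟨ weight-switch (λ u v → α u * β v) ⟩
        e G + ((α a * β b + α b * β a) + (α x * β y + α y * β x))
          ≡⟨ cong (e G +_) (cong₂ _+_ (cong₂ _+_ (cong₂ _*_ (in-A a∈A) (in-B b∈B)) (cong (α b *_) (not-B (disjoint a∈A))))
               (cong₂ _+_ (sym (𝟙-× (x ∈? A) (y ∈? B))) (cong (_* β x) (not-A y∉A)))) ⟩
        e G + ((1 + α b * 0) + (𝟙 (crossing? ((a , x) , (b , y))) + 0))
          ≡⟨ tidy (e G) (α b) _ ⟩
        suc (e G) + 𝟙 (crossing? ((a , x) , (b , y))) ∎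
        where
        open ≡-Reasoning
        in-A : ∀ {v} → v ∈ A → α v ≡ 1
        in-A = 𝟙-yes (_ ∈? A)
        in-B : ∀ {v} → v ∈ B → β v ≡ 1
        in-B = 𝟙-yes (_ ∈? B)
        not-A : ∀ {v} → v ∉ A → α v ≡ 0
        not-A = 𝟙-no (_ ∈? A)
        not-B : ∀ {v} → v ∉ B → β v ≡ 0
        not-B = 𝟙-no (_ ∈? B)
        tidy : ∀ e z c → e + ((1 + z * 0) + (c + 0)) ≡ suc e + c
        tidy = solve-∀
        removed : (α a * β x + α x * β a) + (α b * β y + α y * β b) ≡ 0
        removed = cong₂ _+_
          (cong₂ _+_ (trans (cong (α a *_) (not-B x∉B)) (*-zeroʳ (α a)))
                     (trans (cong (α x *_) (not-B (disjoint a∈A))) (*-zeroʳ (α x))))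
          (cong₂ _+_ (cong (_* β y) (not-A λ b∈A → disjoint b∈A b∈B)) (cong (_* β b) (not-A y∉A)))

    graphs : List (Adjacency n)
    graphs = regularGraphs d n

    count : ℕ → ℕ
    count k = ∑[ G ∈ graphs ] 𝟙 (e G ≟ k)

    count≤length : ∀ k → count k ≤ length graphs
    count≤length k = ≤-trans (∑-mono graphs λ G → 𝟙≤1 (e G ≟ k))
      (≤-reflexive (trans (∑-const graphs 1) (*-identityʳ _)))

    ∑-𝟙-× : ∀ {P : Set} (p : Dec P) {Q : Label → Set} (Q? : ∀ t → Dec (Q t)) →
      ∑ labels (λ t → 𝟙 (p ×-dec Q? t)) ≡ 𝟙 p * ∑ labels (λ t → 𝟙 (Q? t))
    ∑-𝟙-× p Q? = trans (∑-cong labels λ t → 𝟙-× p (Q? t)) (∑-*ˡ labels (𝟙 p) _)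

    ∑-𝟙-level : ∀ k c {f : Adjacency n → ℕ} → (∀ {G} → G ∈ˡ graphs → e G ≡ k → f G ≤ c) →
      (∑[ G ∈ graphs ] 𝟙 (e G ≟ k) * f G) ≤ count k * c
    ∑-𝟙-level k c {f} f≤c = ≤-trans (∑-mono-∈ graphs λ {G} G∈ → bound G∈ (e G ≟ k))
      (≤-reflexive (∑-*ʳ graphs c _))
      where
      bound : ∀ {G} → G ∈ˡ graphs → (eq? : Dec (e G ≡ k)) → 𝟙 eq? * f G ≤ 𝟙 eq? * c
      bound G∈ (yes eq) = *-monoʳ-≤ 1 (f≤c G∈ eq)
      bound G∈ (no _)   = z≤n

    -- The square counts the pairs of edges leaving A for outside B and B for outside A,
    -- and the terms added to F bound the blocked pairs.
    switching-inequality : ∀ k F → # A ≡ # B →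
      F + (d * (k * d) + (# A * d * (d * d) + # A * d * d)) ≤ (# A * d ∸ k) * (# A * d ∸ k) →
      count k * F ≤ count (suc k) * (suc k * (n * d)) + count (2 + k) * ((2 + k) * (2 + k))
    switching-inequality k F #A≡#B F-bound = begin
      count k * F
        ≡⟨ ∑-*ʳ graphs F _ ⟨
      (∑[ G ∈ graphs ] 𝟙 (e G ≟ k) * F)
        ≤⟨ ∑-mono-∈ graphs (λ {G} G∈ → F≤labels G∈ (e G ≟ k)) ⟩
      (∑[ G ∈ graphs ] (∑[ t ∈ labels ] 𝟙 (V₁? G t)) + (∑[ t ∈ labels ] 𝟙 (V₂? G t)))
        ≡⟨ ∑-+ graphs _ _ ⟩
      (∑[ G ∈ graphs ] ∑[ t ∈ labels ] 𝟙 (V₁? G t)) + (∑[ G ∈ graphs ] ∑[ t ∈ labels ] 𝟙 (V₂? G t))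
        ≤⟨ +-mono-≤
             (double-counting graphs labels (regularGraphs-unique d n) switch switch-injective V₁? R₁? maps₁)
             (double-counting graphs labels (regularGraphs-unique d n) switch switch-injective V₂? R₂? maps₂) ⟩
      (∑[ G ∈ graphs ] ∑[ t ∈ labels ] 𝟙 (R₁? G t)) + (∑[ G ∈ graphs ] ∑[ t ∈ labels ] 𝟙 (R₂? G t))
        ≡⟨ cong₂ _+_ (∑-cong graphs λ G → ∑-𝟙-× (e G ≟ suc k) (reverse? G))
                     (∑-cong graphs λ G → ∑-𝟙-× (e G ≟ 2 + k) (λ t → crossing? t ×-dec reverse? G t)) ⟩
      (∑[ G ∈ graphs ] 𝟙 (e G ≟ suc k) * (∑[ t ∈ labels ] 𝟙 (reverse? G t))) +
      (∑[ G ∈ graphs ] 𝟙 (e G ≟ 2 + k) * (∑[ t ∈ labels ] 𝟙 (crossing? t ×-dec reverse? G t)))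
        ≤⟨ +-mono-≤
             (∑-𝟙-level (suc k) (suc k * (n * d)) λ {G} G∈ eq → ≤-reflexive
               (trans (uncurry (reverse-count G) (∈-regularGraphs⁻ G G∈)) (cong (_* (n * d)) eq)))
             (∑-𝟙-level (2 + k) ((2 + k) * (2 + k)) λ {G} G∈ eq → ≤-reflexive
               (trans (uncurry (crossing-reverse-count G) (∈-regularGraphs⁻ G G∈)) (cong₂ _*_ eq eq))) ⟩
      count (suc k) * (suc k * (n * d)) + count (2 + k) * ((2 + k) * (2 + k)) ∎
      where
      open ≤-Reasoning

      -- The split by crossing decides the level on which the switched graph lands, `suc k` or
      -- `2 + k`.
      V₁ V₂ R₁ R₂ : Adjacency n → Label → Set
      V₁ G t = e G ≡ k × ¬ Crossing t × Valid G t
      V₂ G t = e G ≡ k × Crossing t × Valid G t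
      R₁ G t = e G ≡ suc k × Reverse G t
      R₂ G t = e G ≡ 2 + k × Crossing t × Reverse G t

      V₁? : ∀ G t → Dec (V₁ G t)
      V₁? G t = (e G ≟ k) ×-dec ¬? (crossing? t) ×-dec valid? G t
      V₂? : ∀ G t → Dec (V₂ G t)
      V₂? G t = (e G ≟ k) ×-dec crossing? t ×-dec valid? G t
      R₁? : ∀ G t → Dec (R₁ G t)
      R₁? G t = (e G ≟ suc k) ×-dec reverse? G t
      R₂? : ∀ G t → Dec (R₂ G t)
      R₂? G t = (e G ≟ 2 + k) ×-dec crossing? t ×-dec reverse? G t

      maps₁ : ∀ t {G} → G ∈ˡ graphs → V₁ G t → switch t G ∈ˡ graphs × R₁ (switch t G) t
      maps₁ t {G} G∈ (eq , ¬cross , valid) with simple , regular ← ∈-regularGraphs⁻ G G∈ =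
        switch-∈ G simple regular valid ,
        trans (e-switch G simple regular valid) (trans (cong₂ (λ p q → suc p + q) eq (𝟙-no (crossing? t) ¬cross))
          (+-identityʳ (suc k))) ,
        switch-reverse G simple regular valid

      maps₂ : ∀ t {G} → G ∈ˡ graphs → V₂ G t → switch t G ∈ˡ graphs × R₂ (switch t G) t
      maps₂ t {G} G∈ (eq , cross , valid) with simple , regular ← ∈-regularGraphs⁻ G G∈ =
        switch-∈ G simple regular valid ,
        trans (e-switch G simple regular valid) (trans (cong₂ (λ p q → suc p + q) eq (𝟙-yes (crossing? t) cross))
          (+-comm (suc k) 1)) ,
        cross , switch-reverse G simple regular valid

      split : {P Q R : Set} (p : Dec P) (q : Dec Q) (r : Dec R) → P →
        𝟙 r ≤ 𝟙 (p ×-dec ¬? q ×-dec r) + 𝟙 (p ×-dec q ×-dec r)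
      split (no ¬p) _       _       p = contradiction p ¬p
      split (yes _) _       (no _)  _ = z≤n
      split (yes _) (yes _) (yes _) _ = s≤s z≤n
      split (yes _) (no _)  (yes _) _ = s≤s z≤n

      F≤labels : ∀ {G} → G ∈ˡ graphs → (eq? : Dec (e G ≡ k)) →
        𝟙 eq? * F ≤ (∑[ t ∈ labels ] 𝟙 (V₁? G t)) + (∑[ t ∈ labels ] 𝟙 (V₂? G t))
      F≤labels {G} G∈ (no _) = z≤n
      F≤labels {G} G∈ (yes eq) with simple , regular ← ∈-regularGraphs⁻ G G∈ = begin
        1 * F
          ≡⟨ *-identityˡ F ⟩
        F
          ≤⟨ +-cancelʳ-≤ _ F _ (≤-trans F-bound (subst₂ _≤_ (sym (cong₂ _*_
               (remaining (outgoing G simple regular A B) (outgoing-A G simple regular))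
               (remaining (outgoing G simple regular B A)
                 (trans (outgoing-B G simple regular) (cong (_* d) (sym #A≡#B))))))
               (cong (λ z → ∑ labels (λ t → 𝟙 (valid? G t)) + (d * (z * d) + (# A * d * (d * d) + # A * d * d))) eq)
               (valid-count G simple regular))) ⟩
        (∑[ t ∈ labels ] 𝟙 (valid? G t))
          ≤⟨ ∑-mono labels (λ t → split (e G ≟ k) (crossing? t) (valid? G t) eq) ⟩
        (∑[ t ∈ labels ] 𝟙 (V₁? G t) + 𝟙 (V₂? G t))
          ≡⟨ ∑-+ labels _ _ ⟩
        (∑[ t ∈ labels ] 𝟙 (V₁? G t)) + (∑[ t ∈ labels ] 𝟙 (V₂? G t)) ∎
        where
        remaining : ∀ m → m + e G ≡ # A * d → # A * d ∸ k ≡ m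
        remaining m m+e≡ = trans (cong₂ _∸_ (sym m+e≡) (sym eq)) (m+n∸n≡m m (e G))

    -- With c k = count k · k! · K^(K ∸ k) the switching inequality gives
    -- c k · F ≤ c (k+1) · K n d + c (k+2) · 2 K², so c stays below its bound N · K! at K and K ∸ 1.
    count-bound : ∀ K F → # A ≡ # B → K * (n * d) + 2 * (K * K) ≤ F →
      F + (d * (K * d) + (# A * d * (d * d) + # A * d * d)) ≤ (# A * d ∸ K) * (# A * d ∸ K) →
      .{{NonZero F}} → ∀ j k → j + k ≡ K → count k * (k ! * K ^ j) ≤ length graphs * K !
    count-bound K F #A≡#B KD≤F F-bound zero k refl =
      *-mono-≤ (count≤length k) (≤-reflexive (*-identityʳ (k !)))
    count-bound K F #A≡#B KD≤F F-bound (suc zero) k refl =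
      *-mono-≤ (count≤length k) (≤-reflexive (trans (cong (k ! *_) (*-identityʳ (suc k))) (*-comm (k !) (suc k))))
    count-bound K F #A≡#B KD≤F F-bound (suc (suc j)) k eq = *-cancelʳ-≤ _ _ F (begin
      count k * (k ! * K ^ (2 + j)) * F
        ≡⟨ swap₁ (count k) (k ! * K ^ (2 + j)) F ⟩
      count k * F * (k ! * (K * (K * K ^ j)))
        ≤⟨ *-monoˡ-≤ _ (switching-inequality k F #A≡#B (≤-trans (+-monoʳ-≤ F (+-monoˡ-≤ _ (*-monoʳ-≤ d (*-monoˡ-≤ d k≤K))))
             (≤-trans F-bound (*-mono-≤ (∸-monoʳ-≤ (# A * d) k≤K) (∸-monoʳ-≤ (# A * d) k≤K))))) ⟩
      (count (suc k) * (suc k * (n * d)) + count (2 + k) * ((2 + k) * (2 + k))) * (k ! * (K * (K * K ^ j)))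
        ≡⟨ *-distribʳ-+ (k ! * (K * (K * K ^ j))) (count (suc k) * (suc k * (n * d))) _ ⟩
      count (suc k) * (suc k * (n * d)) * (k ! * (K * (K * K ^ j))) +
      count (2 + k) * ((2 + k) * (2 + k)) * (k ! * (K * (K * K ^ j)))
        -- One of the two factors `2 + k` is enlarged to `2 * suc k`, so that (k+2)(k+1) · k!
        -- becomes (k+2)!. This is the 2 in `2 * (K * K)`.
        ≤⟨ +-mono-≤ (≤-reflexive (regroup₁ (count (suc k)) (suc k) (n * d) (k !) K (K ^ j)))
             (≤-trans (*-monoˡ-≤ _ (*-monoʳ-≤ (count (2 + k)) (*-monoʳ-≤ (2 + k) 2+k≤)))
               (≤-reflexive (regroup₂ (count (2 + k)) (2 + k) (suc k) (k !) K (K ^ j)))) ⟩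
      count (suc k) * (suc k ! * K ^ (1 + j)) * (K * (n * d)) + count (2 + k) * ((2 + k) ! * K ^ j) * (2 * (K * K))
        ≤⟨ +-mono-≤ (*-monoˡ-≤ _ (count-bound K F #A≡#B KD≤F F-bound (suc j) (suc k) (trans (+-suc (suc j) k) eq)))
                    (*-monoˡ-≤ _ (count-bound K F #A≡#B KD≤F F-bound j (2 + k)
                      (trans (+-suc j (suc k)) (trans (cong suc (+-suc j k)) eq)))) ⟩
      length graphs * K ! * (K * (n * d)) + length graphs * K ! * (2 * (K * K))
        ≡⟨ *-distribˡ-+ (length graphs * K !) (K * (n * d)) _ ⟨
      length graphs * K ! * (K * (n * d) + 2 * (K * K))
        ≤⟨ *-monoʳ-≤ (length graphs * K !) KD≤F ⟩
      length graphs * K ! * F ∎)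
      where
      open ≤-Reasoning
      k≤K : k ≤ K
      k≤K = ≤-trans (m≤n+m k (2 + j)) (≤-reflexive eq)
      2+k≤ : 2 + k ≤ 2 * suc k
      2+k≤ = ≤-trans (m≤m+n (2 + k) k) (≤-reflexive (double k))
        where
        double : ∀ k → 2 + k + k ≡ 2 * suc k
        double = solve-∀
      swap₁ : ∀ a b c → a * b * c ≡ a * c * b
      swap₁ = solve-∀
      regroup₁ : ∀ c s D f K p → c * (s * D) * (f * (K * (K * p))) ≡ c * (s * f * (K * p)) * (K * D)
      regroup₁ = solve-∀
      regroup₂ : ∀ c s t f K p → c * (s * (2 * t)) * (f * (K * (K * p))) ≡ c * (s * (t * f) * p) * (2 * (K * K))
      regroup₂ = solve-∀

  -- Bipartite holes and the union bound over pairs of sets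

  isBipartiteHole? : ∀ {n} (G : Adjacency n) q A B → Dec (IsBipartiteHole G q A B)
  isBipartiteHole? G q A B =
    (# A ≟ q) ×-dec (# B ≟ q) ×-dec ¬? (nonempty? (A ∩ B)) ×-dec
    (Fin.all? λ u → Fin.all? λ v → (u ∈? A) →-dec (v ∈? B) →-dec ¬? (v ∈? nbrs G u))

  hasBipartiteHole? : ∀ {n} q (G : Adjacency n) → Dec (HasBipartiteHole G q)
  hasBipartiteHole? q G = anySubset? λ A → anySubset? λ B → isBipartiteHole? G q A B

  subsetsOfSize : ∀ n → ℕ → List (Subset n)
  subsetsOfSize zero    zero    = [] ∷ []
  subsetsOfSize zero    (suc q) = []
  subsetsOfSize (suc n) zero    = map (outside ∷_) (subsetsOfSize n zero)
  subsetsOfSize (suc n) (suc q) = map (inside ∷_) (subsetsOfSize n q) ++ map (outside ∷_) (subsetsOfSize n (suc q))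

  ∈-subsetsOfSize : ∀ {n} (S : Subset n) q → # S ≡ q → S ∈ˡ subsetsOfSize n q
  ∈-subsetsOfSize []            zero    _    = here refl
  ∈-subsetsOfSize (true ∷ S)  (suc q) #S≡q = ∈-++⁺ˡ (∈-map⁺ (inside ∷_) (∈-subsetsOfSize S q (suc-injective #S≡q)))
  ∈-subsetsOfSize (false ∷ S) zero    #S≡q = ∈-map⁺ (outside ∷_) (∈-subsetsOfSize S zero #S≡q)
  ∈-subsetsOfSize {suc n} (false ∷ S) (suc q) #S≡q =
    ∈-++⁺ʳ (map (inside ∷_) (subsetsOfSize n q)) (∈-map⁺ (outside ∷_) (∈-subsetsOfSize S (suc q) #S≡q))

  bernoulli : ∀ a m → suc m * a ^ m + a ^ suc m ≤ suc a ^ suc m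
  bernoulli a zero    = ≤-reflexive (base a)
    where
    base : ∀ a → 1 * 1 + a * 1 ≡ (1 + a) * 1
    base = solve-∀
  bernoulli a (suc m) = begin
    (2 + m) * (a * a ^ m) + a * (a * a ^ m)
      ≤⟨ m≤m+n _ (suc m * a ^ m) ⟩
    (2 + m) * (a * a ^ m) + a * (a * a ^ m) + suc m * a ^ m
      ≡⟨ regroup a m (a ^ m) ⟩
    suc a * (suc m * a ^ m + a ^ suc m)
      ≤⟨ *-monoʳ-≤ (suc a) (bernoulli a m) ⟩
    suc a * suc a ^ suc m ∎
    where
    open ≤-Reasoning
    regroup : ∀ a m p → (2 + m) * (a * p) + a * (a * p) + (1 + m) * p ≡ (1 + a) * ((1 + m) * p + a * p)
    regroup = solve-∀

  -- Under Pascal's recursion the claim becomes (q+1) n^q + n^(q+1) ≤ (n+1)^(q+1), which is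
  -- `bernoulli`.
  length-subsetsOfSize : ∀ n q → length (subsetsOfSize n q) * q ! ≤ n ^ q
  length-subsetsOfSize zero    zero    = ≤-refl
  length-subsetsOfSize zero    (suc q) = z≤n
  length-subsetsOfSize (suc n) zero    =
    ≤-trans (≤-reflexive (cong (_* 1) (length-map (outside ∷_) (subsetsOfSize n zero)))) (length-subsetsOfSize n zero)
  length-subsetsOfSize (suc n) (suc q) = begin
    length (subsetsOfSize (suc n) (suc q)) * (suc q * q !)
      ≡⟨ cong (_* (suc q * q !)) (trans (length-++ (map (inside ∷_) (subsetsOfSize n q)))
           (cong₂ _+_ (length-map (inside ∷_) (subsetsOfSize n q)) (length-map (outside ∷_) (subsetsOfSize n (suc q))))) ⟩
    (l₀ + l₁) * (suc q * q !)
      ≡⟨ regroup l₀ l₁ (suc q) (q !) ⟩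
    suc q * (l₀ * q !) + l₁ * (suc q * q !)
      ≤⟨ +-mono-≤ (*-monoʳ-≤ (suc q) (length-subsetsOfSize n q)) (length-subsetsOfSize n (suc q)) ⟩
    suc q * n ^ q + n ^ suc q
      ≤⟨ bernoulli n q ⟩
    suc n ^ suc q ∎
    where
    open ≤-Reasoning
    l₀ = length (subsetsOfSize n q)
    l₁ = length (subsetsOfSize n (suc q))
    regroup : ∀ l₀ l₁ s f → (l₀ + l₁) * (s * f) ≡ s * (l₀ * f) + l₁ * (s * f)
    regroup = solve-∀

  module _ {n : ℕ} (d q K : ℕ) .{{_ : NonZero (K * (n * d) + 2 * (K * K))}}
    (K-bound : K * (n * d) + 2 * (K * K) + (d * (K * d) + (q * d * (d * d) + q * d * d)) ≤ (q * d ∸ K) * (q * d ∸ K)) where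

    -- A hole (`A`, `B`) puts the graph on level 0, where `count-bound` applies with j = K. Pairs
    -- that overlap or have the wrong size contribute nothing.
    hole-count : ∀ A B →
      (∑[ G ∈ regularGraphs d n ] 𝟙 (isBipartiteHole? G q A B)) * K ^ K ≤ length (regularGraphs d n) * K !
    hole-count A B with (# A ≟ q) ×-dec (# B ≟ q) ×-dec ¬? (nonempty? (A ∩ B))
    ... | no ¬sizes = ≤-trans (≤-reflexive (cong (_* K ^ K)
            (trans (∑-cong (regularGraphs d n) λ G → 𝟙-no (isBipartiteHole? G q A B)
              (λ (p , r , s , _) → ¬sizes (p , r , s)))
            (∑-zero (regularGraphs d n))))) z≤n
    ... | yes (refl , #B≡q , A∩B) = ≤-trans
            (*-monoˡ-≤ (K ^ K) (∑-mono (regularGraphs d n) λ G →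
              𝟙-mono (isBipartiteHole? G q A B) (e G ≟ 0) (λ (_ , _ , _ , hole) → no-edges G hole)))
            (≤-trans (≤-reflexive (cong (count 0 *_) (sym (+-identityʳ (K ^ K)))))
              (count-bound K _ (sym #B≡q) ≤-refl K-bound K 0 (+-identityʳ K)))
      where
      open Switching d A B A∩B
      no-edges : ∀ G → (∀ u v → u ∈ A → v ∈ B → v ∉ nbrs G u) → e G ≡ 0
      no-edges G hole = trans
        (∑∑-cong λ u v → pointwise (u ∈? A) (v ∈? B) (v ∈? nbrs G u) (hole u v))
        (trans (∑-cong (allFin n) λ _ → ∑-zero (allFin n)) (∑-zero (allFin n)))
        where
        pointwise : {P Q R : Set} (p : Dec P) (q : Dec Q) (r : Dec R) → (P → Q → ¬ R) → 𝟙 p * 𝟙 q * 𝟙 r ≡ 0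
        pointwise (no _)  _       _       _ = refl
        pointwise (yes _) (no _)  _       _ = refl
        pointwise (yes _) (yes _) (no _)  _ = refl
        pointwise (yes p) (yes q) (yes r) h = contradiction r (h p q)

    holes-count : length (filter (hasBipartiteHole? q) (regularGraphs d n)) * K ^ K * (q ! * q !) ≤
      n ^ q * n ^ q * (length (regularGraphs d n) * K !)
    holes-count = begin
      length (filter (hasBipartiteHole? q) graphs) * K ^ K * (q ! * q !)
        ≡⟨ cong (λ z → z * K ^ K * (q ! * q !)) (length-filter (hasBipartiteHole? q) graphs) ⟩
      (∑[ G ∈ graphs ] 𝟙 (hasBipartiteHole? q G)) * K ^ K * (q ! * q !)
        ≤⟨ *-monoˡ-≤ (q ! * q !) (*-monoˡ-≤ (K ^ K) (∑-mono graphs union)) ⟩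
      (∑[ G ∈ graphs ] ∑[ A ∈ subs ] ∑[ B ∈ subs ] 𝟙 (isBipartiteHole? G q A B)) * K ^ K * (q ! * q !)
        ≡⟨ cong (λ z → z * (q ! * q !)) (trans (cong (_* K ^ K) (trans (∑-comm graphs subs _)
             (∑-cong subs λ A → ∑-comm graphs subs _))) (trans (sym (∑-*ʳ subs (K ^ K) _))
               (∑-cong subs λ A → sym (∑-*ʳ subs (K ^ K) _)))) ⟩
      (∑[ A ∈ subs ] ∑[ B ∈ subs ] (∑[ G ∈ graphs ] 𝟙 (isBipartiteHole? G q A B)) * K ^ K) * (q ! * q !)
        ≤⟨ *-monoˡ-≤ (q ! * q !) (∑-mono subs λ A → ∑-mono subs λ B → hole-count A B) ⟩
      (∑[ A ∈ subs ] ∑[ B ∈ subs ] length graphs * K !) * (q ! * q !)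
        ≡⟨ cong (_* (q ! * q !)) (trans (∑-cong subs λ _ → ∑-const subs _) (∑-const subs _)) ⟩
      length subs * (length subs * (length graphs * K !)) * (q ! * q !)
        ≡⟨ regroup (length subs) (length graphs * K !) (q !) ⟩
      length subs * q ! * (length subs * q !) * (length graphs * K !)
        ≤⟨ *-monoˡ-≤ (length graphs * K !) (*-mono-≤ (length-subsetsOfSize n q) (length-subsetsOfSize n q)) ⟩
      n ^ q * n ^ q * (length graphs * K !) ∎
      where
      open ≤-Reasoning
      graphs = regularGraphs d n
      subs = subsetsOfSize n q
      regroup : ∀ l g f → l * (l * g) * (f * f) ≡ l * f * (l * f) * g
      regroup = solve-∀
      union : ∀ G → 𝟙 (hasBipartiteHole? q G) ≤ (∑[ A ∈ subs ] ∑[ B ∈ subs ] 𝟙 (isBipartiteHole? G q A B))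
      union G with hasBipartiteHole? q G
      ... | no _ = z≤n
      ... | yes (A , B , hole@(#A≡q , #B≡q , _)) = begin
        1
          ≡⟨ 𝟙-yes (isBipartiteHole? G q A B) hole ⟨
        𝟙 (isBipartiteHole? G q A B)
          ≤⟨ ∑-∈ (λ B → 𝟙 (isBipartiteHole? G q A B)) (∈-subsetsOfSize B q #B≡q) ⟩
        (∑[ B ∈ subs ] 𝟙 (isBipartiteHole? G q A B))
          ≤⟨ ∑-∈ (λ A → ∑[ B ∈ subs ] 𝟙 (isBipartiteHole? G q A B)) (∈-subsetsOfSize A q #A≡q) ⟩
        (∑[ A ∈ subs ] ∑[ B ∈ subs ] 𝟙 (isBipartiteHole? G q A B)) ∎

  -- Powers and factorials

  -- The tangent of x^(m+1) is taken at the right end `suc a`, so the increment is overestimated;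
  -- `bernoulli` takes it at the left end.
  bernoulli′ : ∀ a m → suc a ^ suc m ≤ a ^ suc m + suc m * suc a ^ m
  bernoulli′ a zero    = ≤-reflexive (base a)
    where
    base : ∀ a → (1 + a) * 1 ≡ a * 1 + 1 * 1
    base = solve-∀
  bernoulli′ a (suc m) = begin
    suc a * suc a ^ suc m
      ≤⟨ *-monoʳ-≤ (suc a) (bernoulli′ a m) ⟩
    suc a * (a ^ suc m + suc m * suc a ^ m)
      ≡⟨ expand a (a ^ suc m) m (suc a ^ m) ⟩
    a * a ^ suc m + (a ^ suc m + suc m * suc a ^ suc m)
      ≤⟨ +-monoʳ-≤ (a * a ^ suc m) (+-monoˡ-≤ _ (^-monoˡ-≤ (suc m) (n≤1+n a))) ⟩
    a * a ^ suc m + (2 + m) * suc a ^ suc m ∎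
    where
    open ≤-Reasoning
    expand : ∀ a p m r → (1 + a) * (p + (1 + m) * r) ≡ a * p + (p + (1 + m) * ((1 + a) * r))
    expand = solve-∀

  ^-*-dist : ∀ a b k → (a * b) ^ k ≡ a ^ k * b ^ k
  ^-*-dist a b zero    = refl
  ^-*-dist a b (suc k) = trans (cong (a * b *_) (^-*-dist a b k)) (regroup a b (a ^ k) (b ^ k))
    where
    regroup : ∀ a b p q → a * b * (p * q) ≡ a * p * (b * q)
    regroup = solve-∀

  -- The link between consecutive ratios: the two Bernoulli inequalities at a = K (K+2), where a + 1
  -- = (K+1)², compare powers of K and K+2 with powers of K+1.
  square-pred : ∀ K → suc (K * (2 + K)) ≡ suc K * suc K
  square-pred = solve-∀

  -- (1 + 1/K)^K is increasing in K ...
  [1+1/K]^K-step : ∀ K → suc K ^ suc K * suc K ^ K ≤ K ^ K * (2 + K) ^ suc K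
  [1+1/K]^K-step zero      = s≤s z≤n
  -- Multiplying by `K` and adding `N * P` turns the claim into `bernoulli′` at K (K+2), free of
  -- subtraction.
  [1+1/K]^K-step K@(suc _) = *-cancelˡ-≤ K (+-cancelˡ-≤ (N * P) _ _ (begin
    N * P + K * (N * N ^ K * N ^ K)
      ≡⟨ cong (λ z → N * P + K * z) (*-assoc N (N ^ K) (N ^ K)) ⟩
    N * P + K * (N * P)
      ≡⟨ collect K P ⟩
    suc (K * (2 + K)) * P
      ≡⟨ cong (suc (K * (2 + K)) *_) P≡ ⟩
    suc (K * (2 + K)) ^ suc K
      ≤⟨ bernoulli′ (K * (2 + K)) K ⟩
    (K * (2 + K)) ^ suc K + suc K * suc (K * (2 + K)) ^ K
      ≡⟨ cong₂ _+_ (^-*-dist K (2 + K) (suc K)) (cong (suc K *_) (sym P≡)) ⟩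
    K * K ^ K * (2 + K) ^ suc K + N * P
      ≡⟨ trans (+-comm _ (N * P)) (cong (N * P +_) (*-assoc K (K ^ K) ((2 + K) ^ suc K))) ⟩
    N * P + K * (K ^ K * (2 + K) ^ suc K) ∎))
    where
    open ≤-Reasoning
    N = suc K
    P = N ^ K * N ^ K
    P≡ : P ≡ suc (K * (2 + K)) ^ K
    P≡ = trans (sym (^-*-dist N N K)) (cong (_^ K) (sym (square-pred K)))
    collect : ∀ K P → (1 + K) * P + K * ((1 + K) * P) ≡ (1 + K * (2 + K)) * P
    collect = solve-∀

  -- ... and (1 + 1/K)^(K+1) is decreasing.
  [1+1/K]^[1+K]-step : ∀ K → (2 + K) ^ (2 + K) * K ^ suc K ≤ suc K ^ (2 + K) * suc K ^ suc K
  [1+1/K]^[1+K]-step K = begin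
    (2 + K) * (2 + K) ^ N * K ^ N
      ≡⟨ trans (*-assoc (2 + K) ((2 + K) ^ N) (K ^ N)) (cong ((2 + K) *_) (trans (*-comm ((2 + K) ^ N) (K ^ N)) (sym (^-*-dist K (2 + K) N)))) ⟩
    (2 + K) * (a * a ^ K)
      ≡⟨ split K (a * a ^ K) ⟩
    a * a ^ K + N * (a * a ^ K)
      ≤⟨ +-monoˡ-≤ _ (*-monoˡ-≤ (a ^ K) (≤-trans (n≤1+n a) (≤-reflexive (square-pred K)))) ⟩
    N * N * a ^ K + N * (a * a ^ K)
      ≡⟨ trans (cong (_+ N * (a * a ^ K)) (*-assoc N N (a ^ K))) (sym (*-distribˡ-+ N (N * a ^ K) _)) ⟩
    N * (N * a ^ K + a * a ^ K)
      ≤⟨ *-monoʳ-≤ N (bernoulli a K) ⟩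
    N * suc a ^ N
      ≡⟨ cong (N *_) (trans (cong (_^ N) (square-pred K)) (^-*-dist N N N)) ⟩
    N * (N ^ N * N ^ N)
      ≡⟨ *-assoc N (N ^ N) (N ^ N) ⟨
    N * N ^ N * N ^ N ∎
    where
    open ≤-Reasoning
    N = suc K
    a = K * (2 + K)
    split : ∀ K p → (2 + K) * p ≡ p + (1 + K) * p
    split = solve-∀

  -- With K = q + 1 this bounds (1 + 1/K)^(K+1), which decreases from its value 4 at K = 1.
  [1+1/K]^[1+K]≤4 : ∀ q → (2 + q) ^ (2 + q) ≤ 4 * suc q ^ (2 + q)
  [1+1/K]^[1+K]≤4 zero    = ≤-refl
  [1+1/K]^[1+K]≤4 (suc q) = *-cancelʳ-≤ _ _ (K ^ suc K) {{m^n≢0 K (suc K)}} (begin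
    (2 + K) ^ (2 + K) * K ^ suc K
      ≤⟨ [1+1/K]^[1+K]-step K ⟩
    suc K ^ (2 + K) * suc K ^ suc K
      ≤⟨ *-monoʳ-≤ (suc K ^ (2 + K)) ([1+1/K]^[1+K]≤4 q) ⟩
    suc K ^ (2 + K) * (4 * K ^ suc K)
      ≡⟨ regroup (suc K ^ (2 + K)) (K ^ suc K) ⟩
    4 * suc K ^ (2 + K) * K ^ suc K ∎)
    where
    open ≤-Reasoning
    K = suc q
    regroup : ∀ x y → x * (4 * y) ≡ 4 * x * y
    regroup = solve-∀

  -- Consecutive values of n^n / n! have ratio (1 + 1/n)^n, which is at most 4. The best base would
  -- be e; the excess is paid by the 8 in `8d≤ρ^k`.
  n^n≤n!*4^n : ∀ n → n ^ n ≤ n ! * 4 ^ n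
  n^n≤n!*4^n zero          = ≤-refl
  n^n≤n!*4^n (suc zero)    = s≤s z≤n
  n^n≤n!*4^n (suc (suc q)) = begin
    (2 + q) ^ (2 + q)
      ≤⟨ [1+1/K]^[1+K]≤4 q ⟩
    4 * (suc q * suc q ^ suc q)
      ≤⟨ *-monoʳ-≤ 4 (*-mono-≤ (n≤1+n (suc q)) (n^n≤n!*4^n (suc q))) ⟩
    4 * ((2 + q) * (suc q ! * 4 ^ suc q))
      ≡⟨ regroup (2 + q) (suc q !) (4 ^ suc q) ⟩
    (2 + q) * suc q ! * (4 * 4 ^ suc q) ∎
    where
    open ≤-Reasoning
    regroup : ∀ s f p → 4 * (s * (f * p)) ≡ s * f * (4 * p)
    regroup = solve-∀

  -- With K = i + m this is ρ ≤ (1 + 1/K)^K with denominators cleared: the monotonicity step,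
  -- iterated from m up to K.
  [1+1/K]^K-mono : ∀ m i → suc m ^ m * (i + m) ^ (i + m) ≤ m ^ m * suc (i + m) ^ (i + m)
  [1+1/K]^K-mono m zero    = ≤-reflexive (*-comm (suc m ^ m) (m ^ m))
  [1+1/K]^K-mono m (suc i) = *-cancelˡ-≤ (K ^ K) {{K^K≢0 K}} (begin
    K ^ K * (suc m ^ m * suc K ^ suc K)
      ≡⟨ regroup₁ (K ^ K) (suc m ^ m) (suc K ^ suc K) ⟩
    suc m ^ m * K ^ K * suc K ^ suc K
      ≤⟨ *-monoˡ-≤ (suc K ^ suc K) ([1+1/K]^K-mono m i) ⟩
    m ^ m * suc K ^ K * suc K ^ suc K
      ≡⟨ regroup₂ (m ^ m) (suc K ^ K) (suc K ^ suc K) ⟩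
    m ^ m * (suc K ^ suc K * suc K ^ K)
      ≤⟨ *-monoʳ-≤ (m ^ m) ([1+1/K]^K-step K) ⟩
    m ^ m * (K ^ K * (2 + K) ^ suc K)
      ≡⟨ regroup₃ (m ^ m) (K ^ K) ((2 + K) ^ suc K) ⟩
    K ^ K * (m ^ m * (2 + K) ^ suc K) ∎)
    where
    open ≤-Reasoning
    K = i + m
    K^K≢0 : ∀ K → NonZero (K ^ K)
    K^K≢0 zero    = _
    K^K≢0 (suc K) = m^n≢0 (suc K) (suc K)
    regroup₁ : ∀ x y z → x * (y * z) ≡ y * x * z
    regroup₁ = solve-∀
    regroup₂ : ∀ x y z → x * y * z ≡ x * (z * y)
    regroup₂ = solve-∀
    regroup₃ : ∀ x y z → x * (y * z) ≡ y * (x * z)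
    regroup₃ = solve-∀

  n!≤n^n : ∀ n → n ! ≤ n ^ n
  n!≤n^n zero    = ≤-refl
  n!≤n^n (suc n) = *-monoʳ-≤ (suc n) (≤-trans (n!≤n^n n) (^-monoˡ-≤ n (n≤1+n n)))

  -- With ρ = (1 + 1/m)^m < e, this is K! ≤ (m+1)^(m²) · (K/ρ)^K.
  factorial-bound : ∀ m .{{_ : NonZero m}} K →
    K ! * (suc m ^ m) ^ K ≤ (suc m ^ m) ^ m * (m ^ m) ^ K * K ^ K
  factorial-bound m K with ≤-total K m
  -- Up to `m` the sequence (1 + 1/K)^K may still lie below ρ. The prefactor `a ^ m` covers this
  -- range, where K! ≤ K^K is enough.
  ... | inj₁ K≤m = begin
    K ! * a ^ K
      ≤⟨ *-mono-≤ (n!≤n^n K) (^-monoʳ-≤ a {{m^n≢0 (suc m) m}} K≤m) ⟩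
    K ^ K * a ^ m
      ≡⟨ trans (*-comm (K ^ K) (a ^ m)) (cong (_* K ^ K) (sym (*-identityʳ (a ^ m)))) ⟩
    a ^ m * 1 * K ^ K
      ≤⟨ *-monoˡ-≤ (K ^ K) (*-monoʳ-≤ (a ^ m) (m^n>0 (m ^ m) {{m^n≢0 m m}} K)) ⟩
    a ^ m * (m ^ m) ^ K * K ^ K ∎
    where
    open ≤-Reasoning
    a = suc m ^ m
  ... | inj₂ m≤K = subst (λ K → K ! * a ^ K ≤ a ^ m * b ^ K * K ^ K) (m∸n+n≡m m≤K) (go (K ∸ m))
    where
    open ≤-Reasoning
    a = suc m ^ m
    b = m ^ m
    go : ∀ i → (i + m) ! * a ^ (i + m) ≤ a ^ m * b ^ (i + m) * (i + m) ^ (i + m)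
    go zero    = begin
      m ! * a ^ m           ≤⟨ *-monoˡ-≤ (a ^ m) (n!≤n^n m) ⟩
      m ^ m * a ^ m         ≡⟨ trans (*-comm (m ^ m) (a ^ m)) (cong (_* m ^ m) (sym (*-identityʳ (a ^ m)))) ⟩
      a ^ m * 1 * m ^ m     ≤⟨ *-monoˡ-≤ (m ^ m) (*-monoʳ-≤ (a ^ m) (m^n>0 b {{m^n≢0 m m}} m)) ⟩
      a ^ m * b ^ m * m ^ m ∎
    go (suc i) = begin
      suc M * M ! * (a * a ^ M)
        ≡⟨ regroup₁ (suc M) (M !) a (a ^ M) ⟩
      suc M * a * (M ! * a ^ M)
        ≤⟨ *-monoʳ-≤ (suc M * a) (go i) ⟩
      suc M * a * (a ^ m * b ^ M * M ^ M)
        ≡⟨ regroup₂ (suc M) a (a ^ m) (b ^ M) (M ^ M) ⟩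
      suc M * (a ^ m * b ^ M) * (a * M ^ M)
        -- Passing from M to M + 1 multiplies M^M / M! by (1 + 1/M)^M, which is at least ρ since M ≥
        -- m.
        ≤⟨ *-monoʳ-≤ (suc M * (a ^ m * b ^ M)) ([1+1/K]^K-mono m i) ⟩
      suc M * (a ^ m * b ^ M) * (b * suc M ^ M)
        ≡⟨ regroup₃ (suc M) (a ^ m) (b ^ M) b (suc M ^ M) ⟩
      a ^ m * (b * b ^ M) * (suc M * suc M ^ M) ∎
      where
      M = i + m
      regroup₁ : ∀ s f a p → s * f * (a * p) ≡ s * a * (f * p)
      regroup₁ = solve-∀
      regroup₂ : ∀ s a x y z → s * a * (x * y * z) ≡ s * (x * y) * (a * z)
      regroup₂ = solve-∀
      regroup₃ : ∀ s x y b z → s * (x * y) * (b * z) ≡ x * (b * y) * (s * z)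
      regroup₃ = solve-∀

  -- Numerical estimates for the union bound

  -- After division by `q` the slack is the 2 n d by which q d² ≥ 2 (k+1) n d exceeds the main term
  -- 2 k n d. One n d absorbs the terms in q, namely 8 k² q from 2 K² and 4 k d q from expanding the
  -- square, up to 4 d², by 16 k (k+1) ≤ d. The other absorbs that remainder and the blocked pairs,
  -- by 2 d² + 5 d ≤ n.
  K-condition : ∀ n d k q → 16 * (k * suc k) ≤ d → 2 * (d * d) + 5 * d ≤ n →
    2 * suc k * n ≤ q * d → q * d ≤ 2 * suc k * n + d →
    let K = 2 * k * q in
    K * (n * d) + 2 * (K * K) + (d * (K * d) + (q * d * (d * d) + q * d * d)) ≤ (q * d ∸ K) * (q * d ∸ K)
  K-condition n d k q k²≤d d²≤n n≤qd qd≤n = begin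
    2 * k * q * (n * d) + 2 * (2 * k * q * (2 * k * q)) + (d * (2 * k * q * d) + (q * d * (d * d) + q * d * d))
      ≡⟨ factor n d k q ⟩
    q * (2 * k * n * d + 8 * (k * k * q) + 2 * k * (d * d) + d * d * d + d * d)
      ≤⟨ *-monoʳ-≤ q (+-cancelʳ-≤ (4 * (k * d * q)) _ _ core) ⟩
    q * (q * (f * f))
      ≡⟨ square q f ⟩
    q * f * (q * f)
      ≡⟨ cong (λ z → z * z) qf≡ ⟩
    (q * d ∸ 2 * k * q) * (q * d ∸ 2 * k * q) ∎
    where
    open ≤-Reasoning
    f = d ∸ 2 * k
    2k≤d : 2 * k ≤ d
    2k≤d = ≤-trans (≤-trans (m≤m+n (2 * k) _) (≤-reflexive (widen k))) k²≤d
      where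
      widen : ∀ k → 2 * k + (14 * k + 16 * (k * k)) ≡ 16 * (k * suc k)
      widen = solve-∀
    f+2k≡d : f + 2 * k ≡ d
    f+2k≡d = m∸n+n≡m 2k≤d
    qf≡ : q * f ≡ q * d ∸ 2 * k * q
    qf≡ = trans (*-distribˡ-∸ q d (2 * k)) (cong (q * d ∸_) (*-comm q (2 * k)))
    factor : ∀ n d k q →
      2 * k * q * (n * d) + 2 * (2 * k * q * (2 * k * q)) + (d * (2 * k * q * d) + (q * d * (d * d) + q * d * d)) ≡
      q * (2 * k * n * d + 8 * (k * k * q) + 2 * k * (d * d) + d * d * d + d * d)
    factor = solve-∀
    square : ∀ q f → q * (q * (f * f)) ≡ q * f * (q * f)
    square = solve-∀
    q*d² : q * (d * d) ≤ q * (f * f) + 4 * (k * d * q)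
    q*d² = subst (λ d → q * (d * d) ≤ q * (f * f) + 4 * (k * d * q)) f+2k≡d
      (≤-trans (m≤m+n _ (4 * (k * k * q))) (≤-reflexive (expand q f k)))
      where
      expand : ∀ q f k → q * ((f + 2 * k) * (f + 2 * k)) + 4 * (k * k * q) ≡
        q * (f * f) + 4 * (k * (f + 2 * k) * q)
      expand = solve-∀
    8k²q≤ : 8 * (k * k * q) ≤ 4 * (k * d * q)
    8k²q≤ = ≤-trans (≤-reflexive (regroup k q)) (≤-trans (*-monoʳ-≤ (4 * (k * q)) 2k≤d) (≤-reflexive (regroup′ k q d)))
      where
      regroup : ∀ k q → 8 * (k * k * q) ≡ 4 * (k * q) * (2 * k)
      regroup = solve-∀
      regroup′ : ∀ k q d → 4 * (k * q) * d ≡ 4 * (k * d * q)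
      regroup′ = solve-∀
    8kdq≤ : 8 * k * (q * d) ≤ n * d + 4 * (d * d)
    8kdq≤ = begin
      8 * k * (q * d)                         ≤⟨ *-monoʳ-≤ (8 * k) qd≤n ⟩
      8 * k * (2 * suc k * n + d)             ≡⟨ regroup k n d ⟩
      n * (16 * (k * suc k)) + 4 * (2 * k * d) ≤⟨ +-mono-≤ (*-monoʳ-≤ n k²≤d) (*-monoʳ-≤ 4 (*-monoˡ-≤ d 2k≤d)) ⟩
      n * d + 4 * (d * d)                     ∎
      where
      regroup : ∀ k n d → 8 * k * (2 * suc k * n + d) ≡ n * (16 * (k * suc k)) + 4 * (2 * k * d)
      regroup = solve-∀
    core : 2 * k * n * d + 8 * (k * k * q) + 2 * k * (d * d) + d * d * d + d * d + 4 * (k * d * q) ≤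
      q * (f * f) + 4 * (k * d * q)
    core = begin
      2 * k * n * d + 8 * (k * k * q) + 2 * k * (d * d) + d * d * d + d * d + 4 * (k * d * q)
        ≤⟨ +-monoˡ-≤ (4 * (k * d * q)) (+-monoˡ-≤ (d * d) (+-monoˡ-≤ (d * d * d)
             (+-mono-≤ (+-monoʳ-≤ (2 * k * n * d) 8k²q≤) (*-monoˡ-≤ (d * d) 2k≤d)))) ⟩
      2 * k * n * d + 4 * (k * d * q) + d * (d * d) + d * d * d + d * d + 4 * (k * d * q)
        ≡⟨ regroup₁ n d k q ⟩
      2 * k * n * d + 8 * k * (q * d) + (2 * (d * d) * d + d * d)
        ≤⟨ +-monoˡ-≤ (2 * (d * d) * d + d * d) (+-monoʳ-≤ (2 * k * n * d) 8kdq≤) ⟩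
      2 * k * n * d + (n * d + 4 * (d * d)) + (2 * (d * d) * d + d * d)
        ≡⟨ regroup₂ n d k ⟩
      2 * k * n * d + n * d + (2 * (d * d) + 5 * d) * d
        ≤⟨ +-monoʳ-≤ (2 * k * n * d + n * d) (*-monoˡ-≤ d d²≤n) ⟩
      2 * k * n * d + n * d + n * d
        ≡⟨ regroup₃ n d k ⟩
      2 * suc k * n * d
        ≤⟨ *-monoˡ-≤ d n≤qd ⟩
      q * d * d
        ≡⟨ *-assoc q d d ⟩
      q * (d * d)
        ≤⟨ q*d² ⟩
      q * (f * f) + 4 * (k * d * q) ∎
      where
      regroup₁ : ∀ n d k q →
        2 * k * n * d + 4 * (k * d * q) + d * (d * d) + d * d * d + d * d + 4 * (k * d * q) ≡
        2 * k * n * d + 8 * k * (q * d) + (2 * (d * d) * d + d * d)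
      regroup₁ = solve-∀
      regroup₂ : ∀ n d k → 2 * k * n * d + (n * d + 4 * (d * d)) + (2 * (d * d) * d + d * d) ≡
        2 * k * n * d + n * d + (2 * (d * d) + 5 * d) * d
      regroup₂ = solve-∀
      regroup₃ : ∀ n d k → 2 * k * n * d + n * d + n * d ≡ 2 * suc k * n * d
      regroup₃ = solve-∀

  -- h is the number of graphs with a q-hole and N the number of all graphs.
  exponential-decay : ∀ m .{{_ : NonZero m}} n d .{{_ : NonZero d}} k q .{{_ : NonZero q}} {h N} →
    n ≤ q * d → 8 * d * (m ^ m) ^ k ≤ (suc m ^ m) ^ k →
    let K = 2 * k * q in
    h * K ^ K * (q ! * q !) ≤ n ^ q * n ^ q * (N * K !) →
    h * 4 ^ q ≤ N * (suc m ^ m) ^ m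
  exponential-decay m n d k q {h} {N} n≤qd d≤ρ^k h-bound =
    *-cancelʳ-≤ (h * 4 ^ q) (N * a ^ m) (16 ^ q * (X * X) * b ^ K)
      {{m*n≢0 (16 ^ q * (X * X)) (b ^ K) {{m*n≢0 (16 ^ q) (X * X) {{m^n≢0 16 q}} {{m*n≢0 X X}}}} {{m^n≢0 b K}}}}
      (*-cancelʳ-≤ _ _ (K ^ K) {{K^K≢0 K}} (begin
    h * 4 ^ q * (16 ^ q * (X * X) * b ^ K) * K ^ K
      ≡⟨ regroup₁ h (4 ^ q) (16 ^ q) X (b ^ K) (K ^ K) ⟩
    h * K ^ K * (4 ^ q * 16 ^ q * X * X * b ^ K)
      ≡⟨ cong (h * K ^ K *_) powers ⟩
    h * K ^ K * (q ^ q * q ^ q * (8 * d * b ^ k) ^ (2 * q))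
      -- Origin of the 8: with n ≤ q d and q^q ≤ 4^q q!, the number of pairs of sets is at most (4
      -- d)^(2 q), while ρ^(-K) ≤ (8 d)^(-2 q). The quotient is 4^(-q).
      ≤⟨ *-monoʳ-≤ (h * K ^ K) (*-mono-≤ (*-mono-≤ (n^n≤n!*4^n q) (n^n≤n!*4^n q)) (^-monoˡ-≤ (2 * q) d≤ρ^k)) ⟩
    h * K ^ K * (q ! * 4 ^ q * (q ! * 4 ^ q) * (a ^ k) ^ (2 * q))
      ≡⟨ cong (λ z → h * K ^ K * (q ! * 4 ^ q * (q ! * 4 ^ q) * z)) (tower a) ⟩
    h * K ^ K * (q ! * 4 ^ q * (q ! * 4 ^ q) * a ^ K)
      ≡⟨ regroup₂ h (K ^ K) (q !) (4 ^ q) (a ^ K) ⟩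
    h * K ^ K * (q ! * q !) * (4 ^ q * 4 ^ q * a ^ K)
      ≤⟨ *-monoˡ-≤ (4 ^ q * 4 ^ q * a ^ K) h-bound ⟩
    n ^ q * n ^ q * (N * K !) * (4 ^ q * 4 ^ q * a ^ K)
      ≤⟨ *-monoˡ-≤ (4 ^ q * 4 ^ q * a ^ K) (*-monoˡ-≤ (N * K !) (*-mono-≤ (^-monoˡ-≤ q n≤qd) (^-monoˡ-≤ q n≤qd))) ⟩
    X * X * (N * K !) * (4 ^ q * 4 ^ q * a ^ K)
      ≡⟨ regroup₃ X N (K !) (4 ^ q) (a ^ K) ⟩
    X * X * (4 ^ q * 4 ^ q) * N * (K ! * a ^ K)
      ≤⟨ *-monoʳ-≤ (X * X * (4 ^ q * 4 ^ q) * N) (factorial-bound m K) ⟩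
    X * X * (4 ^ q * 4 ^ q) * N * (a ^ m * b ^ K * K ^ K)
      ≡⟨ cong (λ z → X * X * z * N * (a ^ m * b ^ K * K ^ K)) (^-*-dist 4 4 q) ⟨
    X * X * 16 ^ q * N * (a ^ m * b ^ K * K ^ K)
      ≡⟨ regroup₄ X (16 ^ q) N (a ^ m) (b ^ K) (K ^ K) ⟩
    N * a ^ m * (16 ^ q * (X * X) * b ^ K) * K ^ K ∎))
    where
    open ≤-Reasoning
    K = 2 * k * q
    a = suc m ^ m
    b = m ^ m
    X = (q * d) ^ q
    instance
      b≢0 : NonZero b
      b≢0 = m^n≢0 m m
      X≢0 : NonZero X
      X≢0 = m^n≢0 (q * d) q {{m*n≢0 q d}}
    K^K≢0 : ∀ K → NonZero (K ^ K)
    K^K≢0 zero    = _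
    K^K≢0 (suc K) = m^n≢0 (suc K) (suc K)
    tower : ∀ c → (c ^ k) ^ (2 * q) ≡ c ^ K
    tower c = trans (^-*-assoc c k (2 * q)) (cong (c ^_) (swap k q))
      where
      swap : ∀ k q → k * (2 * q) ≡ 2 * k * q
      swap = solve-∀
    square : ∀ c → c ^ (2 * q) ≡ c ^ q * c ^ q
    square c = trans (cong (c ^_) (cong (q +_) (+-identityʳ q))) (^-distribˡ-+-* c q q)
    powers : 4 ^ q * 16 ^ q * X * X * b ^ K ≡ q ^ q * q ^ q * (8 * d * b ^ k) ^ (2 * q)
    powers = begin-equality
      4 ^ q * 16 ^ q * X * X * b ^ K
        ≡⟨ cong (λ z → z * X * X * b ^ K) (trans (sym (^-*-dist 4 16 q)) (^-*-dist 8 8 q)) ⟩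
      8 ^ q * 8 ^ q * X * X * b ^ K
        ≡⟨ cong (λ z → 8 ^ q * 8 ^ q * z * z * b ^ K) (^-*-dist q d q) ⟩
      8 ^ q * 8 ^ q * (q ^ q * d ^ q) * (q ^ q * d ^ q) * b ^ K
        ≡⟨ regroup (8 ^ q) (q ^ q) (d ^ q) (b ^ K) ⟩
      q ^ q * q ^ q * (8 ^ q * d ^ q * (8 ^ q * d ^ q) * b ^ K)
        ≡⟨ cong (λ z → q ^ q * q ^ q * (z * z * b ^ K)) (sym (^-*-dist 8 d q)) ⟩
      q ^ q * q ^ q * ((8 * d) ^ q * (8 * d) ^ q * b ^ K)
        ≡⟨ cong (λ z → q ^ q * q ^ q * z) (cong₂ _*_ (sym (square (8 * d))) (sym (tower b))) ⟩
      q ^ q * q ^ q * ((8 * d) ^ (2 * q) * (b ^ k) ^ (2 * q))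
        ≡⟨ cong (λ z → q ^ q * q ^ q * z) (^-*-dist (8 * d) (b ^ k) (2 * q)) ⟨
      q ^ q * q ^ q * (8 * d * b ^ k) ^ (2 * q) ∎
      where
      regroup : ∀ e q d b → e * e * (q * d) * (q * d) * b ≡ q * q * (e * d * (e * d) * b)
      regroup = solve-∀
    regroup₁ : ∀ h f s X b K → h * f * (s * (X * X) * b) * K ≡ h * K * (f * s * X * X * b)
    regroup₁ = solve-∀
    regroup₂ : ∀ h K q f a → h * K * (q * f * (q * f) * a) ≡ h * K * (q * q) * (f * f * a)
    regroup₂ = solve-∀
    regroup₃ : ∀ X N K f a → X * X * (N * K) * (f * f * a) ≡ X * X * (f * f) * N * (K * a)
    regroup₃ = solve-∀
    regroup₄ : ∀ X s N a b K → X * X * s * N * (a * b * K) ≡ N * a * (s * (X * X) * b) * K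
    regroup₄ = solve-∀

  n<2^n : ∀ n → n < 2 ^ n
  n<2^n zero    = s≤s z≤n
  n<2^n (suc n) = ≤-trans (≤-reflexive (+-comm 1 (suc n)))
    (+-mono-≤ (n<2^n n) (≤-trans (m^n>0 2 n) (m≤m+n (2 ^ n) 0)))

  2*m^m≤[1+m]^m : ∀ m .{{_ : NonZero m}} → 2 * m ^ m ≤ suc m ^ m
  2*m^m≤[1+m]^m (suc m) = ≤-trans (≤-reflexive (cong (suc m ^ suc m +_) (+-identityʳ _))) (bernoulli (suc m) m)

  -- A discrete intermediate value principle, found by scanning down from the upper end.
  crossover : {P : ℕ → Set} → (∀ i → Dec (P i)) → ∀ {lo} j → P lo → ¬ P (j + lo) →
    ∃[ s ] lo ≤ s × P s × ¬ P (suc s)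
  crossover P? zero    Plo ¬P = contradiction Plo ¬P
  crossover P? {lo} (suc j) Plo ¬P with P? (j + lo)
  ... | yes P = j + lo , m≤n+m lo j , P , ¬P
  ... | no ¬P′ = crossover P? j Plo ¬P′

  -- In terms of s = 14 + i this is 16 (s+4)(s+5) ≤ 2^s. A step of i doubles the right side and
  -- multiplies the left by (20+i)/(18+i) only.
  quadratic≤2^ : ∀ i → 16 * ((18 + i) * (19 + i)) ≤ 2 ^ (14 + i)
  quadratic≤2^ zero    = ≤ᵇ⇒≤ _ _ _
  quadratic≤2^ (suc i) = begin
    16 * ((19 + i) * (20 + i))          ≤⟨ *-monoʳ-≤ 16 (*-monoʳ-≤ (19 + i) (m≤m+n (20 + i) (16 + i))) ⟩
    16 * ((19 + i) * (20 + i + (16 + i))) ≡⟨ regroup i ⟩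
    2 * (16 * ((18 + i) * (19 + i)))    ≤⟨ *-monoʳ-≤ 2 (quadratic≤2^ i) ⟩
    2 * 2 ^ (14 + i)                    ∎
    where
    open ≤-Reasoning
    regroup : ∀ i → 16 * ((19 + i) * (20 + i + (16 + i))) ≡ 2 * (16 * ((18 + i) * (19 + i)))
    regroup = solve-∀

  -- s = ⌊log d / log ρ⌋ for ρ = (1 + 1/m)^m.
  record Scale (m lo d : ℕ) : Set where
    field
      s        : ℕ
      lo≤s     : lo ≤ s
      ρ^s≤d    : suc m ^ (m * s) ≤ d * m ^ (m * s)
      8d≤ρ^k   : 8 * d * (m ^ m) ^ (4 + s) ≤ (suc m ^ m) ^ (4 + s)
      16k²≤d   : 16 * ((4 + s) * (5 + s)) ≤ d

  -- By Bernoulli ρ ≥ 2. Hence ρ^s exceeds `d` at s = d + lo, whereas at s = lo it does not, and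
  -- `crossover` yields the place where it passes `d`. The bound 14 ≤ lo serves `quadratic≤2^`,
  -- since 2^s ≤ ρ^s ≤ d.
  scale : ∀ m .{{_ : NonZero m}} {lo d} → 14 ≤ lo → (suc m ^ m) ^ lo ≤ d → Scale m lo d
  scale m {lo} {d} 14≤lo d-large = result (crossover P? d P-lo ¬P-large)
    where
    open ≤-Reasoning
    a = suc m ^ m
    b = m ^ m
    instance
      b≢0 : NonZero b
      b≢0 = m^n≢0 m m
    P : ℕ → Set
    P s = a ^ s ≤ d * b ^ s
    P? : ∀ s → Dec (P s)
    P? s = a ^ s ≤? d * b ^ s
    P-lo : P lo
    P-lo = ≤-trans d-large (m≤m*n d (b ^ lo) {{m^n≢0 b lo}})
    2^b^≤a^ : ∀ s → 2 ^ s * b ^ s ≤ a ^ s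
    2^b^≤a^ s = ≤-trans (≤-reflexive (sym (^-*-dist 2 b s))) (^-monoˡ-≤ s (2*m^m≤[1+m]^m m))
    ¬P-large : ¬ P (d + lo)
    ¬P-large = <⇒≱ (≤-trans
      (*-monoˡ-< (b ^ (d + lo)) {{m^n≢0 b (d + lo)}} (≤-trans (n<2^n d) (^-monoʳ-≤ 2 (m≤m+n d lo))))
      (2^b^≤a^ (d + lo)))
    result : (∃[ s ] lo ≤ s × P s × ¬ P (suc s)) → Scale m lo d
    result (s , lo≤s , Ps , ¬Ps) = record
      { s      = s
      ; lo≤s   = lo≤s
      ; ρ^s≤d  = subst₂ (λ x y → x ≤ d * y) (^-*-assoc (suc m) m s) (^-*-assoc m m s) Ps
      -- One of the four extra factors ρ takes ρ^s past `d`; the other three, each at least 2,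
      -- supply the 8.
      ; 8d≤ρ^k = begin
          8 * d * (b * (b * (b * b ^ suc s)))
            ≡⟨ regroup d b (b ^ suc s) ⟩
          2 * b * (2 * b * (2 * b * (d * b ^ suc s)))
            ≤⟨ *-mono-≤ 2b≤a (*-mono-≤ 2b≤a (*-mono-≤ 2b≤a (<⇒≤ (≰⇒> ¬Ps)))) ⟩
          a * (a * (a * a ^ suc s)) ∎
      ; 16k²≤d = ≤-trans
          (subst (λ s → 16 * ((4 + s) * (5 + s)) ≤ 2 ^ s) (m+[n∸m]≡n (≤-trans 14≤lo lo≤s)) (quadratic≤2^ (s ∸ 14)))
          (*-cancelʳ-≤ (2 ^ s) d (b ^ s) {{m^n≢0 b s}} (≤-trans (2^b^≤a^ s) Ps))
      }
      where
      2b≤a = 2*m^m≤[1+m]^m m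
      regroup : ∀ d b p → 8 * d * (b * (b * (b * p))) ≡ 2 * b * (2 * b * (2 * b * (d * p)))
      regroup = solve-∀

  -- Zero forcing

  subset-of-size : ∀ {n} (S : Subset n) r → r ≤ # S → ∃[ T ] T ⊆ S × # T ≡ r
  subset-of-size []          zero    _         = [] , id , refl
  subset-of-size (false ∷ S) r       r≤        with T , T⊆S , #T≡r ← subset-of-size S r r≤ =
    outside ∷ T , s⊆s T⊆S , #T≡r
  subset-of-size (true ∷ S)  zero    _         with T , T⊆S , #T≡0 ← subset-of-size S zero z≤n =
    outside ∷ T , out⊆ T⊆S , #T≡0
  subset-of-size (true ∷ S)  (suc r) (s≤s r≤) with T , T⊆S , #T≡r ← subset-of-size S r r≤ =
    inside ∷ T , s⊆s T⊆S , cong suc #T≡r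

  #-insert : ∀ {n} (S : Subset n) v → v ∉ S → # (S ∪ ⁅ v ⁆) ≡ suc (# S)
  #-insert (true ∷ S)  zero    v∉ = contradiction here v∉
  #-insert (false ∷ S) zero    v∉ = cong (suc ∘ #_) (∪-identityʳ S)
  #-insert (true ∷ S)  (suc v) v∉ = cong suc (#-insert S v (v∉ ∘ there))
  #-insert (false ∷ S) (suc v) v∉ = #-insert S v (v∉ ∘ there)

  least : {P : ℕ → Set} → (∀ i → Dec (P i)) → ∀ i → P i → ∃[ m ] P m × (∀ j → P j → m ≤ j)
  least {P} P? i Pi = search i 0 (subst P (sym (+-identityʳ i)) Pi) (λ _ ())
    where
    search : ∀ i lo → P (i + lo) → (∀ j → j < lo → ¬ P j) → ∃[ m ] P m × (∀ j → P j → m ≤ j)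
    search i lo Pi+lo below with P? lo
    ... | yes Plo = lo , Plo , λ j Pj → ≮⇒≥ λ j<lo → below j j<lo Pj
    search zero    lo Plo   below | no ¬Plo = contradiction Plo ¬Plo
    search (suc i) lo Pi+lo below | no ¬Plo = search i (suc lo) (subst P (sym (+-suc i lo)) Pi+lo) below′
      where
      below′ : ∀ j → j < suc lo → ¬ P j
      below′ j (s≤s j≤lo) Pj with m≤n⇒m<n∨m≡n j≤lo
      ... | inj₁ j<lo = below j j<lo Pj
      ... | inj₂ refl = ¬Plo Pj

  module _ {n : ℕ} (G : Adjacency n) where

    -- Reduces all sizes above the threshold to a single one, so that the union bound is applied
    -- once for each n.
    shrink-hole : ∀ {q r} → r ≤ q → HasBipartiteHole G q → HasBipartiteHole G r
    shrink-hole r≤q (A , B , refl , #B≡q , A∩B , hole)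
      with A′ , A′⊆A , #A′ ← subset-of-size A _ r≤q
         | B′ , B′⊆B , #B′ ← subset-of-size B _ (≤-trans r≤q (≤-reflexive (sym #B≡q))) =
      A′ , B′ , #A′ , #B′ ,
      (λ (v , v∈) → let v∈A′ , v∈B′ = x∈p∩q⁻ A′ B′ v∈ in A∩B (v , x∈p∩q⁺ (A′⊆A v∈A′ , B′⊆B v∈B′))) ,
      λ u v u∈ v∈ → hole u v (A′⊆A u∈) (B′⊆B v∈)

    -- U is a set of vertices that have already forced, so all their neighbours are black (in T).
    forcers-hole : ∀ {q} r (T U : Subset n) → IsZeroForcingSet G T → U ⊆ T →
      (∀ u v → u ∈ U → v ∈ nbrs G u → v ∈ T) → # U + r ≡ q → # T + r + q ≤ n → HasBipartiteHole G q
    forcers-hole {q} zero T U _ U⊆T closed #U≡q #T+q≤n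
      with B , B⊆∁T , #B ← subset-of-size (∁ T) q
        (≤-trans (≤-trans (≤-reflexive (sym (m+n∸m≡n (# T) q)))
          (∸-monoˡ-≤ (# T) (subst (λ t → t + q ≤ n) (+-identityʳ (# T)) #T+q≤n)))
          (≤-reflexive (sym (∣∁p∣≡n∸∣p∣ T)))) =
      U , B , trans (sym (+-identityʳ (# U))) #U≡q , #B ,
      (λ (v , v∈) → let v∈U , v∈B = x∈p∩q⁻ U B v∈ in x∈∁p⇒x∉p (B⊆∁T v∈B) (U⊆T v∈U)) ,
      λ u v u∈U v∈B v∈Nu → x∈∁p⇒x∉p (B⊆∁T v∈B) (closed u v u∈U v∈Nu)
    -- Forcing cannot have ended while steps are still owed: the size invariant leaves more than q
    -- white vertices.
    forcers-hole {q} (suc r) T U ε _ _ _ #T≤n = contradiction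
      (≤-trans (≤-trans (m≤m+n (n + suc r) q) (≤-reflexive (cong (λ t → t + suc r + q) (sym (∣⊤∣≡n n))))) #T≤n)
      (m+1+n≰m n)
    forcers-hole {q} (suc r) T U (force u v u∈T v∈Nu v∉T only ◅ rest) U⊆T closed #U+r≡q #T≤n =
      forcers-hole r (T ∪ ⁅ v ⁆) (U ∪ ⁅ u ⁆) rest subset closed′
        (trans (cong (_+ r) (#-insert U u u∉U)) (trans (sym (+-suc (# U) r)) #U+r≡q))
        (subst (λ t → t + q ≤ n) (trans (+-suc (# T) r) (cong (_+ r) (sym (#-insert T v v∉T)))) #T≤n)
      where
      -- A vertex that has forced before has no white neighbour left, so every forcer is new and `U`
      -- grows at each step.
      u∉U : u ∉ U
      u∉U u∈U = v∉T (closed u v u∈U v∈Nu)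
      subset : U ∪ ⁅ u ⁆ ⊆ T ∪ ⁅ v ⁆
      subset w∈ with x∈p∪q⁻ U ⁅ u ⁆ w∈
      ... | inj₁ w∈U = p⊆p∪q ⁅ v ⁆ (U⊆T w∈U)
      ... | inj₂ w∈u with refl ← x∈⁅y⁆⇒x≡y u w∈u = p⊆p∪q ⁅ v ⁆ u∈T
      closed′ : ∀ x w → x ∈ U ∪ ⁅ u ⁆ → w ∈ nbrs G x → w ∈ T ∪ ⁅ v ⁆
      closed′ x w x∈ w∈Nx with x∈p∪q⁻ U ⁅ u ⁆ x∈
      ... | inj₁ x∈U = p⊆p∪q ⁅ v ⁆ (closed x w x∈U w∈Nx)
      ... | inj₂ x∈u with refl ← x∈⁅y⁆⇒x≡y u x∈u with w ∈? T
      ...   | yes w∈T = p⊆p∪q ⁅ v ⁆ w∈T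
      ...   | no w∉T with refl ← only w w∈Nx w∉T = q⊆p∪q T ⁅ v ⁆ (x∈⁅x⁆ w)

    zeroForcing⇒hole : ∀ {q} S → IsZeroForcingSet G S → # S + 2 * q ≤ n → HasBipartiteHole G q
    zeroForcing⇒hole {q} S zfs #S≤n = forcers-hole q S ⊥ zfs (λ u∈⊥ → contradiction u∈⊥ ∉⊥)
      (λ u v u∈⊥ _ → contradiction u∈⊥ ∉⊥) (cong (_+ q) (∣⊥∣≡0 n))
      (≤-trans (≤-reflexive (trans (+-assoc (# S) q q) (cong (λ z → # S + (q + z)) (sym (+-identityʳ q))))) #S≤n)

    -- The event about Z(G) asserts that the number exists, so the minimum must be found by search.
    -- Each forcing step blackens a new vertex, so fuel `n` exhausts every forcing sequence.
    isZeroForcingSet? : ∀ S → Dec (IsZeroForcingSet G S)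
    isZeroForcingSet? S = decide n S (m≤n+m n (# S))
      where
      ForcesAndContinues : Subset n → Fin n → Fin n → Set
      ForcesAndContinues S u v = (u ∈ S × v ∈ nbrs G u × v ∉ S × (∀ w → w ∈ nbrs G u → w ∉ S → w ≡ v)) ×
        IsZeroForcingSet G (S ∪ ⁅ v ⁆)

      forces? : ∀ S u v → Dec (u ∈ S × v ∈ nbrs G u × v ∉ S × (∀ w → w ∈ nbrs G u → w ∉ S → w ≡ v))
      forces? S u v = (u ∈? S) ×-dec (v ∈? nbrs G u) ×-dec ¬? (v ∈? S) ×-dec
        (Fin.all? λ w → (w ∈? nbrs G u) →-dec ¬? (w ∈? S) →-dec (w Fin.≟ v))

      decide : ∀ fuel S → n ≤ # S + fuel → Dec (IsZeroForcingSet G S)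
      decide zero S n≤#S with refl ← ∣p∣≡n⇒p≡⊤ {p = S} (≤-antisym (∣p∣≤n S) (subst (n ≤_) (+-identityʳ (# S)) n≤#S)) =
        yes ε
      decide (suc fuel) S n≤ with # S ≟ n
      ... | yes #S≡n with refl ← ∣p∣≡n⇒p≡⊤ {p = S} #S≡n = yes ε
      ... | no #S≢n = map′ to from (Fin.any? λ u → Fin.any? λ v → step? u v)
        where
        step? : ∀ u v → Dec (ForcesAndContinues S u v)
        step? u v with forces? S u v
        ... | no ¬f = no (¬f ∘ proj₁)
        ... | yes f@(_ , _ , v∉S , _) = map′ (f ,_) proj₂ (decide fuel (S ∪ ⁅ v ⁆)
                (subst (n ≤_) (trans (+-suc (# S) fuel) (cong (_+ fuel) (sym (#-insert S v v∉S)))) n≤))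
        to : (∃[ u ] ∃[ v ] ForcesAndContinues S u v) → IsZeroForcingSet G S
        to (u , v , (u∈ , v∈ , v∉ , only) , rest) = force u v u∈ v∈ v∉ only ◅ rest
        from : IsZeroForcingSet G S → ∃[ u ] ∃[ v ] ForcesAndContinues S u v
        from ε = contradiction (∣⊤∣≡n n) #S≢n
        from (force u v u∈ v∈ v∉ only ◅ rest) = u , v , (u∈ , v∈ , v∉ , only) , rest

    zeroForcingNumber : ∃[ z ] IsZeroForcingNumber G z
    zeroForcingNumber
      with z , P , minimal ← least (λ z → anySubset? λ S → isZeroForcingSet? S ×-dec (# S ≟ z)) n (⊤ , ε , ∣⊤∣≡n n) =
      z , P , λ S zfs → minimal (# S) (S , zfs , refl)

    holeless⇒zeroForcingNumber : ∀ {q z} → ¬ HasBipartiteHole G q → IsZeroForcingNumber G z → n ≤ z + 2 * q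
    holeless⇒zeroForcingNumber ¬hole ((S , zfs , refl) , _) = <⇒≤ (≰⇒> (¬hole ∘ zeroForcing⇒hole S zfs))

  -- The least q with q d > 2 (k + 1) n.
  holeSize : (d : ℕ) .{{_ : NonZero d}} (k n : ℕ) → ℕ
  holeSize d k n = suc (2 * suc k * n / d)

  module _ (d k n : ℕ) .{{_ : NonZero d}} where

    private
      r = 2 * suc k * n % d
      division : 2 * suc k * n ≡ r + 2 * suc k * n / d * d
      division = m≡m%n+[m/n]*n (2 * suc k * n) d

    holeSize-lower : 2 * suc k * n ≤ holeSize d k n * d
    holeSize-lower = ≤-trans (≤-reflexive division)
      (+-monoˡ-≤ (2 * suc k * n / d * d) (<⇒≤ (m%n<n (2 * suc k * n) d)))

    holeSize-upper : holeSize d k n * d ≤ 2 * suc k * n + d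
    holeSize-upper = ≤-trans (≤-reflexive (+-comm d (2 * suc k * n / d * d)))
      (+-monoˡ-≤ d (≤-trans (m≤n+m _ r) (≤-reflexive (sym division))))

    n≤holeSize*d : n ≤ holeSize d k n * d
    n≤holeSize*d = ≤-trans (m≤m+n n _) holeSize-lower

  -- Rarity of holes and the thresholds in natural numbers

  module _ {m lo d : ℕ} .{{_ : NonZero m}} .{{_ : NonZero d}} (sc : Scale m lo d) where

    open Scale sc

    level : ℕ
    level = 4 + s

    holes-rare : ∀ D → ∃[ N ] ∀ n → N ≤ n →
      length (filter (hasBipartiteHole? (holeSize d level n)) (regularGraphs d n)) * D ≤ length (regularGraphs d n)
    -- The first two summands are the requirement of `K-condition`. The last gives D C ≤ q, hence D
    -- C ≤ 4^q, where `C` is the constant prefactor left over from `factorial-bound`.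
    holes-rare D = 2 * (d * d) + 5 * d + D * C * d , bound
      where
      open ≤-Reasoning
      C = (suc m ^ m) ^ m
      bound : ∀ n → 2 * (d * d) + 5 * d + D * C * d ≤ n →
        length (filter (hasBipartiteHole? (holeSize d level n)) (regularGraphs d n)) * D ≤ length (regularGraphs d n)
      bound n n-large = *-cancelʳ-≤ _ _ C {{m^n≢0 (suc m ^ m) m {{m^n≢0 (suc m) m}}}} (begin
        h * D * C
          ≡⟨ *-assoc h D C ⟩
        h * (D * C)
          ≤⟨ *-monoʳ-≤ h (≤-trans DC≤q (≤-trans (<⇒≤ (n<2^n q)) (^-monoˡ-≤ q (s≤s (s≤s z≤n))))) ⟩
        h * 4 ^ q
          ≤⟨ exponential-decay m n d level q {h} {N} (n≤holeSize*d d level n) 8d≤ρ^k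
               (holes-count {n} d q K {{>-nonZero (≤-trans (s≤s z≤n) (m≤n+m (2 * (K * K)) (K * (n * d))))}}
                 (K-condition n d level q 16k²≤d (≤-trans (m≤m+n _ (D * C * d)) n-large)
                   (holeSize-lower d level n) (holeSize-upper d level n))) ⟩
        N * C ∎)
        where
        q = holeSize d level n
        K = 2 * level * q
        N = length (regularGraphs d n)
        h = length (filter (hasBipartiteHole? q) (regularGraphs d n))
        DC≤q : D * C ≤ q
        DC≤q = *-cancelʳ-≤ (D * C) q d (≤-trans (m≤n+m _ (2 * (d * d) + 5 * d)) (≤-trans n-large (n≤holeSize*d d level n)))

    -- Rounding costs at most `d`, and d + 1 ≤ n ≤ 2 n, whence `2 + level` in place of `suc level`.
    -- The extra 1 admits a real inequality known only up to an error 1/d.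
    holeSize-≤ : ∀ {n q} → d < n → 2 * n * (2 + level) ≤ q * d + 1 → holeSize d level n ≤ q
    holeSize-≤ {n} {q} d<n n≤qd = *-cancelʳ-≤ (holeSize d level n) q d (+-cancelʳ-≤ 1 _ _ (begin
      holeSize d level n * d + 1    ≤⟨ +-monoˡ-≤ 1 (holeSize-upper d level n) ⟩
      2 * suc level * n + d + 1     ≡⟨ trans (+-assoc (2 * suc level * n) d 1) (cong (2 * suc level * n +_) (+-comm d 1)) ⟩
      2 * suc level * n + suc d     ≤⟨ +-monoʳ-≤ (2 * suc level * n) (≤-trans d<n (m≤m+n n (n + 0))) ⟩
      2 * suc level * n + 2 * n     ≡⟨ regroup level n ⟩
      2 * n * (2 + level)           ≤⟨ n≤qd ⟩
      q * d + 1                     ∎))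
      where
      open ≤-Reasoning
      regroup : ∀ k n → 2 * suc k * n + 2 * n ≡ 2 * n * (2 + k)
      regroup = solve-∀

    zeroForcing-lower : ∀ {n z} → d < n → n ≤ z + 2 * holeSize d level n → n * d ≤ z * d + 4 * n * (2 + level)
    zeroForcing-lower {n} {z} d<n n≤z+2q = begin
      n * d                                     ≤⟨ *-monoˡ-≤ d n≤z+2q ⟩
      (z + 2 * q) * d                           ≡⟨ regroup₁ z q d ⟩
      z * d + 2 * (q * d)                       ≤⟨ +-monoʳ-≤ (z * d) (*-monoʳ-≤ 2 (≤-trans (holeSize-upper d level n)
                                                     (+-monoʳ-≤ (2 * suc level * n) (≤-trans (<⇒≤ d<n) (m≤m+n n n))))) ⟩
      z * d + 2 * (2 * suc level * n + (n + n)) ≡⟨ regroup₂ z d level n ⟩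
      z * d + 4 * n * (2 + level)               ∎
      where
      open ≤-Reasoning
      q = holeSize d level n
      regroup₁ : ∀ z q d → (z + 2 * q) * d ≡ z * d + 2 * (q * d)
      regroup₁ = solve-∀
      regroup₂ : ∀ z d k n → z * d + 2 * (2 * suc k * n + (n + n)) ≡ z * d + 4 * n * (2 + k)
      regroup₂ = solve-∀

  -- (1 + 1/E) · s · (m/(m+1))² ≥ s + 6 for m = 8E, cleared of denominators.
  slack : ∀ E s → 14 * E ≤ s → let m = 8 * E in
    (6 + s) * (E * (suc m * suc m)) ≤ suc E * (m * s * (1 * m))
  slack zero      s _     = ≤-reflexive (*-zeroʳ (6 + s))
  slack E@(suc e) s 14E≤s = begin
    (6 + s) * (E * (suc m * suc m))
      ≡⟨ expand E s ⟩
    64 * (E * E * E) * s + 16 * (E * E) * s + E * s + (384 * (E * E * E) + 96 * (E * E) + 6 * E)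
      -- The right side is 64 E³ s + 64 E² s. Of the 48 E² s not matched on the left, one E² s pays
      -- for E s and 47 E² s for the terms free of s, because s ≥ 14 E and 47 · 14 = 384 + 96 + 6 +
      -- 172.
      ≤⟨ +-mono-≤ (+-monoʳ-≤ (64 * (E * E * E) * s + 16 * (E * E) * s) E*s≤) tail≤ ⟩
    64 * (E * E * E) * s + 16 * (E * E) * s + E * E * s + 47 * (E * E) * s
      ≡⟨ collect E s ⟩
    suc E * (m * s * (1 * m)) ∎
    where
    open ≤-Reasoning
    m = 8 * E
    E≤E*E : E ≤ E * E
    E≤E*E = m≤m*n E E
    E*s≤ : E * s ≤ E * E * s
    E*s≤ = *-monoˡ-≤ s E≤E*E
    tail≤ : 384 * (E * E * E) + 96 * (E * E) + 6 * E ≤ 47 * (E * E) * s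
    tail≤ = begin
      384 * (E * E * E) + 96 * (E * E) + 6 * E
        ≤⟨ +-mono-≤ (+-monoʳ-≤ (384 * (E * E * E)) (*-monoʳ-≤ 96 (m≤m*n (E * E) E)))
             (*-monoʳ-≤ 6 (≤-trans E≤E*E (m≤m*n (E * E) E))) ⟩
      384 * (E * E * E) + 96 * (E * E * E) + 6 * (E * E * E)
        ≤⟨ m≤m+n _ (172 * (E * E * E)) ⟩
      384 * (E * E * E) + 96 * (E * E * E) + 6 * (E * E * E) + 172 * (E * E * E)
        ≡⟨ regroup E ⟩
      47 * (E * E) * (14 * E)
        ≤⟨ *-monoʳ-≤ (47 * (E * E)) 14E≤s ⟩
      47 * (E * E) * s ∎
      where
      regroup : ∀ E → 384 * (E * E * E) + 96 * (E * E * E) + 6 * (E * E * E) + 172 * (E * E * E) ≡ 47 * (E * E) * (14 * E)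
      regroup = solve-∀
    expand : ∀ E s → (6 + s) * (E * (suc (8 * E) * suc (8 * E))) ≡
      64 * (E * E * E) * s + 16 * (E * E) * s + E * s + (384 * (E * E * E) + 96 * (E * E) + 6 * E)
    expand = solve-∀
    collect : ∀ E s → 64 * (E * E * E) * s + 16 * (E * E) * s + E * E * s + 47 * (E * E) * s ≡
      suc E * (8 * E * s * (1 * (8 * E)))
    collect = solve-∀

  length-filter-¬ : ∀ {A : Set} {P : A → Set} (P? : Decidable P) xs →
    length xs ≡ length (filter (λ x → ¬? (P? x)) xs) + length (filter P? xs)
  length-filter-¬ P? xs = sym (begin
    length (filter (λ x → ¬? (P? x)) xs) + length (filter P? xs)
      ≡⟨ cong₂ _+_ (length-filter (λ x → ¬? (P? x)) xs) (length-filter P? xs) ⟩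
    ∑ xs (λ x → 𝟙 (¬? (P? x))) + ∑ xs (λ x → 𝟙 (P? x))
      ≡⟨ ∑-+ xs _ _ ⟨
    ∑ xs (λ x → 𝟙 (¬? (P? x)) + 𝟙 (P? x))
      ≡⟨ ∑-cong xs (λ x → one (P? x)) ⟩
    ∑ xs (λ _ → 1)
      ≡⟨ trans (∑-const xs 1) (*-identityʳ _) ⟩
    length xs ∎)
    where
    open ≡-Reasoning
    one : {Q : Set} (q : Dec Q) → 𝟙 (¬? q) + 𝟙 q ≡ 1
    one (yes _) = refl
    one (no _)  = refl

-- Rational lower bounds for partial sums of the Mercator series

module Mercator where

  open import Defs using (logSum; logTerm)
  open import Data.Integer.Base as ℤ using (+_)
  import Data.Integer.Properties as ℤ
  open import Data.Nat.Base as ℕ using (ℕ; zero; suc)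
  import Data.Nat.Properties as ℕ
  open import Data.Nat.Tactic.RingSolver using (solve-∀)
  open import Data.Rational.Base
  open import Data.Rational.Properties
  open import Data.Rational.Solver using (module +-*-Solver)
  open import Data.Rational.Unnormalised.Base as ℚᵘ using (mkℚᵘ)
  import Data.Rational.Unnormalised.Properties as ℚᵘ
  open import Algebra.Definitions.RawSemiring +-*-rawSemiring using (_^_)
  open import Relation.Binary.PropositionalEquality

  open +-*-Solver using (solve; _:+_; _:*_; _:-_; :-_; _:=_; con)

  ι : ℕ → ℚ
  ι n = + n / 1

  /-≃ : ∀ a b → toℚᵘ (+ a / suc b) ℚᵘ.≃ mkℚᵘ (+ a) b
  /-≃ a b = toℚᵘ-fromℚᵘ (mkℚᵘ (+ a) b)

  /-mono : ∀ a b c d .{{_ : ℕ.NonZero b}} .{{_ : ℕ.NonZero d}} → a ℕ.* d ℕ.≤ c ℕ.* b → + a / b ≤ + c / d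
  /-mono a (suc b) c (suc d) ad≤cb = toℚᵘ-cancel-≤
    (ℚᵘ.≤-respˡ-≃ (ℚᵘ.≃-sym (/-≃ a b)) (ℚᵘ.≤-respʳ-≃ (ℚᵘ.≃-sym (/-≃ c d))
      (ℚᵘ.*≤* (subst₂ ℤ._≤_ (ℤ.pos-* a (suc d)) (ℤ.pos-* c (suc b)) (ℤ.+≤+ ad≤cb)))))

  ι-mono : ∀ {a b} → a ℕ.≤ b → ι a ≤ ι b
  ι-mono {a} {b} a≤b = /-mono a 1 b 1 (ℕ.*-monoˡ-≤ 1 a≤b)

  ι-cancel-≤ : ∀ {a b} → ι a ≤ ι b → a ℕ.≤ b
  ι-cancel-≤ {a} {b} ιa≤ιb with ℚᵘ.≤-respˡ-≃ (/-≃ a 0) (ℚᵘ.≤-respʳ-≃ (/-≃ b 0) (toℚᵘ-mono-≤ ιa≤ιb))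
  ... | ℚᵘ.*≤* p = ℤ.drop‿+≤+ (subst₂ ℤ._≤_ (ℤ.*-identityʳ (+ a)) (ℤ.*-identityʳ (+ b)) p)

  ι-+ : ∀ a b → ι (a ℕ.+ b) ≡ ι a + ι b
  ι-+ a b = toℚᵘ-injective (begin
    toℚᵘ (ι (a ℕ.+ b))              ≈⟨ /-≃ (a ℕ.+ b) 0 ⟩
    mkℚᵘ (+ (a ℕ.+ b)) 0            ≈⟨ ℚᵘ.*≡* (cong (ℤ._* + 1) (sym (cong₂ ℤ._+_ (ℤ.*-identityʳ (+ a)) (ℤ.*-identityʳ (+ b))))) ⟩
    mkℚᵘ (+ a) 0 ℚᵘ.+ mkℚᵘ (+ b) 0  ≈⟨ ℚᵘ.+-cong (/-≃ a 0) (/-≃ b 0) ⟨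
    toℚᵘ (ι a) ℚᵘ.+ toℚᵘ (ι b)      ≈⟨ toℚᵘ-homo-+ (ι a) (ι b) ⟨
    toℚᵘ (ι a + ι b)                ∎)
    where open ℚᵘ.≃-Reasoning

  /-*-/ : ∀ a b c d .{{_ : ℕ.NonZero b}} .{{_ : ℕ.NonZero d}} .{{_ : ℕ.NonZero (b ℕ.* d)}} →
    (+ a / b) * (+ c / d) ≡ + (a ℕ.* c) / (b ℕ.* d)
  /-*-/ a (suc b) c (suc d) = toℚᵘ-injective (begin
    toℚᵘ ((+ a / suc b) * (+ c / suc d))             ≈⟨ toℚᵘ-homo-* (+ a / suc b) (+ c / suc d) ⟩
    toℚᵘ (+ a / suc b) ℚᵘ.* toℚᵘ (+ c / suc d)       ≈⟨ ℚᵘ.*-cong (/-≃ a b) (/-≃ c d) ⟩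
    mkℚᵘ (+ a) b ℚᵘ.* mkℚᵘ (+ c) d                   ≈⟨ ℚᵘ.*≡* (cong (ℤ._* + (suc b ℕ.* suc d)) (sym (ℤ.pos-* a c))) ⟩
    mkℚᵘ (+ (a ℕ.* c)) (ℕ.pred (suc b ℕ.* suc d))    ≈⟨ /-≃ (a ℕ.* c) (ℕ.pred (suc b ℕ.* suc d)) ⟨
    toℚᵘ (+ (a ℕ.* c) / (suc b ℕ.* suc d))           ∎)
    where open ℚᵘ.≃-Reasoning

  /-≡ : ∀ a b c d .{{_ : ℕ.NonZero b}} .{{_ : ℕ.NonZero d}} → a ℕ.* d ≡ c ℕ.* b → + a / b ≡ + c / d
  /-≡ a b c d eq = ≤-antisym (/-mono a b c d (ℕ.≤-reflexive eq)) (/-mono c d a b (ℕ.≤-reflexive (sym eq)))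

  ι-* : ∀ a b → ι (a ℕ.* b) ≡ ι a * ι b
  ι-* a b = sym (/-*-/ a 1 b 1)

  /-*-ι : ∀ a b .{{_ : ℕ.NonZero b}} → (+ a / b) * ι b ≡ ι a
  /-*-ι a b@(suc b-1) = trans (/-*-/ a b b 1) (/-≡ (a ℕ.* b) (b ℕ.* 1) a 1
    (trans (ℕ.*-identityʳ (a ℕ.* b)) (cong (a ℕ.*_) (sym (ℕ.*-identityʳ b)))))

  0≤/ : ∀ a b .{{_ : ℕ.NonZero b}} → 0ℚ ≤ + a / b
  0≤/ a b = nonNegative⁻¹ _ {{normalize-nonNeg a b}}

  0≤ι : ∀ n → 0ℚ ≤ ι n
  0≤ι n = 0≤/ n 1

  ι-pos : ∀ n .{{_ : ℕ.NonZero n}} → Positive (ι n)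
  ι-pos n = normalize-pos n 1

  *-monoˡ-≤ : ∀ {c a b} → 0ℚ ≤ c → a ≤ b → c * a ≤ c * b
  *-monoˡ-≤ {c} 0≤c = *-monoˡ-≤-nonNeg c {{nonNegative 0≤c}}

  *-monoʳ-≤ : ∀ {c a b} → 0ℚ ≤ c → a ≤ b → a * c ≤ b * c
  *-monoʳ-≤ {c} 0≤c = *-monoʳ-≤-nonNeg c {{nonNegative 0≤c}}

  *-mono-≤ : ∀ {a b c d} → 0ℚ ≤ c → 0ℚ ≤ b → a ≤ b → c ≤ d → a * c ≤ b * d
  *-mono-≤ 0≤c 0≤b a≤b c≤d = ≤-trans (*-monoʳ-≤ 0≤c a≤b) (*-monoˡ-≤ 0≤b c≤d)

  0≤* : ∀ {a b} → 0ℚ ≤ a → 0ℚ ≤ b → 0ℚ ≤ a * b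
  0≤* {a} {b} 0≤a 0≤b = nonNegative⁻¹ _
    {{nonNeg*nonNeg⇒nonNeg a {{nonNegative 0≤a}} b {{nonNegative 0≤b}}}}

  p≤p+q : ∀ {p q} → 0ℚ ≤ q → p ≤ p + q
  p≤p+q {p} {q} 0≤q = subst (_≤ p + q) (+-identityʳ p) (+-monoʳ-≤ p 0≤q)

  0≤^ : ∀ {x} k → 0ℚ ≤ x → 0ℚ ≤ x ^ k
  0≤^ zero    0≤x = nonNegative⁻¹ 1ℚ
  0≤^ (suc k) 0≤x = 0≤* 0≤x (0≤^ k 0≤x)

  ^-mono-≤ : ∀ {x y} k → 0ℚ ≤ x → x ≤ y → x ^ k ≤ y ^ k
  ^-mono-≤ zero    0≤x x≤y = ≤-refl
  ^-mono-≤ (suc k) 0≤x x≤y = *-mono-≤ (0≤^ k 0≤x) (≤-trans 0≤x x≤y) x≤y (^-mono-≤ k 0≤x x≤y)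

  -- Partial sums of - log (1 - x), with x variable so that increments in x can be estimated;
  -- `logSum` is the case x = (d-1)/d.
  mercator : ℚ → ℕ → ℚ
  mercator x zero    = 0ℚ
  mercator x (suc M) = mercator x M + x ^ suc M * (+ 1 / suc M)

  logSum≡mercator : ∀ d .{{_ : ℕ.NonZero d}} M → logSum d M ≡ mercator (+ (d ℕ.∸ 1) / d) M
  logSum≡mercator d zero    = refl
  logSum≡mercator d (suc M) = cong (_+ logTerm d M) (logSum≡mercator d M)

  -- The derivative of `mercator` in its first argument.
  geometric : ℚ → ℕ → ℚ
  geometric y zero    = 0ℚ
  geometric y (suc M) = geometric y M + y ^ M

  geometric-sum : ∀ y M → (1ℚ - y) * geometric y M ≡ 1ℚ - y ^ M
  geometric-sum y zero    = trans (*-zeroʳ (1ℚ - y)) (sym (+-inverseʳ 1ℚ))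
  geometric-sum y (suc M) = trans (*-distribˡ-+ (1ℚ - y) (geometric y M) (y ^ M))
    (trans (cong (_+ (1ℚ - y) * y ^ M) (geometric-sum y M))
      (solve 2 (λ y p → (con 1ℚ :- p) :+ (con 1ℚ :- y) :* p := con 1ℚ :- y :* p) refl y (y ^ M)))

  power-increment : ∀ {y h} k → 0ℚ ≤ y → 0ℚ ≤ h → y ^ suc k + ι (suc k) * (h * y ^ k) ≤ (y + h) ^ suc k
  power-increment {y} {h} zero    0≤y 0≤h = ≤-reflexive
    (solve 2 (λ y h → y :* con 1ℚ :+ con 1ℚ :* (h :* con 1ℚ) := (y :+ h) :* con 1ℚ) refl y h)
  power-increment {y} {h} (suc k) 0≤y 0≤h = begin
    y * (y * y ^ k) + ι (2 ℕ.+ k) * (h * (y * y ^ k))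
      ≡⟨ cong (λ c → y * (y * y ^ k) + c * (h * (y * y ^ k))) (ι-+ 1 (suc k)) ⟩
    y * (y * y ^ k) + (1ℚ + ι (suc k)) * (h * (y * y ^ k))
      ≤⟨ p≤p+q (0≤* (0≤ι (suc k)) (0≤* 0≤h (0≤* 0≤h (0≤^ k 0≤y)))) ⟩
    y * (y * y ^ k) + (1ℚ + ι (suc k)) * (h * (y * y ^ k)) + ι (suc k) * (h * (h * y ^ k))
      ≡⟨ solve 4 (λ y h c p → y :* (y :* p) :+ (con 1ℚ :+ c) :* (h :* (y :* p)) :+ c :* (h :* (h :* p))
                            := (y :+ h) :* (y :* p :+ c :* (h :* p))) refl y h (ι (suc k)) (y ^ k) ⟩
    (y + h) * (y * y ^ k + ι (suc k) * (h * y ^ k))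
      ≤⟨ *-monoˡ-≤ (≤-trans 0≤y (p≤p+q 0≤h)) (power-increment k 0≤y 0≤h) ⟩
    (y + h) * (y + h) ^ suc k ∎
    where open ≤-Reasoning

  -- Convexity on the nonnegative axis: the polynomial lies above its tangent at `y`. The proof is
  -- termwise, by the same fact for powers.
  mercator-increment : ∀ {y h} M → 0ℚ ≤ y → 0ℚ ≤ h →
    mercator y M + h * geometric y M ≤ mercator (y + h) M
  mercator-increment {y} {h} zero    0≤y 0≤h = ≤-reflexive (trans (+-identityˡ _) (*-zeroʳ h))
  mercator-increment {y} {h} (suc M) 0≤y 0≤h = begin
    (mercator y M + y ^ suc M * c) + h * (geometric y M + y ^ M)
      ≡⟨ solve 5 (λ m p h g q → (m :+ p) :+ h :* (g :+ q) := (m :+ h :* g) :+ (p :+ con 1ℚ :* (h :* q)))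
           refl (mercator y M) (y ^ suc M * c) h (geometric y M) (y ^ M) ⟩
    (mercator y M + h * geometric y M) + (y ^ suc M * c + 1ℚ * (h * y ^ M))
      ≡⟨ cong (λ z → (mercator y M + h * geometric y M) + (y ^ suc M * c + z * (h * y ^ M))) (sym (/-*-ι 1 (suc M))) ⟩
    (mercator y M + h * geometric y M) + (y ^ suc M * c + c * ι (suc M) * (h * y ^ M))
      ≡⟨ cong (λ z → mercator y M + h * geometric y M + z)
           (solve 4 (λ p c n q → p :* c :+ c :* n :* q := (p :+ n :* q) :* c) refl (y ^ suc M) c (ι (suc M)) (h * y ^ M)) ⟩
    (mercator y M + h * geometric y M) + (y ^ suc M + ι (suc M) * (h * y ^ M)) * c
      ≤⟨ +-mono-≤ (mercator-increment M 0≤y 0≤h) (*-monoʳ-≤ (0≤/ 1 (suc M)) (power-increment M 0≤y 0≤h)) ⟩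
    mercator (y + h) M + (y + h) ^ suc M * c ∎
    where
    open ≤-Reasoning
    c = + 1 / suc M

  mercator-mono : ∀ {y z} M → 0ℚ ≤ y → y ≤ z → mercator y M ≤ mercator z M
  mercator-mono zero    0≤y y≤z = ≤-refl
  mercator-mono (suc M) 0≤y y≤z = +-mono-≤ (mercator-mono M 0≤y y≤z)
    (*-monoʳ-≤ (0≤/ 1 (suc M)) (^-mono-≤ (suc M) 0≤y y≤z))

  module _ {t u : ℚ} (0≤t : 0ℚ ≤ t) (0≤u : 0ℚ ≤ u) (t+u≡1 : t + u ≡ 1ℚ) where

    u^≤1 : ∀ j → u ^ j ≤ 1ℚ
    u^≤1 zero    = ≤-refl
    u^≤1 (suc j) = ≤-trans (*-mono-≤ (0≤^ j 0≤u) (nonNegative⁻¹ 1ℚ)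
        (subst (u ≤_) (trans (+-comm u t) t+u≡1) (p≤p+q 0≤t)) (u^≤1 j))
      (≤-reflexive (*-identityˡ 1ℚ))

    0≤1-u^ : ∀ j → 0ℚ ≤ 1ℚ - u ^ j
    0≤1-u^ j = subst (_≤ 1ℚ - u ^ j) (+-inverseʳ (u ^ j)) (+-monoˡ-≤ (- (u ^ j)) (u^≤1 j))

    next : ∀ j → (1ℚ - u ^ j) + t * u ^ j ≡ 1ℚ - u ^ suc j
    next j = begin
      (1ℚ - u ^ j) + t * u ^ j
        ≡⟨ solve 2 (λ t p → (con 1ℚ :- p) :+ t :* p := con 1ℚ :+ t :* p :- con 1ℚ :* p) refl t (u ^ j) ⟩
      1ℚ + t * u ^ j - 1ℚ * u ^ j
        ≡⟨ cong (λ z → 1ℚ + t * u ^ j - z * u ^ j) t+u≡1 ⟨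
      1ℚ + t * u ^ j - (t + u) * u ^ j
        ≡⟨ solve 3 (λ t u p → con 1ℚ :+ t :* p :- (t :+ u) :* p := con 1ℚ :- u :* p) refl t u (u ^ j) ⟩
      1ℚ - u * u ^ j ∎
      where open ≡-Reasoning

    -- Passing from 1 - u^j to 1 - u^(j+1) raises - log (1 - y) by - log u ≥ t.
    mercator-lower : ∀ j {x} M → 1ℚ - u ^ j ≤ x → ι j * (t * (1ℚ - x ^ M)) ≤ mercator (1ℚ - u ^ j) M
    mercator-lower zero {x} M _ = ≤-trans (≤-reflexive (*-zeroˡ (t * (1ℚ - x ^ M)))) (0≤mercator M)
      where
      0≤mercator : ∀ M → 0ℚ ≤ mercator (1ℚ - 1ℚ) M
      0≤mercator zero    = ≤-refl
      0≤mercator (suc M) = ≤-trans (0≤mercator M)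
        (p≤p+q (0≤* (0≤^ (suc M) (≤-reflexive (sym (+-inverseʳ 1ℚ)))) (0≤/ 1 (suc M))))
    mercator-lower (suc j) {x} M y′≤x = begin
      ι (suc j) * (t * (1ℚ - x ^ M))
        ≡⟨ cong (_* (t * (1ℚ - x ^ M))) (ι-+ 1 j) ⟩
      (1ℚ + ι j) * (t * (1ℚ - x ^ M))
        ≡⟨ solve 2 (λ c w → (con 1ℚ :+ c) :* w := c :* w :+ w) refl (ι j) (t * (1ℚ - x ^ M)) ⟩
      ι j * (t * (1ℚ - x ^ M)) + t * (1ℚ - x ^ M)
        ≤⟨ +-mono-≤ (mercator-lower j M y≤x) (*-monoˡ-≤ 0≤t
             (+-monoʳ-≤ 1ℚ (neg-antimono-≤ (^-mono-≤ M (0≤1-u^ j) y≤x)))) ⟩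
      mercator y M + t * (1ℚ - y ^ M)
        ≡⟨ cong (λ z → mercator y M + t * z) (geometric-sum y M) ⟨
      mercator y M + t * ((1ℚ - y) * geometric y M)
        ≡⟨ cong (λ z → mercator y M + z) (solve 3 (λ t p g → t :* ((con 1ℚ :- (con 1ℚ :- p)) :* g) := (t :* p) :* g)
             refl t (u ^ j) (geometric y M)) ⟩
      mercator y M + (t * u ^ j) * geometric y M
        ≤⟨ mercator-increment M (0≤1-u^ j) 0≤tu^ ⟩
      mercator (y + t * u ^ j) M
        ≡⟨ cong (λ z → mercator z M) (next j) ⟩
      mercator (1ℚ - u ^ suc j) M ∎
      where
      open ≤-Reasoning
      y = 1ℚ - u ^ j
      0≤tu^ : 0ℚ ≤ t * u ^ j
      0≤tu^ = 0≤* 0≤t (0≤^ j 0≤u)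
      y≤x : y ≤ x
      y≤x = ≤-trans (p≤p+q 0≤tu^) (≤-trans (≤-reflexive (next j)) y′≤x)

  /-+-/ : ∀ a b c .{{_ : ℕ.NonZero c}} → a ℕ.+ b ≡ c → (+ a / c) + (+ b / c) ≡ 1ℚ
  /-+-/ a b c refl = ≤-antisym (cancel (≤-reflexive eq)) (cancel (≤-reflexive (sym eq)))
    where
    cancel : ∀ {p q} → p * ι c ≤ q * ι c → p ≤ q
    cancel = *-cancelʳ-≤-pos (ι c) {{ι-pos c}}
    eq : ((+ a / c) + (+ b / c)) * ι c ≡ 1ℚ * ι c
    eq = trans (*-distribʳ-+ (ι c) (+ a / c) (+ b / c))
      (trans (cong₂ _+_ (/-*-ι a c) (/-*-ι b c)) (trans (sym (ι-+ a b)) (sym (*-identityˡ (ι c)))))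

  ι-^ : ∀ a b j .{{_ : ℕ.NonZero b}} → (+ a / b) ^ j * ι (b ℕ.^ j) ≡ ι (a ℕ.^ j)
  ι-^ a b zero    = refl
  ι-^ a b (suc j) = trans (cong ((+ a / b) * (+ a / b) ^ j *_) (ι-* b (b ℕ.^ j)))
    (trans (solve 4 (λ x p b q → x :* p :* (b :* q) := (x :* b) :* (p :* q)) refl (+ a / b) ((+ a / b) ^ j) (ι b) (ι (b ℕ.^ j)))
      (trans (cong₂ _*_ (/-*-ι a b) (ι-^ a b j)) (sym (ι-* a (a ℕ.^ j)))))

  -- An explicit rate x^M ≤ (d+1)/(d+1+M), since each further factor x outweighs the growth of d + 1
  -- + M by one. It says how many terms of the series suffice.
  power-decay : ∀ d M → let x = + d / suc d in x ^ M * ι (suc d ℕ.+ M) ≤ ι (suc d)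
  power-decay d zero    = ≤-reflexive (trans (*-identityˡ _) (cong ι (ℕ.+-identityʳ (suc d))))
  power-decay d (suc M) = begin
    x * x ^ M * ι (suc d ℕ.+ suc M)
      ≡⟨ solve 3 (λ x p c → x :* p :* c := p :* (x :* c)) refl x (x ^ M) (ι (suc d ℕ.+ suc M)) ⟩
    x ^ M * (x * ι (suc d ℕ.+ suc M))
      ≤⟨ *-monoˡ-≤ (0≤^ M (0≤/ d (suc d))) step ⟩
    x ^ M * ι (suc d ℕ.+ M)
      ≤⟨ power-decay d M ⟩
    ι (suc d) ∎
    where
    open ≤-Reasoning
    x = + d / suc d
    step : x * ι (suc d ℕ.+ suc M) ≤ ι (suc d ℕ.+ M)
    step = *-cancelʳ-≤-pos (ι (suc d)) {{ι-pos (suc d)}} (begin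
      x * ι (suc d ℕ.+ suc M) * ι (suc d)
        ≡⟨ solve 3 (λ x a b → x :* a :* b := (x :* b) :* a) refl x (ι (suc d ℕ.+ suc M)) (ι (suc d)) ⟩
      x * ι (suc d) * ι (suc d ℕ.+ suc M)
        ≡⟨ cong (_* ι (suc d ℕ.+ suc M)) (/-*-ι d (suc d)) ⟩
      ι d * ι (suc d ℕ.+ suc M)
        ≡⟨ ι-* d (suc d ℕ.+ suc M) ⟨
      ι (d ℕ.* (suc d ℕ.+ suc M))
        ≤⟨ ι-mono (ℕ.≤-trans (ℕ.m≤m+n _ (suc M)) (ℕ.≤-reflexive (expand d M))) ⟩
      ι ((suc d ℕ.+ M) ℕ.* suc d)
        ≡⟨ ι-* (suc d ℕ.+ M) (suc d) ⟩
      ι (suc d ℕ.+ M) * ι (suc d) ∎)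
      where
      expand : ∀ d M → d ℕ.* (suc d ℕ.+ suc M) ℕ.+ suc M ≡ (suc d ℕ.+ M) ℕ.* suc d
      expand = solve-∀

  -- The hypothesis says 1/d ≤ u^j, that is 1 - u^j ≤ x. The sum at x thus dominates the sum at 1 -
  -- u^j, which is at least j t (1 - x^M). The stage M ≥ (m+1) d makes x^M ≤ t, so truncating the
  -- series costs only the factor u.
  log-lower : ∀ m j d .{{_ : ℕ.NonZero d}} → suc m ℕ.^ j ℕ.≤ d ℕ.* m ℕ.^ j →
    ∀ M → suc m ℕ.* d ℕ.≤ M → ι j * ((+ 1 / suc m) * (+ m / suc m)) ≤ logSum d M
  log-lower m j d@(suc d-1) [1+m]^j≤dm^j M M-large = begin
    ι j * (t * u)
      ≤⟨ *-monoˡ-≤ (0≤ι j) (*-monoˡ-≤ 0≤t u≤1-x^M) ⟩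
    ι j * (t * (1ℚ - x ^ M))
      ≤⟨ mercator-lower 0≤t 0≤u t+u≡1 j M y≤x ⟩
    mercator (1ℚ - u ^ j) M
      ≤⟨ mercator-mono M (0≤1-u^ 0≤t 0≤u t+u≡1 j) y≤x ⟩
    mercator x M
      ≡⟨ logSum≡mercator d M ⟨
    logSum d M ∎
    where
    open ≤-Reasoning
    t u x : ℚ
    t = + 1 / suc m
    u = + m / suc m
    x = + d-1 / d
    0≤t = 0≤/ 1 (suc m)
    0≤u = 0≤/ m (suc m)
    t+u≡1 : t + u ≡ 1ℚ
    t+u≡1 = /-+-/ 1 m (suc m) refl
    complement : ∀ {p q r} → p + q ≡ 1ℚ → q ≤ r → 1ℚ - r ≤ p
    complement {p} {q} {r} p+q≡1 q≤r = begin
      1ℚ - r      ≤⟨ +-monoʳ-≤ 1ℚ (neg-antimono-≤ q≤r) ⟩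
      1ℚ - q      ≡⟨ cong (_- q) p+q≡1 ⟨
      p + q - q   ≡⟨ solve 2 (λ p q → p :+ q :- q := p) refl p q ⟩
      p           ∎
    1/d≤u^j : + 1 / d ≤ u ^ j
    1/d≤u^j = *-cancelʳ-≤-pos (ι (suc m ℕ.^ j) * ι d)
      {{pos*pos⇒pos (ι (suc m ℕ.^ j)) {{ι-pos (suc m ℕ.^ j) {{ℕ.m^n≢0 (suc m) j}}}} (ι d) {{ι-pos d}}}} (begin
      (+ 1 / d) * (ι (suc m ℕ.^ j) * ι d)
        ≡⟨ solve 3 (λ p a b → p :* (a :* b) := a :* (p :* b)) refl (+ 1 / d) (ι (suc m ℕ.^ j)) (ι d) ⟩
      ι (suc m ℕ.^ j) * ((+ 1 / d) * ι d)
        ≡⟨ trans (cong (ι (suc m ℕ.^ j) *_) (/-*-ι 1 d)) (*-identityʳ _) ⟩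
      ι (suc m ℕ.^ j)
        ≤⟨ ι-mono [1+m]^j≤dm^j ⟩
      ι (d ℕ.* m ℕ.^ j)
        ≡⟨ trans (ι-* d (m ℕ.^ j)) (*-comm (ι d) (ι (m ℕ.^ j))) ⟩
      ι (m ℕ.^ j) * ι d
        ≡⟨ cong (_* ι d) (ι-^ m (suc m) j) ⟨
      u ^ j * ι (suc m ℕ.^ j) * ι d
        ≡⟨ *-assoc (u ^ j) _ _ ⟩
      u ^ j * (ι (suc m ℕ.^ j) * ι d) ∎)
    y≤x : 1ℚ - u ^ j ≤ x
    y≤x = complement (/-+-/ d-1 1 d (ℕ.+-comm d-1 1)) 1/d≤u^j
    x^M≤t : x ^ M ≤ t
    x^M≤t = *-cancelʳ-≤-pos (ι (suc m) * ι d) {{pos*pos⇒pos (ι (suc m)) {{ι-pos (suc m)}} (ι d) {{ι-pos d}}}} (begin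
      x ^ M * (ι (suc m) * ι d)
        ≡⟨ cong (x ^ M *_) (ι-* (suc m) d) ⟨
      x ^ M * ι (suc m ℕ.* d)
        ≤⟨ *-monoˡ-≤ (0≤^ M (0≤/ d-1 d)) (ι-mono (ℕ.≤-trans M-large (ℕ.m≤n+m M d))) ⟩
      x ^ M * ι (d ℕ.+ M)
        ≤⟨ power-decay d-1 M ⟩
      ι d
        ≡⟨ *-identityˡ (ι d) ⟨
      1ℚ * ι d
        ≡⟨ cong (_* ι d) (/-*-ι 1 (suc m)) ⟨
      t * ι (suc m) * ι d
        ≡⟨ *-assoc t (ι (suc m)) (ι d) ⟩
      t * (ι (suc m) * ι d) ∎)
    u≤1-x^M : u ≤ 1ℚ - x ^ M
    u≤1-x^M = begin
      u            ≡⟨ solve 2 (λ t u → u := t :+ u :- t) refl t u ⟩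
      t + u - t    ≡⟨ cong (_- t) t+u≡1 ⟩
      1ℚ - t       ≤⟨ +-monoʳ-≤ 1ℚ (neg-antimono-≤ x^M≤t) ⟩
      1ℚ - x ^ M   ∎

-- Passage to real thresholds and to asymptotic probability

open Combinatorics using
  ( Scale; scale; level; slack; length-filter-¬; holeSize; holeSize-≤; holes-rare; hasBipartiteHole?
  ; shrink-hole; zeroForcingNumber; holeless⇒zeroForcingNumber; zeroForcing-lower)
open Mercator using
  ( ι; ι-mono; ι-cancel-≤; ι-+; ι-*; ι-pos; 0≤ι; /-mono; /-*-ι; 0≤/; *-monoˡ-≤; *-monoʳ-≤; *-mono-≤
  ; 0≤*; p≤p+q; log-lower)
open import Defs
open import Data.Integer.Base as ℤ using (+_; +[1+_])
open import Data.List.Base using (length; filter)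
open import Data.List.Relation.Binary.Sublist.Propositional.Properties using (filter-⊆)
open import Data.List.Relation.Unary.All as All using (All)
open import Data.List.Relation.Unary.All.Properties using (all-filter)
open import Data.Nat.Base as ℕ using (ℕ; zero; suc)
import Data.Nat.Properties as ℕ
open import Data.Product.Base using (_×_; _,_; proj₁; proj₂; ∃-syntax)
open import Data.Rational.Base as ℚ using (ℚ; mkℚ; 0ℚ; 1ℚ)
import Data.Rational.Properties as ℚ
open import Data.Rational.Solver using (module +-*-Solver)
open import Relation.Binary.PropositionalEquality using (_≡_; refl; sym; trans; cong; cong₂; subst)
open import Relation.Nullary using (¬_)
open import Relation.Nullary.Decidable using (¬?)
open import Relation.Unary using (Decidable)

open +-*-Solver using (solve; _:+_; _:*_; _:-_; :-_; _:=_; con)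

1/suc≤ : ∀ η → 0ℚ ℚ.< η → ∃[ n ] + 1 ℚ./ suc n ℚ.≤ η
1/suc≤ η@(mkℚ +[1+ a ] b-1 _) _ = b-1 , subst (+ 1 ℚ./ suc b-1 ℚ.≤_) (ℚ.↥p/↧p≡p η)
  (/-mono 1 (suc b-1) (suc a) (suc b-1) (ℕ.*-monoˡ-≤ (suc b-1) {1} {suc a} (ℕ.s≤s ℕ.z≤n)))
1/suc≤ (mkℚ (+ 0) _ _)        (ℚ.*<* (ℤ.+<+ ()))
1/suc≤ (mkℚ (ℤ.-[1+ _ ]) _ _) (ℚ.*<* ())

0<1/ : ∀ d .{{_ : ℕ.NonZero d}} → 0ℚ ℚ.< + 1 ℚ./ d
0<1/ d = ℚ.positive⁻¹ _ {{ℚ.normalize-pos 1 d}}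

-- The event `P` compares reals and need not be decidable. Filtering out the decidable `H` yields
-- the list of favourable graphs, and a D with 1/D ≤ δ turns rarity into probability at least 1 - δ.
rare⇒AAS : ∀ {d} {H : ∀ n → Adjacency n → Set} {P : Event} →
  (H? : ∀ n → Decidable (H n)) (N₀ : ℕ) → (∀ n → N₀ ℕ.≤ n → ∀ G → ¬ H n G → P n G) →
  (∀ D → ∃[ N ] ∀ n → N ℕ.≤ n → length (filter (H? n) (regularGraphs d n)) ℕ.* D ℕ.≤ length (regularGraphs d n)) →
  AAS d P
rare⇒AAS {d} {H} {P} H? N₀ ¬H⇒P rare δ 0<δ = N₀ ℕ.+ N , λ n n≥ _ →
  filter (λ G → ¬? (H? n G)) (regularGraphs d n) ,
  filter-⊆ (λ G → ¬? (H? n G)) (regularGraphs d n) ,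
  All.map (λ {G} → ¬H⇒P n (ℕ.≤-trans (ℕ.m≤m+n N₀ N) n≥) G) (all-filter (λ G → ¬? (H? n G)) (regularGraphs d n)) ,
  likely (length (regularGraphs d n)) (length (filter (λ G → ¬? (H? n G)) (regularGraphs d n)))
    (length (filter (H? n) (regularGraphs d n)))
    (length-filter-¬ (H? n) (regularGraphs d n))
    (proj₂ (rare (suc D-1)) n (ℕ.≤-trans (ℕ.m≤n+m N N₀) n≥))
  where
  D-1 : ℕ
  D-1 = proj₁ (1/suc≤ δ 0<δ)
  1/D≤δ : + 1 ℚ./ suc D-1 ℚ.≤ δ
  1/D≤δ = proj₂ (1/suc≤ δ 0<δ)
  N : ℕ
  N = proj₁ (rare (suc D-1))
  likely : ∀ N g b → N ≡ g ℕ.+ b → b ℕ.* suc D-1 ℕ.≤ N → (1ℚ ℚ.- δ) ℚ.* ι N ℚ.≤ ι g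
  likely N g b N≡g+b bD≤N = begin
    (1ℚ ℚ.- δ) ℚ.* ι N
      ≡⟨ solve 2 (λ δ N → (con 1ℚ :- δ) :* N := N :- δ :* N) refl δ (ι N) ⟩
    ι N ℚ.- δ ℚ.* ι N
      ≤⟨ ℚ.+-monoʳ-≤ (ι N) (ℚ.neg-antimono-≤ ιb≤δN) ⟩
    ι N ℚ.- ι b
      ≡⟨ cong (ℚ._- ι b) (trans (cong ι N≡g+b) (ι-+ g b)) ⟩
    ι g ℚ.+ ι b ℚ.- ι b
      ≡⟨ solve 2 (λ g b → g :+ b :- b := g) refl (ι g) (ι b) ⟩
    ι g ∎
    where
    open ℚ.≤-Reasoning
    ιb≤δN : ι b ℚ.≤ δ ℚ.* ι N
    ιb≤δN = begin
      ι b
        ≡⟨ trans (solve 1 (λ b → b := con 1ℚ :* b) refl (ι b)) (cong (ℚ._* ι b) (sym (/-*-ι 1 (suc D-1)))) ⟩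
      (+ 1 ℚ./ suc D-1) ℚ.* ι (suc D-1) ℚ.* ι b
        ≡⟨ trans (solve 3 (λ x y z → x :* y :* z := x :* (z :* y)) refl (+ 1 ℚ./ suc D-1) (ι (suc D-1)) (ι b))
             (cong ((+ 1 ℚ./ suc D-1) ℚ.*_) (sym (ι-* b (suc D-1)))) ⟩
      (+ 1 ℚ./ suc D-1) ℚ.* ι (b ℕ.* suc D-1)
        ≤⟨ *-mono-≤ (0≤ι (b ℕ.* suc D-1)) (ℚ.<⇒≤ 0<δ) 1/D≤δ (ι-mono bD≤N) ⟩
      δ ℚ.* ι N ∎

module _ (ε : ℝ) (E-1 : ℕ) (N₁ : ℕ) (1/E≤ε : ∀ M → N₁ ℕ.≤ M → + 1 ℚ./ suc E-1 ℚ.≤ seq ε M) where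

  private
    E = suc E-1
    -- With this choice (m/(m+1))² is at least 1 - 1/(4 E), a loss well below the gain 1/E from ε.
    -- The surplus, about 3 s / (4 E), exceeds the additive 6 once s ≥ 14 E.
    m = 8 ℕ.* E

  module _ {d : ℕ} .{{_ : ℕ.NonZero d}} (sc : Scale m (14 ℕ.* E) d) where

    open Scale sc

    Q : ℕ → ℕ
    Q = holeSize d (level sc)

    M₀ : ℕ
    M₀ = N₁ ℕ.+ suc m ℕ.* d

    -- Here 6 + s is `2 + level`, the coefficient required by both thresholds. At j = m s the
    -- logarithm is at least s (m/(m+1))², and `slack` compares this with 6 + s. From `M₀` on ε is
    -- above 1/E and the series has enough terms.
    scaled-log : ∀ M → M₀ ℕ.≤ M → ι (6 ℕ.+ s) ℚ.≤ (ι 1 ℚ.+ seq ε M) ℚ.* logSum d M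
    scaled-log M M≥M₀ = ℚ.≤-trans clear (*-mono-≤ 0≤log 0≤1+ε
      (ℚ.+-monoʳ-≤ (ι 1) 1/E≤εM) (log-lower m (m ℕ.* s) d ρ^s≤d M (ℕ.≤-trans (ℕ.m≤n+m _ N₁) M≥M₀)))
      where
      open ℚ.≤-Reasoning
      t = + 1 ℚ./ suc m
      u = + m ℚ./ suc m
      w = + 1 ℚ./ E
      1/E≤εM = 1/E≤ε M (ℕ.≤-trans (ℕ.m≤m+n N₁ _) M≥M₀)
      0≤log : 0ℚ ℚ.≤ ι (m ℕ.* s) ℚ.* (t ℚ.* u)
      0≤log = 0≤* (0≤ι (m ℕ.* s)) (0≤* (0≤/ 1 (suc m)) (0≤/ m (suc m)))
      0≤1+ε : 0ℚ ℚ.≤ ι 1 ℚ.+ seq ε M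
      0≤1+ε = ℚ.≤-trans (0≤ι 1) (p≤p+q (ℚ.≤-trans (0≤/ 1 E) 1/E≤εM))
      clear : ι (6 ℕ.+ s) ℚ.≤ (ι 1 ℚ.+ w) ℚ.* (ι (m ℕ.* s) ℚ.* (t ℚ.* u))
      clear = ℚ.*-cancelʳ-≤-pos (ι (E ℕ.* (suc m ℕ.* suc m))) {{ι-pos (E ℕ.* (suc m ℕ.* suc m))}} (begin
        ι (6 ℕ.+ s) ℚ.* ι (E ℕ.* (suc m ℕ.* suc m))
          ≡⟨ ι-* (6 ℕ.+ s) (E ℕ.* (suc m ℕ.* suc m)) ⟨
        ι ((6 ℕ.+ s) ℕ.* (E ℕ.* (suc m ℕ.* suc m)))
          ≤⟨ ι-mono (slack E s lo≤s) ⟩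
        ι (suc E ℕ.* (m ℕ.* s ℕ.* (1 ℕ.* m)))
          ≡⟨ trans (ι-* (suc E) (m ℕ.* s ℕ.* (1 ℕ.* m))) (cong₂ ℚ._*_
               (trans (ι-+ 1 E) (trans (ℚ.+-comm (ι 1) (ι E)) (cong (ι E ℚ.+_) (sym (/-*-ι 1 E)))))
               (trans (ι-* (m ℕ.* s) (1 ℕ.* m)) (cong (ι (m ℕ.* s) ℚ.*_) (trans (ι-* 1 m)
                 (cong₂ ℚ._*_ (sym (/-*-ι 1 (suc m))) (sym (/-*-ι m (suc m)))))))) ⟩
        (ι E ℚ.+ w ℚ.* ι E) ℚ.* (ι (m ℕ.* s) ℚ.* ((t ℚ.* ι (suc m)) ℚ.* (u ℚ.* ι (suc m))))
          ≡⟨ solve 6 (λ e w j t u p → (e :+ w :* e) :* (j :* ((t :* p) :* (u :* p)))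
                                   := (con 1ℚ :+ w) :* (j :* (t :* u)) :* (e :* (p :* p)))
               refl (ι E) w (ι (m ℕ.* s)) t u (ι (suc m)) ⟩
        (1ℚ ℚ.+ w) ℚ.* (ι (m ℕ.* s) ℚ.* (t ℚ.* u)) ℚ.* (ι E ℚ.* (ι (suc m) ℚ.* ι (suc m)))
          ≡⟨ cong ((1ℚ ℚ.+ w) ℚ.* (ι (m ℕ.* s) ℚ.* (t ℚ.* u)) ℚ.*_)
               (trans (cong (ι E ℚ.*_) (sym (ι-* (suc m) (suc m)))) (sym (ι-* E (suc m ℕ.* suc m)))) ⟩
        (ι 1 ℚ.+ w) ℚ.* (ι (m ℕ.* s) ℚ.* (t ℚ.* u)) ℚ.* ι (E ℕ.* (suc m ℕ.* suc m)) ∎)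

    threshold⇒holeSize≤ : ∀ {n q} → d ℕ.< n →
      (fromℕ 1 + ε) * (fromℕ 2 * fromℕ n * log d / d) ≤ fromℕ q → Q n ℕ.≤ q
    threshold⇒holeSize≤ {n} {q} d<n below =
      holeSize-≤ sc d<n (ι-cancel-≤ (begin
        ι (2 ℕ.* n ℕ.* (6 ℕ.+ s))
          ≡⟨ trans (ι-* (2 ℕ.* n) (6 ℕ.+ s)) (cong (ℚ._* ι (6 ℕ.+ s)) (ι-* 2 n)) ⟩
        ι 2 ℚ.* ι n ℚ.* ι (6 ℕ.+ s)
          ≤⟨ *-monoˡ-≤ (0≤* (0≤ι 2) (0≤ι n)) (scaled-log M (ℕ.m≤m+n M₀ N)) ⟩
        ι 2 ℚ.* ι n ℚ.* (X ℚ.* S)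
          ≡⟨ trans (solve 1 (λ z → z := z :* con 1ℚ) refl _) (cong (ι 2 ℚ.* ι n ℚ.* (X ℚ.* S) ℚ.*_) (sym (/-*-ι 1 d))) ⟩
        ι 2 ℚ.* ι n ℚ.* (X ℚ.* S) ℚ.* (Y ℚ.* ι d)
          ≡⟨ solve 6 (λ a b x s y d → a :* b :* (x :* s) :* (y :* d) := x :* (a :* b :* s :* y) :* d)
               refl (ι 2) (ι n) X S Y (ι d) ⟩
        X ℚ.* (ι 2 ℚ.* ι n ℚ.* S ℚ.* Y) ℚ.* ι d
          -- The real inequality is used at one stage with tolerance 1/d, which becomes 1 after
          -- multiplication by d.
          ≤⟨ *-monoʳ-≤ (0≤ι d) (proj₂ (below Y (0<1/ d)) M (ℕ.m≤n+m N M₀)) ⟩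
        (ι q ℚ.+ Y) ℚ.* ι d
          ≡⟨ trans (ℚ.*-distribʳ-+ (ι d) (ι q) Y) (cong₂ ℚ._+_ (sym (ι-* q d)) (/-*-ι 1 d)) ⟩
        ι (q ℕ.* d) ℚ.+ ι 1
          ≡⟨ ι-+ (q ℕ.* d) 1 ⟨
        ι (q ℕ.* d ℕ.+ 1) ∎))
      where
      open ℚ.≤-Reasoning
      Y = + 1 ℚ./ d
      N M : ℕ
      N = proj₁ (below Y (0<1/ d))
      M = M₀ ℕ.+ N
      X S : ℚ
      X = ι 1 ℚ.+ seq ε M
      S = logSum d M

    zeroForcing-threshold : ∀ {n z} → d ℕ.< n → n ℕ.≤ z ℕ.+ 2 ℕ.* Q n →
      fromℕ n * (fromℕ 1 - (fromℕ 1 + ε) * (fromℕ 4 * log d / d)) ≤ fromℕ z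
    -- From `M₀` on the rational inequality holds without error, so this stage serves every η.
    zeroForcing-threshold {n} {z} d<n n≤z+2Q η 0<η = M₀ , λ M M≥M₀ →
      let X = ι 1 ℚ.+ seq ε M
          S = logSum d M
      in ℚ.≤-trans {j = ι z} (ℚ.*-cancelʳ-≤-pos (ι d) {{ι-pos d}} (begin
        ι n ℚ.* (ι 1 ℚ.- X ℚ.* (ι 4 ℚ.* S ℚ.* Y)) ℚ.* ι d
          ≡⟨ solve 6 (λ n x f s y d → n :* (con 1ℚ :- x :* (f :* s :* y)) :* d := n :* d :- f :* n :* (x :* s) :* (y :* d))
               refl (ι n) X (ι 4) S Y (ι d) ⟩
        ι n ℚ.* ι d ℚ.- ι 4 ℚ.* ι n ℚ.* (X ℚ.* S) ℚ.* (Y ℚ.* ι d)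
          ≡⟨ cong₂ ℚ._-_ (sym (ι-* n d)) (trans (cong (ι 4 ℚ.* ι n ℚ.* (X ℚ.* S) ℚ.*_) (/-*-ι 1 d)) (ℚ.*-identityʳ _)) ⟩
        ι (n ℕ.* d) ℚ.- ι 4 ℚ.* ι n ℚ.* (X ℚ.* S)
          ≤⟨ ℚ.+-mono-≤ (ι-mono (zeroForcing-lower sc {n} {z} d<n n≤z+2Q))
               (ℚ.neg-antimono-≤ (*-monoˡ-≤ (0≤* (0≤ι 4) (0≤ι n)) (scaled-log M M≥M₀))) ⟩
        ι (z ℕ.* d ℕ.+ 4 ℕ.* n ℕ.* (6 ℕ.+ s)) ℚ.- ι 4 ℚ.* ι n ℚ.* ι (6 ℕ.+ s)
          ≡⟨ cong (ℚ._- ι 4 ℚ.* ι n ℚ.* ι (6 ℕ.+ s)) (trans (ι-+ (z ℕ.* d) _) (cong₂ ℚ._+_ (ι-* z d)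
               (trans (ι-* (4 ℕ.* n) (6 ℕ.+ s)) (cong (ℚ._* ι (6 ℕ.+ s)) (ι-* 4 n))))) ⟩
        ι z ℚ.* ι d ℚ.+ ι 4 ℚ.* ι n ℚ.* ι (6 ℕ.+ s) ℚ.- ι 4 ℚ.* ι n ℚ.* ι (6 ℕ.+ s)
          ≡⟨ solve 2 (λ a b → a :+ b :- b := a) refl (ι z ℚ.* ι d) (ι 4 ℚ.* ι n ℚ.* ι (6 ℕ.+ s)) ⟩
        ι z ℚ.* ι d ∎)) (p≤p+q (ℚ.<⇒≤ 0<η))
      where
      open ℚ.≤-Reasoning
      Y = + 1 ℚ./ d

    -- Both events follow from the absence of holes of the one size `Q n`, for n above d.
    conclusion :
      AAS d (λ n G → ∀ (q : ℕ) →
        (fromℕ 1 + ε) * (fromℕ 2 * fromℕ n * log d / d) ≤ fromℕ q →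
        ¬ HasBipartiteHole G q)
      ×
      AAS d (λ n G → ∃[ z ] IsZeroForcingNumber G z ×
        fromℕ n * (fromℕ 1 - (fromℕ 1 + ε) * (fromℕ 4 * log d / d)) ≤ fromℕ z)
    conclusion =
      rare⇒AAS hole? (suc d) (λ n d<n G ¬hole q above hole → ¬hole (shrink-hole G (threshold⇒holeSize≤ d<n above) hole))
        (holes-rare sc) ,
      rare⇒AAS hole? (suc d) (λ n d<n G ¬hole → let z , isZ = zeroForcingNumber G in
          z , isZ , zeroForcing-threshold d<n (holeless⇒zeroForcingNumber G ¬hole isZ))
        (holes-rare sc)
      where
      hole? : ∀ n → Decidable (λ (G : Adjacency n) → HasBipartiteHole G (Q n))
      hole? n = hasBipartiteHole? (Q n)

mainTheorem2 : ∀ (ε : ℝ) → fromℕ 0 < ε →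
    ∃[ d₀ ] ∀ (d : ℕ) .{{_ : ℕ.NonZero d}} → d₀ ℕ.≤ d →
    AAS d (λ n G → ∀ (q : ℕ) →
    (fromℕ 1 + ε) * (fromℕ 2 * fromℕ n * log d / d) ≤ fromℕ q →
    ¬ HasBipartiteHole G q)
    ×
    AAS d (λ n G → ∃[ z ] IsZeroForcingNumber G z ×
    fromℕ n * (fromℕ 1 - (fromℕ 1 + ε) * (fromℕ 4 * log d / d)) ≤ fromℕ z)
mainTheorem2 ε (η , 0<η , N , η≤ε) =
  -- The numerator of ρ^(14 E), an integer upper bound for it. It forces s ≥ 14 E, which `slack`
  -- requires, and 14 E ≥ 14 serves `quadratic≤2^`.
  (suc m ℕ.^ m) ℕ.^ (14 ℕ.* suc E-1) , λ d d-large → conclusion ε E-1 N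
    (λ M M≥N → ℚ.≤-trans (proj₂ (1/suc≤ η 0<η)) (ℚ.≤-trans (ℚ.≤-reflexive (sym (ℚ.+-identityˡ η))) (η≤ε M M≥N)))
    (scale m (ℕ.m≤m*n 14 (suc E-1)) d-large)
  where
  E-1 m : ℕ
  E-1 = proj₁ (1/suc≤ η 0<η)
  m = 8 ℕ.* suc E-1
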